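{- Let $n\geq 2$, $q=p^h$ with $p$ prime and $h\geq 2$, and $1\leq k\leq n-1$. Suppose that $p\geq 11$, $q^k\geq 239$, and let $\delta=\frac{q^k}{200}-\theta_{k-1}-\frac32$. Let $\mathcal{H}(n,n-k,q)$ be the hypergraph whose vertices are the points of $\mathrm{PG}(n,q)$ and whose hyperedges are the $(n-k)$-dimensional subspaces. Then any rainbow-free strict $N$-coloring of $\mathcal{H}(n,n-k,q)$ with \[N\geq \theta_n-2\theta_k+1-\delta\] has a monochromatic $2$-transversal, i.e., a color class meeting every $(n-k)$-dimensional subspace in at least two points.
   Context: For a hypergraph $\mathcal{H}=(V;E)$, a strict $N$-coloring is a partition of $V$ into exactly $N$ nonempty color classes. A hyperedge is rainbow if no two of its vertices have the same color; a coloring is rainbow-free if no hyperedge is rainbow. A $2$-transversal is a vertex set meeting every hyperedge in at least $2$ vertices. Dimensions are projective, and $\theta_m=\frac{q^{m+1}-1}{q-1}$ is the number of points of an $m$-dimensional projective space of order $q$. -}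

module Defs where

open import Level using (0ℓ)
open import Data.Nat using (ℕ; zero; suc; _^_) renaming (_+_ to _+ℕ_)
open import Data.Fin using (Fin; zero; suc)
open import Data.Product using (Σ; ∃; _×_; _,_)
open import Relation.Nullary using (¬_)
open import Relation.Binary.PropositionalEquality using (_≡_)
open import Algebra.Bundles using (CommutativeRing)

-- θ m = 1 + q + ... + q^m  (number of points of PG(m,q))
θ : ℕ → ℕ → ℕ
θ q zero    = 1
θ q (suc m) = θ q m +ℕ q ^ suc m

record FiniteField (q : ℕ) : Set₁ where
  field
    cring : CommutativeRing 0ℓ 0ℓ
  open CommutativeRing cring public
  field
    1≉0     : ¬ (1# ≈ 0#)
    inverse : ∀ x → ¬ (x ≈ 0#) → ∃ λ y → x * y ≈ 1#
    enum      : Fin q → Carrier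
    enum-inj  : ∀ i j → enum i ≈ enum j → i ≡ j
    enum-surj : ∀ x → ∃ λ i → enum i ≈ x

module Geometry {q : ℕ} (F : FiniteField q) where
  open FiniteField F using (Carrier; _≈_; _+_; _*_; 0#; 1#)

  Vect : ℕ → Set
  Vect m = Fin m → Carrier

  ∑ : ∀ {d} → (Fin d → Carrier) → Carrier
  ∑ {zero}  f = 0#
  ∑ {suc d} f = f zero + ∑ (λ j → f (suc j))

  NonZeroVec : ∀ {m} → Vect m → Set
  NonZeroVec v = ¬ (∀ i → v i ≈ 0#)

  -- points of PG(n,q): nonzero vectors of F^(n+1) (up to scalars, see _∼_)
  record Point (n : ℕ) : Set where
    constructor pt
    field
      vec     : Vect (suc n)
      nonzero : NonZeroVec vec
  open Point public

  -- two points are equal iff their vectors are proportional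
  _∼_ : ∀ {n} → Point n → Point n → Set
  P ∼ Q = ∃ λ c → ¬ (c ≈ 0#) × (∀ i → vec Q i ≈ c * vec P i)

  lincomb : ∀ {d m} → (Fin d → Carrier) → (Fin d → Vect m) → Vect m
  lincomb c B i = ∑ (λ j → c j * B j i)

  LinIndep : ∀ {d m} → (Fin d → Vect m) → Set
  LinIndep B = ∀ c → (∀ i → lincomb c B i ≈ 0#) → ∀ j → c j ≈ 0#

  -- an r-dimensional (projective) subspace of PG(n,q), given by a basis
  -- of r+1 linearly independent vectors of F^(n+1)
  record Subspace (n r : ℕ) : Set where
    field
      basis : Fin (suc r) → Vect (suc n)
      indep : LinIndep basis
  open Subspace public

  _∈S_ : ∀ {n r} → Point n → Subspace n r → Set
  P ∈S S = ∃ λ c → ∀ i → vec P i ≈ lincomb c (basis S) i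

  record Coloring (n N : ℕ) : Set where
    field
      col      : Point n → Fin N
      col-resp : ∀ P Q → P ∼ Q → col P ≡ col Q
  open Coloring public

  Strict : ∀ {n N} → Coloring n N → Set
  Strict {n} {N} χ = ∀ (c : Fin N) → ∃ λ (P : Point n) → col χ P ≡ c

  RainbowFree : ∀ {n N} → ℕ → Coloring n N → Set
  RainbowFree {n} r χ = ∀ (S : Subspace n r) →
    ∃ λ (P : Point n) → ∃ λ (Q : Point n) →
      P ∈S S × Q ∈S S × ¬ (P ∼ Q) × col χ P ≡ col χ Q

  Mono2Transversal : ∀ {n N} → ℕ → Coloring n N → Fin N → Set
  Mono2Transversal {n} r χ c = ∀ (S : Subspace n r) →
    ∃ λ (P : Point n) → ∃ λ (Q : Point n) →
      P ∈S S × Q ∈S S × ¬ (P ∼ Q) × col χ P ≡ c × col χ Q ≡ c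

-- Write Q = q ^ k and represent the subspaces of codimension at most k as kernels of k × (n + 1) matrices M.
-- With d = θ_n − N, the sum of |C| − 1 over the colour classes C, the hypothesis gives 50 (d + 1) ≤ 101 Q.
--
-- Averaging over all M the number of points and of pairs of equally coloured points in ker M shows that one class C
-- takes nearly everything: the excess ρ of the other classes satisfies 10 ρ ≤ 3 Q.
--
-- Let D be the union of the other classes with at least two points, so that C ∪ D meets every ker M twice.
-- The points of D are discarded one at a time. If the kernels are no longer met twice, choose a failing M
-- with as few points of D as possible, and add to the remaining points those of D off ker M.
-- The resulting list A has exactly one point in ker M, and at least two in the kernel of each M + e ⊗ (x a + y b), for e ≠ 0,
-- (x, y) ≠ (0, 0) and suitable linear forms a and b. For fixed e, the points of A with M v ∈ ⟨e⟩ become lines of AG(2, q)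
-- that cover every point but the origin twice, and the origin once; the derivative of the product of these lines
-- shows that there are at least 3 q − 2 of them. Summing over ⟨e⟩ gives |A| ≥ 3 Q − 2, which contradicts
-- |A| ≤ |C| + 4 ρ − 1. So C alone meets every kernel twice.
module Submission where

open import Defs using (FiniteField)
open import Data.Nat using (ℕ)
open import Level using (0ℓ)
open import Data.Fin using (Fin)
open import Data.Product using (∃)
open import Algebra using (Op₁; Op₂; IsCommutativeRing; CommutativeRing)
open import Relation.Binary.PropositionalEquality
open import Data.Maybe using (nothing)
import Tactic.RingSolver.Core.AlmostCommutativeRing as ACR

-- Two forms are used because one would not do: with the updates M + e ⊗ x a alone the lines become
-- points of AG(1, q), and the count stops near |A| ≥ 2 Q, while |C| itself may slightly exceed 2 Q.
-- The plane supplies the missing Q. Let P be the point just discarded, P₀ the only remaining point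
-- in ker M, and P′ ≠ P a point of D in ker M. The choices a P = 0 and b P ≠ 0 make every update
-- with y ≠ 0 expel P; such a kernel is met twice, because it was so before P was discarded. For y =
-- 0 the choice a P′ ≠ 0 expels P′; by the minimality of M such a kernel either is met twice already
-- or gains a point of D off ker M, which is why those points are added to the list. Finally a P₀ ≠
-- 0 makes the derivative of the product nonzero at the origin.
--
-- The factor 4 has two sources: a class of c ≥ 2 points has c ≤ 2 (c - 1), so |D| ≤ 2 ρ, and the
-- list uses D at most twice.

-- A field carried by Fin q itself, so that its equality is _≡_ and vectors over it are decidable.
record FinField (q : ℕ) : Set where
  infixl 6 _⊕_
  infixl 7 _⊗_
  infix 8 ⊖_
  field
    _⊕_ _⊗_ : Op₂ (Fin q)
    ⊖_ : Op₁ (Fin q)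
    0k 1k : Fin q
    isCommutativeRing : IsCommutativeRing _≡_ _⊕_ _⊗_ ⊖_ 0k 1k
    1≢0 : 1k ≢ 0k
    inverse : ∀ x → x ≢ 0k → ∃ λ y → x ⊗ y ≡ 1k

  commutativeRing : CommutativeRing 0ℓ 0ℓ
  commutativeRing = record { isCommutativeRing = isCommutativeRing }

  solverRing : ACR.AlmostCommutativeRing 0ℓ 0ℓ
  solverRing = ACR.fromCommutativeRing commutativeRing (λ _ → nothing)

-- The carrier of `F` is a setoid, so the geometry is moved along `ι` to vectors over `Fin q`; `ε`
-- turns computed vectors back into points and bases.
record Coordinates {q : ℕ} (F : FiniteField q) (K : FinField q) : Set where
  open FiniteField F using (Carrier; _≈_; _+_; _*_; 0#)
  open FinField K using (_⊕_; _⊗_; 0k)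
  field
    ι : Carrier → Fin q
    ε : Fin q → Carrier
    ι-cong : ∀ {x y} → x ≈ y → ι x ≡ ι y
    ε-ι : ∀ x → ε (ι x) ≈ x
    ι-ε : ∀ i → ι (ε i) ≡ i
    ι-+ : ∀ x y → ι (x + y) ≡ ι x ⊕ ι y
    ι-* : ∀ x y → ι (x * y) ≡ ι x ⊗ ι y
    ι-0 : ι 0# ≡ 0k

-- Finite field arithmetic, up to Fermat's identity

module Field {q : ℕ} (K : FinField q) where
  open import Data.Nat using (zero; suc)
  open import Data.Nat using () renaming (_+_ to _+ℕ_; _*_ to _*ℕ_)
  open import Data.Fin using (Fin; _≟_)
  open import Data.Product using (_×_; _,_)
  open import Data.Empty using (⊥-elim)
  open import Function using (id)
  open import Data.Fin.Properties using (suc-injective)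
  open import Data.Fin.Permutation using (Permutation; permutation; _⟨$⟩ʳ_)
  open import Relation.Nullary using (yes; no)
  open import Relation.Binary.PropositionalEquality
  open FinField K
  import Tactic.RingSolver.NonReflective as NR
  open import Algebra using (CommutativeRing; CommutativeMonoid)
  open CommutativeRing commutativeRing public using (+-identityˡ; +-identityʳ; +-comm; +-assoc; *-comm; *-assoc; *-identityˡ; *-identityʳ; zeroˡ; zeroʳ; -‿inverseˡ; -‿inverseʳ)

  open import Algebra.Properties.Ring (CommutativeRing.ring commutativeRing) using (-‿distribˡ-*; -‿distribʳ-*; -‿involutive; -0#≈0#)
  open import Algebra.Properties.AbelianGroup (CommutativeRing.+-abelianGroup commutativeRing) using (⁻¹-∙-comm)
  open import Algebra.Properties.Semiring.Mult (CommutativeRing.semiring commutativeRing) using (×-homo-+; ×1-homo-*) renaming (_×_ to _·_) public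
  open import Algebra.Bundles.Raw using (RawRing)
  open import Algebra.Solver.Ring.AlmostCommutativeRing using (fromCommutativeRing; _-Raw-AlmostCommutative⟶_)
  open import Data.Maybe using (Maybe; just; nothing)
  import Data.Nat as ℕ
  import Algebra.Solver.Ring as RS
  open import Level using (0ℓ)

  -- The solver needs coefficients on which cancellation is decidable: formal differences of naturals.
  private
    ℕ² : RawRing 0ℓ 0ℓ
    ℕ² = record { Carrier = ℕ × ℕ ; _≈_ = _≡_ ; 0# = 0 , 0 ; 1# = 1 , 0
      ; _+_ = λ (a , b) (c , d) → a +ℕ c , b +ℕ d
      ; _*_ = λ (a , b) (c , d) → a *ℕ c +ℕ b *ℕ d , a *ℕ d +ℕ b *ℕ c
      ; -_ = λ (a , b) → b , a }

    module _ where
      open NR solverRing using (solve; _⊜_) renaming (_⊕_ to _:+_; _⊗_ to _:*_)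

      interchange : ∀ a b c d → (a ⊕ c) ⊕ (b ⊕ d) ≡ (a ⊕ b) ⊕ (c ⊕ d)
      interchange = solve 4 (λ a b c d → ((a :+ c) :+ (b :+ d)) ⊜ ((a :+ b) :+ (c :+ d))) refl

      expand : ∀ a b c d → (a ⊗ c ⊕ b ⊗ d) ⊕ (a ⊗ d ⊕ b ⊗ c) ≡ (a ⊕ b) ⊗ (c ⊕ d)
      expand = solve 4 (λ a b c d → ((a :* c :+ b :* d) :+ (a :* d :+ b :* c)) ⊜ ((a :+ b) :* (c :+ d))) refl

      rot : ∀ a d e f → ((a ⊕ d) ⊕ e) ⊕ f ≡ (a ⊕ f) ⊕ (d ⊕ e)
      rot = solve 4 (λ a d e f → (((a :+ d) :+ e) :+ f) ⊜ ((a :+ f) :+ (d :+ e))) refl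

    value : ℕ × ℕ → Fin q
    value (a , b) = (a · 1k) ⊕ ⊖ (b · 1k)

    morphism : ℕ² -Raw-AlmostCommutative⟶ fromCommutativeRing commutativeRing
    morphism = record
      { ⟦_⟧ = value
      ; +-homo = λ (a , b) (c , d) → trans
          (cong₂ (λ x y → x ⊕ ⊖ y) (×-homo-+ 1k a c) (×-homo-+ 1k b d))
          (trans (cong (a · 1k ⊕ c · 1k ⊕_) (sym (⁻¹-∙-comm _ _))) (interchange _ _ _ _))
      ; *-homo = λ (a , b) (c , d) → trans
          (cong₂ (λ x y → x ⊕ ⊖ y)
            (trans (×-homo-+ 1k (a *ℕ c) (b *ℕ d)) (cong₂ _⊕_ (×1-homo-* a c)
              (trans (×1-homo-* b d) (neg² _ _))))
            (trans (×-homo-+ 1k (a *ℕ d) (b *ℕ c)) (cong₂ _⊕_ (×1-homo-* a d) (×1-homo-* b c))))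
          (trans (cong₂ _⊕_ refl (trans (sym (⁻¹-∙-comm _ _)) (cong₂ _⊕_ (-‿distribʳ-* _ _) (-‿distribˡ-* _ _))))
            (expand _ _ _ _))
      ; -‿homo = λ (a , b) → trans (+-comm _ _) (trans (cong (⊖ (a · 1k) ⊕_) (sym (-‿involutive _))) (⁻¹-∙-comm _ _))
      ; 0-homo = -‿inverseʳ 0k
      ; 1-homo = trans (cong₂ _⊕_ (+-identityʳ 1k) -0#≈0#) (+-identityʳ 1k) }
      where
      neg² : ∀ x y → x ⊗ y ≡ (⊖ x) ⊗ (⊖ y)
      neg² x y = trans (sym (-‿involutive _)) (trans (cong ⊖_ (-‿distribʳ-* x y)) (-‿distribˡ-* x (⊖ y)))

    -- The differences a - b and c - d are compared as a + d and c + b, so that cancelling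
    -- coefficients are recognised whichever naturals represent them.
    dec : (u v : ℕ × ℕ) → Maybe (value u ≡ value v)
    dec (a , b) (c , d) with a +ℕ d ℕ.≟ c +ℕ b
    ... | no _ = nothing
    ... | yes e = just (trans (sym (+-identityʳ _)) (trans (cong₂ _⊕_ refl (sym (-‿inverseʳ (d · 1k))))
      (trans (sym (rot (a · 1k) (d · 1k) (⊖ (d · 1k)) (⊖ (b · 1k))))
      (trans (cong₂ _⊕_ (cong₂ _⊕_ (trans (sym (×-homo-+ 1k a d)) (trans (cong (_· 1k) e)
          (×-homo-+ 1k c b))) refl) refl)
      (trans (swap-last _ _ _ _) (trans (cong₂ _⊕_ refl (-‿inverseʳ (b · 1k))) (+-identityʳ _)))))))
      where
      swap-last : ∀ c b e f → ((c ⊕ b) ⊕ e) ⊕ f ≡ (c ⊕ e) ⊕ (b ⊕ f)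
      swap-last c b e f = trans (+-assoc _ _ _) (trans (+-assoc _ _ _) (trans (cong (c ⊕_)
        (trans (sym (+-assoc b e f)) (trans (cong (_⊕ f) (+-comm b e)) (+-assoc e b f)))) (sym (+-assoc _ _ _))))

  open RS ℕ² (fromCommutativeRing commutativeRing) morphism dec public
    using (solve; _:+_; _:*_; :-_; _:=_; con; _:-_)

  module _ (M : CommutativeMonoid 0ℓ 0ℓ) where
    open CommutativeMonoid M using (_≈_; ε; ∙-cong; ∙-congˡ; identityˡ; identityʳ) renaming (Carrier to A; trans to ≈-trans; refl to ≈-refl)
    open import Algebra.Properties.CommutativeMonoid.Sum M using () renaming (sum to sumᴹ)

    sum-ε : ∀ {n} (f : Fin n → A) → (∀ j → f j ≈ ε) → sumᴹ f ≈ ε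
    sum-ε {zero} f h = ≈-refl
    sum-ε {suc n} f h = ≈-trans (∙-cong (h Fin.zero) (sum-ε _ (λ j → h (Fin.suc j)))) (identityˡ ε)

    -- Kept over an arbitrary commutative monoid, because it serves both the sums over the plane and
    -- the multiplicative product in `fermat`.
    sum-single : ∀ {n} (i : Fin n) (f : Fin n → A) → (∀ j → j ≢ i → f j ≈ ε) → sumᴹ f ≈ f i
    sum-single Fin.zero f h = ≈-trans (∙-congˡ (sum-ε _ (λ j → h (Fin.suc j) λ ()))) (identityʳ _)
    sum-single (Fin.suc i) f h = ≈-trans (∙-cong (h Fin.zero λ ()) (sum-single i _ (λ j ne → h (Fin.suc j) (λ e → ne
        (suc-injective e))))) (identityˡ _)

  open import Algebra.Properties.CommutativeMonoid.Sum (CommutativeRing.+-commutativeMonoid commutativeRing)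
    using (sum; ∑-distrib-+; sum-permute; sum-cong-≗; sum-replicate) public
  open import Algebra.Properties.Semiring.Sum (CommutativeRing.semiring commutativeRing) using (*-distribˡ-sum; *-distribʳ-sum) public
  import Algebra.Properties.CommutativeMonoid.Sum (CommutativeRing.*-commutativeMonoid commutativeRing) as ∏

  x⊖x : ∀ x → x ⊕ ⊖ x ≡ 0k
  x⊖x = -‿inverseʳ

  x⊖y≡0⇒x≡y : ∀ {x y} → x ⊕ ⊖ y ≡ 0k → x ≡ y
  x⊖y≡0⇒x≡y {x} {y} e = trans (solve 2 (λ x y → x := (x :+ :- y) :+ y) refl x y) (trans (cong (_⊕ y) e)
      (+-identityˡ y))

  ⊗-cancel : ∀ {x y} → x ≢ 0k → x ⊗ y ≡ 0k → y ≡ 0k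
  ⊗-cancel {x} {y} x≢0 e with inverse x x≢0
  ... | u , xu = trans (sym (*-identityˡ y)) (trans (cong (_⊗ y) (sym xu))
    (trans (solve 3 (λ x u y → (x :* u) :* y := u :* (x :* y)) refl x u y) (trans (cong (u ⊗_) e) (zeroʳ u))))

  ⊗-nonzero : ∀ {x y} → x ≢ 0k → y ≢ 0k → x ⊗ y ≢ 0k
  ⊗-nonzero x≢0 y≢0 e = y≢0 (⊗-cancel x≢0 e)

  infixr 9 _↑_
  _↑_ : Fin q → ℕ → Fin q
  x ↑ zero = 1k
  x ↑ suc m = x ⊗ x ↑ m

  ↑-+ : ∀ x m n → x ↑ (m +ℕ n) ≡ x ↑ m ⊗ x ↑ n
  ↑-+ x zero n = sym (*-identityˡ _)
  ↑-+ x (suc m) n = trans (cong (x ⊗_) (↑-+ x m n)) (sym (*-assoc _ _ _))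

  ↑-⊗ : ∀ x y m → (x ⊗ y) ↑ m ≡ x ↑ m ⊗ y ↑ m
  ↑-⊗ x y zero = sym (*-identityˡ _)
  ↑-⊗ x y (suc m) = trans (cong (x ⊗ y ⊗_) (↑-⊗ x y m)) (solve 4 (λ a b c d → a :* b :* (c :* d) := a :* c :*
      (b :* d)) refl x y (x ↑ m) (y ↑ m))

  shift : Permutation q q
  shift = permutation (_⊕ 1k) (_⊕ ⊖ 1k)
    (λ x → solve 2 (λ x o → x :+ :- o :+ o := x) refl x 1k)
    (λ x → solve 2 (λ x o → x :+ o :+ :- o := x) refl x 1k)

  scale : ∀ t → t ≢ 0k → Permutation q q
  scale t t≢0 with inverse t t≢0
  ... | u , tu = permutation (t ⊗_) (u ⊗_) (λ x → trans (sym (*-assoc _ _ _)) (trans (cong (_⊗ x) tu)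
      (*-identityˡ x)))
    (λ x → trans (solve 3 (λ u t x → u :* (t :* x) := t :* u :* x) refl u t x) (trans (cong (_⊗ x) tu)
        (*-identityˡ x)))

  scale-eval : ∀ t t≢0 x → scale t t≢0 ⟨$⟩ʳ x ≡ t ⊗ x
  scale-eval t t≢0 x with inverse t t≢0
  ... | u , tu = refl

  -- Translation by 1 permutes the field, so the sum of all x equals the sum of all x + 1, which
  -- exceeds it by q · 1.
  q·1≡0 : q · 1k ≡ 0k
  q·1≡0 = trans (sym (sum-replicate q)) (trans (solve 2 (λ s o → o := (s :+ o) :+ :- s) refl (sum id) ones)
      (trans (cong (λ z → z ⊕ ⊖ sum id) (trans (sym (∑-distrib-+ id _)) (sym (sum-permute id shift)))) (x⊖x _)))
    where ones = sum {q} (λ _ → 1k)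

  -- Reindexing by x ↦ t x. As soon as t ↑ m ≠ 1 for some t, this forces the power sum to vanish.
  pow-sum-scale : ∀ t → t ≢ 0k → ∀ m → t ↑ m ⊗ sum (_↑ m) ≡ sum (_↑ m)
  pow-sum-scale t t≢0 m = trans (*-distribˡ-sum (t ↑ m) (_↑ m)) (trans
    (sum-cong-≗ (λ x → trans (sym (↑-⊗ t x m)) (cong (_↑ m) (sym (scale-eval t t≢0 x)))))
    (sym (sum-permute (_↑ m) (scale t t≢0))))

  ∏-nonzero : ∀ {n} (f : Fin n → Fin q) → (∀ i → f i ≢ 0k) → ∏.sum f ≢ 0k
  ∏-nonzero {zero} f h = 1≢0
  ∏-nonzero {suc n} f h = ⊗-nonzero (h Fin.zero) (∏-nonzero _ (λ i → h (Fin.suc i)))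

  ∏-replicate : ∀ n t → ∏.sum {n} (λ _ → t) ≡ t ↑ n
  ∏-replicate zero t = refl
  ∏-replicate (suc n) t = cong (t ⊗_) (∏-replicate n t)

  ifzero : Fin q → Fin q → Fin q → Fin q
  ifzero x a b with x ≟ 0k
  ... | yes _ = a
  ... | no _ = b

  ifzero-yes : ∀ {x} a b → x ≡ 0k → ifzero x a b ≡ a
  ifzero-yes {x} a b e with x ≟ 0k
  ... | yes _ = refl
  ... | no n = ⊥-elim (n e)

  ifzero-no : ∀ {x} a b → x ≢ 0k → ifzero x a b ≡ b
  ifzero-no {x} a b n with x ≟ 0k
  ... | yes e = ⊥-elim (n e)
  ... | no _ = refl

  -- Multiplication by t permutes the nonzero elements, so it fixes their product.
  fermat : ∀ t → t ≢ 0k → t ↑ q ≡ t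
  fermat t t≢0 = trans (sym (∏-replicate q t)) (trans (∏.sum-cong-≗ gh) (trans (∏.∑-distrib-+ g h)
      (trans (cong₂ _⊗_ ∏g≡1 ∏h≡t) (*-identityˡ t))))
    where
    -- `f` is the identity with 0 replaced by 1, so that its product is nonzero and can be
    -- cancelled; `g` and `h` split the constant t into its occurrences at nonzero elements and the
    -- one at 0.
    f g h : Fin q → Fin q
    f x = ifzero x 1k x
    g x = ifzero x 1k t
    h x = ifzero x t 1k
    gh : ∀ x → t ≡ g x ⊗ h x
    gh x with x ≟ 0k
    ... | yes _ = sym (*-identityˡ t)
    ... | no _ = sym (*-identityʳ t)
    gf : ∀ x → f (t ⊗ x) ≡ g x ⊗ f x
    gf x with x ≟ 0k
    ... | yes e = trans (ifzero-yes _ _ (trans (cong (t ⊗_) e) (zeroʳ t))) (sym (*-identityˡ 1k))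
    ... | no n = ifzero-no _ _ (⊗-nonzero t≢0 n)
    f≢0 : ∀ x → f x ≢ 0k
    f≢0 x with x ≟ 0k
    ... | yes _ = 1≢0
    ... | no n = n
    ∏h≡t : ∏.sum h ≡ t
    ∏h≡t = trans (sum-single (CommutativeRing.*-commutativeMonoid commutativeRing) 0k h (λ j ne → ifzero-no _ _ ne))
        (ifzero-yes _ _ refl)
    ∏f : ∏.sum f ≡ ∏.sum g ⊗ ∏.sum f
    ∏f = trans (∏.sum-permute f (scale t t≢0)) (trans (∏.sum-cong-≗ (λ x → trans (cong f (scale-eval t t≢0 x))
        (gf x))) (∏.∑-distrib-+ g f))
    ∏g≡1 : ∏.sum g ≡ 1k
    ∏g≡1 = x⊖y≡0⇒x≡y (⊗-cancel (∏-nonzero f f≢0) (trans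
      (solve 3 (λ f g o → f :* (g :+ :- o) := g :* f :+ :- (o :* f)) refl (∏.sum f) (∏.sum g) 1k)
      (trans (cong₂ (λ x y → x ⊕ ⊖ y) (sym ∏f) (*-identityˡ _)) (x⊖x _))))

  ⊕-congˡ : ∀ {x y z} → y ≡ z → x ⊕ y ≡ x ⊕ z
  ⊕-congˡ = cong (_ ⊕_)

  ⊕-congʳ : ∀ {x y z} → y ≡ z → y ⊕ x ≡ z ⊕ x
  ⊕-congʳ = cong (_⊕ _)

  ⊗-congˡ : ∀ {x y z} → y ≡ z → x ⊗ y ≡ x ⊗ z
  ⊗-congˡ = cong (_ ⊗_)

  ⊗-congʳ : ∀ {x y z} → y ≡ z → y ⊗ x ≡ z ⊗ x
  ⊗-congʳ = cong (_⊗ _)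

-- Power sums and double covers of the affine plane by lines

module Lines {q : ℕ} (K : FinField q) where
  open import Data.Nat using (zero; suc; _≤_; _<_; s≤s; z≤n; _∸_; _≤?_)
  import Data.Nat
  open import Data.Nat using () renaming (_+_ to _+ℕ_; _*_ to _*ℕ_; _≟_ to _≟ℕ_)
  import Data.Nat.Properties as ℕP
  open import Data.Fin using (Fin; _≟_)
  open import Data.Product using (∃; _×_; _,_; proj₁)
  open import Data.List using (List; []; _∷_; length; filter; allFin)
  open import Data.List.Properties using (length-tabulate; filter-all)
  open import Data.List.Relation.Unary.All using (All; []; _∷_)
  import Data.List.Relation.Unary.All as All
  import Data.List.Relation.Unary.All.Properties as AllP
  open import Data.List.Relation.Unary.AllPairs using ([]; _∷_)
  open import Data.List.Relation.Unary.Unique.Propositional using (Unique)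
  import Data.List.Relation.Unary.Unique.Propositional.Properties as UP
  open import Data.Fin.Properties using (any?)
  open import Data.Empty using (⊥-elim)
  open import Relation.Nullary using (¬_; yes; no; ¬?; Dec)
  open import Relation.Nullary.Decidable using (_×-dec_)
  open import Relation.Binary.PropositionalEquality
  open import Algebra using (CommutativeRing)
  open FinField K
  open Field K

  -- The polynomial functions of degree less than L, described without coefficients: at every a
  -- there is a difference quotient of degree less than L - 1. This is precisely what counting roots
  -- consumes.
  Deg : ℕ → (Fin q → Fin q) → Set
  Deg zero f = ∀ x → f x ≡ 0k
  Deg (suc L) f = ∀ a → ∃ λ g → Deg L g × ∀ x → f x ≡ f a ⊕ (x ⊕ ⊖ a) ⊗ g x

  Deg-zero : ∀ L → Deg L (λ _ → 0k)
  Deg-zero zero x = refl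
  Deg-zero (suc L) a = (λ _ → 0k) , Deg-zero L , λ x → sym (trans (+-identityˡ _) (zeroʳ _))

  Deg-const : ∀ L c → Deg (suc L) (λ _ → c)
  Deg-const L c a = (λ _ → 0k) , Deg-zero L , λ x → sym (trans (cong (c ⊕_) (zeroʳ _)) (+-identityʳ c))

  Deg-suc : ∀ L {f} → Deg L f → Deg (suc L) f
  Deg-suc zero h a = (λ _ → 0k) , Deg-zero 0 , λ x → trans (h x) (sym (trans (cong₂ _⊕_ (h a) (zeroʳ _))
      (+-identityʳ 0k)))
  Deg-suc (suc L) h a with h a
  ... | g , dg , e = g , Deg-suc L dg , e

  Deg-add : ∀ L {f g} → Deg L f → Deg L g → Deg L (λ x → f x ⊕ g x)
  Deg-add zero hf hg x = trans (cong₂ _⊕_ (hf x) (hg x)) (+-identityʳ 0k)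
  Deg-add (suc L) hf hg a with hf a | hg a
  ... | u , du , eu | v , dv , ev = (λ x → u x ⊕ v x) , Deg-add L du dv , λ x → trans (cong₂ _⊕_ (eu x) (ev x))
    (solve 5 (λ fa ga d u v → fa :+ d :* u :+ (ga :+ d :* v) := fa :+ ga :+ d :* (u :+ v)) refl _ _ _ _ _)

  Deg-scale : ∀ L c {f} → Deg L f → Deg L (λ x → c ⊗ f x)
  Deg-scale zero c h x = trans (cong (c ⊗_) (h x)) (zeroʳ c)
  Deg-scale (suc L) c h a with h a
  ... | u , du , eu = (λ x → c ⊗ u x) , Deg-scale L c du , λ x → trans (cong (c ⊗_) (eu x))
    (solve 4 (λ c fa d u → c :* (fa :+ d :* u) := c :* fa :+ d :* (c :* u)) refl c _ _ _)

  Deg-↑ : ∀ m → Deg (suc m) (_↑ m)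
  Deg-↑ zero = Deg-const 0 1k
  Deg-↑ (suc m) a with Deg-↑ m a
  ... | g , dg , e = (λ x → x ↑ m ⊕ a ⊗ g x) , Deg-add (suc m) (Deg-↑ m) (Deg-suc m (Deg-scale m a dg)) , λ x →
    trans (cong (x ⊗_) (e x)) (trans
     (solve 4 (λ x a p g → x :* (p :+ (x :- a) :* g) := a :* p :+ (x :- a) :* (p :+
         (x :- a) :* g :+ a :* g)) refl x a (a ↑ m) (g x))
     (cong (λ z → a ⊗ a ↑ m ⊕ (x ⊕ ⊖ a) ⊗ (z ⊕ a ⊗ g x)) (sym (e x))))

  -- The root a is divided out. The other roots differ from a, hence remain roots of the quotient,
  -- and the degree runs out no later than the roots do.
  Deg-roots : ∀ L {f} → Deg L f → ∀ l → Unique l → All (λ x → f x ≡ 0k) l → L ≤ length l → ∀ x → f x ≡ 0k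
  Deg-roots zero d l u h le = d
  Deg-roots (suc L) {f} d (a ∷ l) (a∉l ∷ u) (fa ∷ h) (s≤s le) x with d a
  ... | g , dg , e = trans (f≡ x) (trans (⊗-congˡ (Deg-roots L dg l u (All.zipWith (λ (ne , fy) → g≡0 ne fy)
      (a∉l , h)) le x)) (zeroʳ _))
    where
    f≡ : ∀ x → f x ≡ (x ⊕ ⊖ a) ⊗ g x
    f≡ x = trans (e x) (trans (⊕-congʳ fa) (+-identityˡ _))
    g≡0 : ∀ {y} → a ≢ y → f y ≡ 0k → g y ≡ 0k
    g≡0 {y} ne fy = ⊗-cancel (λ z → ne (sym (x⊖y≡0⇒x≡y z))) (trans (sym (f≡ y)) fy)

  length-filter-≢ : ∀ {n} (a : Fin n) l → Unique l → length l ≤ suc (length (filter (λ x → ¬? (x ≟ a)) l))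
  length-filter-≢ a [] u = z≤n
  length-filter-≢ a (x ∷ l) (x∉l ∷ u) with x ≟ a
  ... | yes refl = s≤s (ℕP.≤-reflexive (sym (cong length (filter-all (λ x → ¬? (x ≟ a)) (All.map (λ n e → n
      (sym e)) x∉l)))))
  ... | no _ = s≤s (length-filter-≢ a l u)

  -- For a positive exponent m, either some nonzero t has t ↑ m ≠ 1 and scaling by t kills the sum,
  -- or x ↑ m - 1 has all q - 1 > m nonzero elements as roots, hence vanishes at 0 as well, which
  -- makes 1 equal to 0.
  pow-sum≡0 : ∀ m → suc m < q → sum (_↑ m) ≡ 0k
  pow-sum≡0 zero lt = trans (sum-replicate q) q·1≡0
  pow-sum≡0 (suc m) lt with any? (λ t → ¬? (t ≟ 0k) ×-dec ¬? (t ↑ suc m ≟ 1k))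
  ... | yes (t , t≢0 , tm≢1) = ⊗-cancel (λ z → tm≢1 (x⊖y≡0⇒x≡y z)) (trans
     (solve 3 (λ p o s → (p :- o) :* s := p :* s :- o :* s) refl (t ↑ suc m) 1k S)
     (trans (cong₂ (λ x y → x ⊕ ⊖ y) (pow-sum-scale t t≢0 (suc m)) (*-identityˡ S)) (x⊖x S)))
     where S = sum (_↑ suc m)
  ... | no none = ⊥-elim (1≢0 (trans (sym (x⊖y≡0⇒x≡y at0)) (zeroˡ (0k ↑ m))))
    where
    nonzero = filter (λ x → ¬? (x ≟ 0k)) (allFin q)
    vanish : ∀ {x} → x ≢ 0k → x ↑ suc m ⊕ ⊖ 1k ≡ 0k
    vanish {x} n with x ↑ suc m ≟ 1k
    ... | yes e = trans (⊕-congʳ e) (x⊖x 1k)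
    ... | no ne = ⊥-elim (none (x , n , ne))
    at0 : 0k ↑ suc m ⊕ ⊖ 1k ≡ 0k
    at0 = Deg-roots (suc (suc m)) (Deg-add (suc (suc m)) (Deg-↑ (suc m)) (Deg-const (suc m) (⊖ 1k))) nonzero
      (UP.filter⁺ (λ x → ¬? (x ≟ 0k)) (UP.allFin⁺ q)) (All.map vanish (AllP.all-filter (λ x → ¬? (x ≟ 0k))
          (allFin q)))
      (ℕP.≤-pred (ℕP.≤-trans (ℕP.≤-trans lt (ℕP.≤-reflexive (sym (length-tabulate {n = q} (λ x → x)))))
          (length-filter-≢ 0k (allFin q) (UP.allFin⁺ q)))) 0k

  -- Fermat replaces the exponent q + r by r + 1, and m ≤ 2 q - 3 brings r + 1 down to at most q -
  -- 2. The gap left between the two ranges is m = q - 1, where the power sum is - 1.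
  pow-sum≡0′ : ∀ m → q ≤ m → m +ℕ 3 ≤ 2 *ℕ q → sum (_↑ m) ≡ 0k
  pow-sum≡0′ m q≤m le = trans (sum-cong-≗ reduce) (pow-sum≡0 (suc r) lt)
    where
    r = m ∸ q
    eq : q +ℕ r ≡ m
    eq = ℕP.m+[n∸m]≡n q≤m
    lt : suc (suc r) < q
    lt = ℕP.+-cancelˡ-≤ q _ _ (ℕP.≤-trans (ℕP.≤-reflexive (trans (sym (ℕP.+-assoc q 3 r)) (trans (cong (_+ℕ r)
        (ℕP.+-comm q 3))
       (trans (cong (3 +ℕ_) eq) (ℕP.+-comm 3 m))))) (ℕP.≤-trans le (ℕP.≤-reflexive (cong (q +ℕ_)
           (ℕP.+-identityʳ q)))))
    nonZero = Data.Nat.>-nonZero (ℕP.≤-trans (s≤s z≤n) lt)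
    q↑ : ∀ x → x ↑ q ≡ x
    q↑ x with x ≟ 0k
    ... | no ne = fermat x ne
    ... | yes refl = trans (cong (0k ↑_) (sym (ℕP.suc-pred q ⦃ nonZero ⦄))) (zeroˡ _)
    reduce : ∀ x → x ↑ m ≡ x ↑ suc r
    reduce x = trans (cong (x ↑_) (sym eq)) (trans (↑-+ x q r) (cong (_⊗ x ↑ r) (q↑ x)))

  d↑ : ℕ → Fin q → Fin q
  d↑ zero x = 0k
  d↑ (suc i) x = suc i · 1k ⊗ x ↑ i

  d↑-suc : ∀ i x → d↑ (suc i) x ≡ x ⊗ d↑ i x ⊕ x ↑ i
  d↑-suc zero x = trans (cong (_⊗ 1k) (+-identityʳ 1k)) (trans (*-identityʳ 1k) (sym (trans (cong (_⊕ 1k) (zeroʳ x))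
      (+-identityˡ 1k))))
  d↑-suc (suc i) x = trans (solve 4 (λ o n x p → (o :+ n) :* (x :* p) := x :* (n :* p) :+ o :* (x :* p)) refl 1k
      (suc i · 1k) x (x ↑ i))
    (⊕-congˡ (*-identityˡ _))

  -- The exponent q - 1 is the one bad case up to 2 q - 3, and there the coefficient i = q is zero.
  -- Differentiating thus extends the vanishing range from i ≤ q - 2 to i ≤ 2 q - 2, and the extra q
  -- is what turns a bound near 2 q into one near 3 q.
  d↑-sum≡0 : ∀ i → i +ℕ 2 ≤ 2 *ℕ q → sum (d↑ i) ≡ 0k
  d↑-sum≡0 zero le = sum-ε (CommutativeRing.+-commutativeMonoid commutativeRing) {q} _ (λ _ → refl)
  d↑-sum≡0 (suc m) le = trans (sym (*-distribˡ-sum {q} (suc m · 1k) (_↑ m))) (cases (suc m ≤? q))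
    where
    cases : Dec (suc m ≤ q) → suc m · 1k ⊗ sum (_↑ m) ≡ 0k
    cases (no n) = trans (⊗-congˡ (pow-sum≡0′ m (ℕP.≤-pred (ℕP.≰⇒> n)) (ℕP.≤-trans (ℕP.≤-reflexive
        (ℕP.+-suc m 2)) le))) (zeroʳ _)
    cases (yes sm≤q) with suc m ≟ℕ q
    ... | yes e = trans (⊗-congʳ (cong (_· 1k) e)) (trans (⊗-congʳ q·1≡0) (zeroˡ _))
    ... | no ne = trans (⊗-congˡ (pow-sum≡0 m (ℕP.≤∧≢⇒< sm≤q ne))) (zeroʳ _)

  -- Degenerate triples, with a zero linear part, are included: a point on which both forms vanish
  -- produces one.
  Line : Set
  Line = Fin q × Fin q × Fin q

  ev : Line → Fin q → Fin q → Fin q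
  ev (a , b , c) x y = a ⊗ x ⊕ b ⊗ y ⊕ c

  Π ∂Π : List Line → Fin q → Fin q → Fin q
  Π [] x y = 1k
  Π (g ∷ gs) x y = ev g x y ⊗ Π gs x y
  ∂Π [] x y = 0k
  ∂Π (g ∷ gs) x y = proj₁ g ⊗ Π gs x y ⊕ ev g x y ⊗ ∂Π gs x y

  -- The derivative of x ↑ i ⊗ y ↑ j ⊗ Π gs x y with respect to x.
  D : ℕ → ℕ → List Line → Fin q → Fin q → Fin q
  D i j gs x y = d↑ i x ⊗ y ↑ j ⊗ Π gs x y ⊕ x ↑ i ⊗ y ↑ j ⊗ ∂Π gs x y

  -- Multiplying a monomial by a x + b y + c gives three monomials, and differentiation is linear. A
  -- line is thereby traded for one degree of the monomial, and the product never has to be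
  -- expanded.
  D-∷ : ∀ i j a b c gs x y → D i j ((a , b , c) ∷ gs) x y ≡ (a ⊗ D (suc i) j gs x y ⊕ b ⊗ D i
      (suc j) gs x y) ⊕ c ⊗ D i j gs x y
  D-∷ i j a b c gs x y = trans
    (solve 10 (λ a b c x y d xi yj p p′ →
        d :* yj :* ((a :* x :+ b :* y :+ c) :* p) :+ xi :* yj :* (a :* p :+ (a :* x :+ b :* y :+ c) :* p′)
        := (a :* ((x :* d :+ xi) :* yj :* p :+ x :* xi :* yj :* p′) :+ b :* (d :* (y :* yj) :* p :+ xi :*
            (y :* yj) :* p′)) :+ c :* (d :* yj :* p :+ xi :* yj :* p′))
      refl a b c x y (d↑ i x) (x ↑ i) (y ↑ j) (Π gs x y) (∂Π gs x y))
    (cong (λ z → (a ⊗ (z ⊗ y ↑ j ⊗ Π gs x y ⊕ x ↑ suc i ⊗ y ↑ j ⊗ ∂Π gs x y) ⊕ b ⊗ D i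
        (suc j) gs x y) ⊕ c ⊗ D i j gs x y) (sym (d↑-suc i x)))

  ∬ : (Fin q → Fin q → Fin q) → Fin q
  ∬ f = sum (λ x → sum (λ y → f x y))

  ∬-cong : ∀ {f g : Fin q → Fin q → Fin q} → (∀ x y → f x y ≡ g x y) → ∬ f ≡ ∬ g
  ∬-cong h = sum-cong-≗ (λ x → sum-cong-≗ (h x))

  ∬-⊕ : ∀ f g → ∬ (λ x y → f x y ⊕ g x y) ≡ ∬ f ⊕ ∬ g
  ∬-⊕ f g = trans (sum-cong-≗ (λ x → ∑-distrib-+ (f x) (g x))) (∑-distrib-+ (λ x → sum (f x)) (λ x → sum (g x)))

  ∬-⊗ : ∀ a f → ∬ (λ x y → a ⊗ f x y) ≡ a ⊗ ∬ f
  ∬-⊗ a f = trans (sum-cong-≗ (λ x → sym (*-distribˡ-sum a (f x)))) (sym (*-distribˡ-sum {q} a _))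

  ∬-product : ∀ (f g : Fin q → Fin q) → ∬ (λ x y → f x ⊗ g y) ≡ sum f ⊗ sum g
  ∬-product f g = trans (sum-cong-≗ (λ x → sym (*-distribˡ-sum (f x) g))) (sym (*-distribʳ-sum (sum g) f))

  -- The number of lines plus the degree of the monomial never increases along the induction. For a
  -- bare monomial, i + j ≤ 3 q - 3: either j ≤ q - 2 and the sum over y vanishes, or i ≤ 2 q - 2
  -- and the sum over x of the derivative vanishes.
  ∬D≡0 : ∀ gs i j → length gs +ℕ (i +ℕ j) +ℕ 3 ≤ 3 *ℕ q → ∬ (D i j gs) ≡ 0k
  ∬D≡0 [] i j le = trans (∬-cong (λ x y → trans (cong₂ _⊕_ (*-identityʳ _) (zeroʳ _)) (+-identityʳ _)))
    (trans (∬-product (d↑ i) (_↑ j)) (cases (suc (suc j) ≤? q)))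
    where
    cases : Dec (suc (suc j) ≤ q) → sum (d↑ i) ⊗ sum (_↑ j) ≡ 0k
    cases (yes lt) = trans (⊗-congˡ (pow-sum≡0 j lt)) (zeroʳ _)
    cases (no ge) = trans (⊗-congʳ (d↑-sum≡0 i (ℕP.+-cancelˡ-≤ q _ _ (ℕP.≤-trans (ℕP.+-monoˡ-≤ (i +ℕ 2) (ℕP.≤-pred
        (ℕP.≰⇒> ge))) (ℕP.≤-trans (ℕP.≤-reflexive eq) le))))) (zeroˡ _)
      where
      open import Data.Nat.Solver using (module +-*-Solver)
      eq : suc j +ℕ (i +ℕ 2) ≡ i +ℕ j +ℕ 3
      eq = +-*-Solver.solve 2 (λ i j → +-*-Solver.con 1 +-*-Solver.:+ j +-*-Solver.:+
          (i +-*-Solver.:+ +-*-Solver.con 2) +-*-Solver.:= i +-*-Solver.:+ j +-*-Solver.:+ +-*-Solver.con 3) refl i j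
  ∬D≡0 ((a , b , c) ∷ gs) i j le = trans (∬-cong (D-∷ i j a b c gs)) (trans (∬-⊕ _ _)
    (trans (cong₂ _⊕_ (trans (∬-⊕ _ _) (cong₂ _⊕_
       (vanish a (suc i) j (ℕP.≤-trans (ℕP.≤-reflexive (cong (_+ℕ 3) (ℕP.+-suc (length gs) _))) le))
       (vanish b i (suc j) (ℕP.≤-trans (ℕP.≤-reflexive (cong (_+ℕ 3) (trans (cong (length gs +ℕ_) (ℕP.+-suc i j))
           (ℕP.+-suc (length gs) _)))) le))))
       (vanish c i j (ℕP.≤-trans (ℕP.n≤1+n _) le)))
     (trans (+-identityʳ _) (+-identityʳ _))))
    where
    vanish : ∀ a i j → length gs +ℕ (i +ℕ j) +ℕ 3 ≤ 3 *ℕ q → ∬ (λ x y → a ⊗ D i j gs x y) ≡ 0k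
    vanish a i j le = trans (∬-⊗ a (D i j gs)) (trans (cong (a ⊗_) (∬D≡0 gs i j le)) (zeroʳ a))

  δ : Fin q → ℕ
  δ x with x ≟ 0k
  ... | yes _ = 1
  ... | no _ = 0

  zeros : List Line → Fin q → Fin q → ℕ
  zeros [] x y = 0
  zeros (g ∷ gs) x y = δ (ev g x y) +ℕ zeros gs x y

  Π≡0 : ∀ gs x y → 1 ≤ zeros gs x y → Π gs x y ≡ 0k
  Π≡0 (g ∷ gs) x y h with ev g x y ≟ 0k
  ... | yes e = trans (⊗-congʳ e) (zeroˡ _)
  ... | no _ = trans (⊗-congˡ (Π≡0 gs x y h)) (zeroʳ _)

  -- Each summand of Leibniz' rule omits one factor only, so two vanishing factors leave a zero in
  -- all of them.
  ∂Π≡0 : ∀ gs x y → 2 ≤ zeros gs x y → ∂Π gs x y ≡ 0k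
  ∂Π≡0 (g ∷ gs) x y h with ev g x y ≟ 0k
  ... | yes e = trans (cong₂ _⊕_ (trans (⊗-congˡ (Π≡0 gs x y (ℕP.≤-pred h))) (zeroʳ _)) (trans (⊗-congʳ e)
      (zeroˡ _))) (+-identityʳ 0k)
  ... | no _ = trans (cong₂ _⊕_ (trans (⊗-congˡ (Π≡0 gs x y (ℕP.≤-trans (ℕP.n≤1+n 1) h))) (zeroʳ _)) (trans (⊗-congˡ
      (∂Π≡0 gs x y h)) (zeroʳ _))) (+-identityʳ 0k)

  Π≢0 : ∀ gs x y → zeros gs x y ≡ 0 → Π gs x y ≢ 0k
  Π≢0 [] x y h = 1≢0
  Π≢0 (g ∷ gs) x y h with ev g x y ≟ 0k
  ... | no n = ⊗-nonzero n (Π≢0 gs x y h)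

  -- Only the summand that omits the single vanishing line survives; it is the x-coefficient of that
  -- line times the nonzero product of the others.
  ∂Π≢0 : ∀ gs x y → zeros gs x y ≡ 1 → All (λ g → ev g x y ≡ 0k → proj₁ g ≢ 0k) gs → ∂Π gs x y ≢ 0k
  ∂Π≢0 (g ∷ gs) x y h (a≢0 ∷ as) e with ev g x y ≟ 0k
  ... | yes g0 = ⊗-nonzero (a≢0 g0) (Π≢0 gs x y (ℕP.suc-injective h))
    (trans (sym (+-identityʳ _)) (trans (⊕-congˡ (sym (trans (⊗-congʳ g0) (zeroˡ _)))) e))
  ... | no n = ⊗-nonzero n (∂Π≢0 gs x y h as)
    (trans (sym (+-identityˡ _)) (trans (⊕-congʳ (sym (trans (⊗-congˡ (Π≡0 gs x y (ℕP.≤-reflexive (sym h))))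
        (zeroʳ _)))) e))

  -- Otherwise the x-derivative of the product of the lines would sum to 0 over the plane, by degree,
  -- although it is nonzero at the origin only.
  double-cover : ∀ gs → (∀ x y → ¬ (x ≡ 0k × y ≡ 0k) → 2 ≤ zeros gs x y) → zeros gs 0k 0k ≡ 1 →
    All (λ g → ev g 0k 0k ≡ 0k → proj₁ g ≢ 0k) gs → 3 *ℕ q ≤ length gs +ℕ 2
  double-cover gs h2 h1 ha with 3 *ℕ q ≤? length gs +ℕ 2
  ... | yes p = p
  ... | no n = ⊥-elim (∂Π≢0 gs 0k 0k h1 ha (trans (sym concentrated) (trans (∬-cong D≡∂Π) (∬D≡0 gs 0 0
      (ℕP.≤-trans (ℕP.≤-reflexive (trans (cong (_+ℕ 3) (ℕP.+-identityʳ (length gs))) (ℕP.+-suc (length gs) 2)))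
          (ℕP.≰⇒> n))))))
    where
    +M = CommutativeRing.+-commutativeMonoid commutativeRing
    D≡∂Π : ∀ x y → ∂Π gs x y ≡ D 0 0 gs x y
    D≡∂Π x y = sym (trans (cong₂ _⊕_ (trans (⊗-congʳ (zeroˡ _)) (zeroˡ _)) (trans (⊗-congʳ (*-identityʳ 1k))
        (*-identityˡ _))) (+-identityˡ _))
    concentrated : ∬ (∂Π gs) ≡ ∂Π gs 0k 0k
    concentrated = trans (sum-single +M 0k _ (λ x x≢0 → sum-ε +M {q} _ (λ y → ∂Π≡0 gs x y (h2 x y (λ
        (x≡0 , _) → x≢0 x≡0)))))
      (sum-single +M 0k _ (λ y y≢0 → ∂Π≡0 gs 0k y (h2 0k y (λ (_ , y≡0) → y≢0 y≡0))))

-- Exact counts of forms and matrices vanishing at given vectors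

module Counting {q : ℕ} (K : FinField q) where
  open import Data.Nat using (zero; suc; _≤_; z≤n; _+_; _*_; _^_)
  import Data.Nat.Properties as ℕP
  open import Data.Nat.Solver using (module +-*-Solver)
  open import Data.Fin using (Fin; _≟_)
  open import Data.Product using (_×_; _,_; proj₂)
  open import Data.Vec using (Vec; []; _∷_; replicate; zipWith)
  import Data.Vec as Vec
  import Data.Vec.Properties as VecP
  open import Data.List using (List; []; _∷_; length; allFin; _++_; map; cartesianProductWith)
  open import Data.List.Properties using (length-tabulate)
  open import Data.List.Membership.Propositional using (_∈_)
  open import Data.List.Membership.Propositional.Properties using (∈-allFin; ∈-cartesianProductWith⁺)
  open import Data.List.Relation.Unary.Any using (here; there)
  open import Data.List.Relation.Unary.All using (All; []; _∷_)
  import Data.List.Relation.Unary.All as All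
  open import Data.List.Relation.Unary.AllPairs using (AllPairs; []; _∷_)
  open import Data.List.Relation.Unary.Unique.Propositional using (Unique)
  import Data.List.Relation.Unary.Unique.Propositional.Properties as UP
  open import Data.Empty using (⊥-elim)
  open import Relation.Nullary using (yes; no)
  open import Relation.Binary.PropositionalEquality
  open import Function using (_∘_)
  open FinField K
  open Field K
  open Lines K using (δ)

  module _ {A : Set} where
    tot : (A → ℕ) → List A → ℕ
    tot f [] = 0
    tot f (x ∷ l) = f x + tot f l

    tot-cong : ∀ {f g : A → ℕ} l → (∀ x → f x ≡ g x) → tot f l ≡ tot g l
    tot-cong [] h = refl
    tot-cong (x ∷ l) h = cong₂ _+_ (h x) (tot-cong l h)

    tot-mono : ∀ {f g : A → ℕ} l → (∀ x → f x ≤ g x) → tot f l ≤ tot g l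
    tot-mono [] h = z≤n
    tot-mono (x ∷ l) h = ℕP.+-mono-≤ (h x) (tot-mono l h)

    tot-+ : ∀ (f g : A → ℕ) l → tot (λ x → f x + g x) l ≡ tot f l + tot g l
    tot-+ f g [] = refl
    tot-+ f g (x ∷ l) = trans (cong (f x + g x +_) (tot-+ f g l))
      (+-*-Solver.solve 4 (λ a b c d → a :+ℕ b :+ℕ (c :+ℕ d) :=ℕ a :+ℕ c :+ℕ (b :+ℕ d)) refl (f x) (g x) (tot f l)
          (tot g l))
      where open +-*-Solver using () renaming (_:+_ to _:+ℕ_; _:=_ to _:=ℕ_)

    tot-* : ∀ c (f : A → ℕ) l → tot (λ x → c * f x) l ≡ c * tot f l
    tot-* c f [] = sym (ℕP.*-zeroʳ c)
    tot-* c f (x ∷ l) = trans (cong (c * f x +_) (tot-* c f l)) (sym (ℕP.*-distribˡ-+ c (f x) _))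

    tot-*ʳ : ∀ c (f : A → ℕ) l → tot (λ x → f x * c) l ≡ tot f l * c
    tot-*ʳ c f l = trans (tot-cong l (λ x → ℕP.*-comm (f x) c)) (trans (tot-* c f l) (ℕP.*-comm c _))

    tot-const : ∀ c l → tot (λ _ → c) l ≡ length l * c
    tot-const c [] = refl
    tot-const c (x ∷ l) = cong (c +_) (tot-const c l)

    tot-++ : ∀ (f : A → ℕ) l l′ → tot f (l ++ l′) ≡ tot f l + tot f l′
    tot-++ f [] l′ = refl
    tot-++ f (x ∷ l) l′ = trans (cong (f x +_) (tot-++ f l l′)) (sym (ℕP.+-assoc (f x) _ _))

    tot-zero : ∀ {f : A → ℕ} l → All (λ x → f x ≡ 0) l → tot f l ≡ 0
    tot-zero [] [] = refl
    tot-zero (x ∷ l) (h ∷ hs) = cong₂ _+_ h (tot-zero l hs)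

    tot-single : ∀ {f : A → ℕ} {x l} → Unique l → x ∈ l → (∀ y → y ≢ x → f y ≡ 0) → tot f l ≡ f x
    tot-single {l = _ ∷ l} (x∉l ∷ _) (here refl) h = trans (cong (_ +_) (tot-zero l (All.map (λ n → h _ (λ e → n
        (sym e))) x∉l))) (ℕP.+-identityʳ _)
    tot-single {f} {l = y ∷ l} (y∉l ∷ u) (there x∈l) h = trans (cong (_+ tot f l) (h y (All.lookup y∉l x∈l)))
        (tot-single u x∈l h)

  tot-map : ∀ {A B : Set} (f : B → ℕ) (g : A → B) l → tot f (map g l) ≡ tot (f ∘ g) l
  tot-map f g [] = refl
  tot-map f g (x ∷ l) = cong (f (g x) +_) (tot-map f g l)

  tot-cartesianProductWith : ∀ {A B C : Set} (f : C → ℕ) (g : A → B → C) l l′ →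
    tot f (cartesianProductWith g l l′) ≡ tot (λ x → tot (λ y → f (g x y)) l′) l
  tot-cartesianProductWith f g [] l′ = refl
  tot-cartesianProductWith f g (x ∷ l) l′ = trans (tot-++ f (map (g x) l′) _)
    (cong₂ _+_ (tot-map f (g x) l′) (tot-cartesianProductWith f g l l′))

  tot-swap : ∀ {A B : Set} (f : A → B → ℕ) l l′ → tot (λ x → tot (f x) l′) l ≡ tot (λ y → tot (λ x → f x y) l) l′
  tot-swap f [] l′ = sym (trans (tot-const 0 l′) (ℕP.*-zeroʳ (length l′)))
  tot-swap f (x ∷ l) l′ = trans (cong (tot (f x) l′ +_) (tot-swap f l l′)) (sym (tot-+ (f x) _ l′))

  vecs : ∀ {A : Set} → List A → ∀ m → List (Vec A m)
  vecs l zero = [] ∷ []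
  vecs l (suc m) = cartesianProductWith (λ v x → x ∷ v) (vecs l m) l

  tot-vecs : ∀ {A : Set} m (f : Vec A (suc m) → ℕ) l → tot f (vecs l (suc m)) ≡ tot (λ v → tot (λ x → f (x ∷ v)) l)
      (vecs l m)
  tot-vecs m f l = tot-cartesianProductWith f _ (vecs l m) l

  vecs-unique : ∀ {A : Set} {l : List A} → Unique l → ∀ m → Unique (vecs l m)
  vecs-unique u zero = [] ∷ []
  vecs-unique u (suc m) = UP.cartesianProductWith⁺ _ (λ e → VecP.∷-injectiveʳ e , VecP.∷-injectiveˡ e)
      (vecs-unique u m) u

  ∈-vecs : ∀ {A : Set} {l : List A} → (∀ x → x ∈ l) → ∀ {m} (v : Vec A m) → v ∈ vecs l m
  ∈-vecs h [] = here refl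
  ∈-vecs h (x ∷ v) = ∈-cartesianProductWith⁺ _ (∈-vecs h v) (h x)

  ∏V : ∀ {A : Set} {m} → (A → ℕ) → Vec A m → ℕ
  ∏V g [] = 1
  ∏V g (x ∷ v) = g x * ∏V g v

  ∏V-* : ∀ {A : Set} {m} (g h : A → ℕ) (v : Vec A m) → ∏V g v * ∏V h v ≡ ∏V (λ x → g x * h x) v
  ∏V-* g h [] = refl
  ∏V-* g h (x ∷ v) = trans (ℕP.[m*n]*[o*p]≡[m*o]*[n*p] (g x) _ (h x) _) (cong (g x * h x *_) (∏V-* g h v))

  -- Distributivity. It reduces every count over matrices to a count over a single row.
  tot-∏V : ∀ {A : Set} (g : A → ℕ) l m → tot (∏V g) (vecs l m) ≡ tot g l ^ m
  tot-∏V g l zero = refl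
  tot-∏V g l (suc m) = trans (tot-vecs m (∏V g) l) (trans (tot-cong (vecs l m) (λ v → tot-*ʳ (∏V g v) g l))
    (trans (tot-* (tot g l) (∏V g) (vecs l m)) (cong (tot g l *_) (tot-∏V g l m))))

  length≡tot : ∀ {A : Set} (l : List A) → tot (λ _ → 1) l ≡ length l
  length≡tot l = trans (tot-const 1 l) (ℕP.*-identityʳ _)

  tot1-vecs : ∀ {A : Set} (l : List A) m → tot (λ _ → 1) (vecs l m) ≡ length l ^ m
  tot1-vecs l m = trans (tot-cong (vecs l m) (sym ∘ ones)) (trans (tot-∏V (λ _ → 1) l m) (cong (_^ m) (length≡tot l)))
    where
    ones : ∀ {A : Set} {m} (v : Vec A m) → ∏V (λ _ → 1) v ≡ 1
    ones [] = refl
    ones (x ∷ v) = trans (ℕP.+-identityʳ _) (ones v)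

  infixl 6 _+v_
  infixl 7 _*v_

  0v : ∀ {m} → Vec (Fin q) m
  0v = replicate _ 0k

  _+v_ : ∀ {m} → Vec (Fin q) m → Vec (Fin q) m → Vec (Fin q) m
  _+v_ = zipWith _⊕_

  _*v_ : ∀ {m} → Fin q → Vec (Fin q) m → Vec (Fin q) m
  s *v v = Vec.map (s ⊗_) v

  dot : ∀ {m} → Vec (Fin q) m → Vec (Fin q) m → Fin q
  dot [] [] = 0k
  dot (x ∷ u) (y ∷ v) = x ⊗ y ⊕ dot u v

  dot-comb : ∀ {m} (f u v : Vec (Fin q) m) s t → dot f (s *v u +v t *v v) ≡ s ⊗ dot f u ⊕ t ⊗ dot f v
  dot-comb [] [] [] s t = sym (trans (cong₂ _⊕_ (zeroʳ s) (zeroʳ t)) (+-identityʳ 0k))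
  dot-comb (x ∷ f) (y ∷ u) (z ∷ v) s t = trans (cong (x ⊗ (s ⊗ y ⊕ t ⊗ z) ⊕_) (dot-comb f u v s t))
    (solve 7 (λ x y z s t a b → x :* (s :* y :+ t :* z) :+ (s :* a :+ t :* b) := s :* (x :* y :+ a) :+ t :*
        (x :* z :+ b)) refl x y z s t (dot f u) (dot f v))

  dot-sym : ∀ {m} (u v : Vec (Fin q) m) → dot u v ≡ dot v u
  dot-sym [] [] = refl
  dot-sym (x ∷ u) (y ∷ v) = cong₂ _⊕_ (*-comm x y) (dot-sym u v)

  dot-0 : ∀ {m} (f : Vec (Fin q) m) → dot f 0v ≡ 0k
  dot-0 [] = refl
  dot-0 (x ∷ f) = trans (cong₂ _⊕_ (zeroʳ x) (dot-0 f)) (+-identityʳ 0k)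

  δ-yes : ∀ {x} → x ≡ 0k → δ x ≡ 1
  δ-yes {x} e with x ≟ 0k
  ... | yes _ = refl
  ... | no n = ⊥-elim (n e)

  δ-no : ∀ {x} → x ≢ 0k → δ x ≡ 0
  δ-no {x} n with x ≟ 0k
  ... | yes e = ⊥-elim (n e)
  ... | no _ = refl

  els : List (Fin q)
  els = allFin q

  length-els : length els ≡ q
  length-els = length-tabulate {n = q} (λ x → x)

  δ-linear : ∀ p c → p ≢ 0k → tot (λ x → δ (x ⊗ p ⊕ c)) els ≡ 1
  δ-linear p c p≢0 with inverse p p≢0
  ... | u , pu = trans (tot-single {x = x₀} (UP.allFin⁺ q) (∈-allFin x₀) (λ y ne → δ-no (λ e → ne (uniq y e))))
      (δ-yes sol)
    where
    x₀ = ⊖ (c ⊗ u)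
    sol : x₀ ⊗ p ⊕ c ≡ 0k
    sol = trans (solve 3 (λ c u p → (:- (c :* u)) :* p :+ c := c :+ :- (c :* (p :* u))) refl c u p)
      (trans (cong (λ z → c ⊕ ⊖ (c ⊗ z)) pu) (trans (cong (λ z → c ⊕ ⊖ z) (*-identityʳ c)) (x⊖x c)))
    uniq : ∀ y → y ⊗ p ⊕ c ≡ 0k → y ≡ x₀
    uniq y e = x⊖y≡0⇒x≡y (⊗-cancel p≢0 (trans
      (solve 3 (λ p y x → p :* (y :- x) := y :* p :- x :* p) refl p y x₀)
      (trans (solve 3 (λ a b c → a :- b := (a :+ c) :- (b :+ c)) refl (y ⊗ p) (x₀ ⊗ p) c) (trans (cong₂
          (λ a b → a ⊕ ⊖ b) e sol) (x⊖x 0k)))))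

  forms : ∀ m → List (Vec (Fin q) m)
  forms = vecs els

  forms-unique : ∀ m → Unique (forms m)
  forms-unique = vecs-unique (UP.allFin⁺ q)

  ∈-forms : ∀ {m} (v : Vec (Fin q) m) → v ∈ forms m
  ∈-forms = ∈-vecs ∈-allFin

  private
    tot-els-const : ∀ c → tot (λ _ → c) els ≡ q * c
    tot-els-const c = trans (tot-const c els) (cong (_* c) length-els)

    drop-0 : ∀ {x p d} → p ≡ 0k → x ⊗ p ⊕ d ≡ d
    drop-0 {x} {p} {d} e = trans (⊕-congʳ (trans (cong (x ⊗_) e) (zeroʳ x))) (+-identityˡ d)

  count-forms : ∀ m → tot (λ _ → 1) (forms m) ≡ q ^ m
  count-forms m = trans (tot1-vecs els m) (cong (_^ m) length-els)

  count-vanishing : ∀ n (v : Vec (Fin q) (suc n)) → v ≢ 0v → tot (λ f → δ (dot f v)) (forms (suc n)) ≡ q ^ n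
  count-vanishing n (p ∷ v) v≢0 with p ≟ 0k
  ... | no p≢0 = trans (tot-vecs n _ els) (trans (tot-cong (forms n) (λ f → δ-linear p (dot f v) p≢0))
      (count-forms n))
  count-vanishing zero (p ∷ []) v≢0 | yes p≡0 = ⊥-elim (v≢0 (cong (_∷ []) p≡0))
  count-vanishing (suc n) (p ∷ v) v≢0 | yes p≡0 = trans (tot-vecs (suc n) _ els)
    (trans (tot-cong (forms (suc n)) (λ f → trans (tot-cong els (λ x → cong δ (drop-0 {x} p≡0))) (tot-els-const _)))
    (trans (tot-* q _ (forms (suc n))) (cong (q *_) (count-vanishing n v (λ e → v≢0 (cong₂ _∷_ p≡0 e))))))

  Indep2 : ∀ {m} → Vec (Fin q) m → Vec (Fin q) m → Set
  Indep2 u v = ∀ s t → s *v u +v t *v v ≡ 0v → s ≡ 0k × t ≡ 0k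

  +v-comm : ∀ {m} (u v : Vec (Fin q) m) → u +v v ≡ v +v u
  +v-comm [] [] = refl
  +v-comm (x ∷ u) (y ∷ v) = cong₂ _∷_ (+-comm x y) (+v-comm u v)

  +v-identityˡ : ∀ {m} (u : Vec (Fin q) m) → 0v +v u ≡ u
  +v-identityˡ [] = refl
  +v-identityˡ (x ∷ u) = cong₂ _∷_ (+-identityˡ x) (+v-identityˡ u)

  0*v : ∀ {m} (u : Vec (Fin q) m) → 0k *v u ≡ 0v
  0*v [] = refl
  0*v (x ∷ u) = cong₂ _∷_ (zeroˡ x) (0*v u)

  1*v : ∀ {m} (u : Vec (Fin q) m) → 1k *v u ≡ u
  1*v [] = refl
  1*v (x ∷ u) = cong₂ _∷_ (*-identityˡ x) (1*v u)

  *v-0 : ∀ {m} s → s *v 0v {m} ≡ 0v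
  *v-0 {zero} s = refl
  *v-0 {suc m} s = cong₂ _∷_ (zeroʳ s) (*v-0 s)

  Indep2-sym : ∀ {m} {u v : Vec (Fin q) m} → Indep2 u v → Indep2 v u
  Indep2-sym i s t e with i t s (trans (+v-comm _ _) e)
  ... | a , b = b , a

  Indep2⇒≢0 : ∀ {m} {u v : Vec (Fin q) m} → Indep2 u v → v ≢ 0v
  Indep2⇒≢0 {u = u} i v≡0 = 1≢0 (proj₂ (i 0k 1k (trans (cong₂ _+v_ (0*v u) (trans (cong (1k *v_) v≡0) (*v-0 1k)))
      (+v-identityˡ 0v))))

  private
    -- Subtracting a multiple of p ∷ u from r ∷ v eliminates the first coordinate.
    count-pivot : ∀ n p r (u v : Vec (Fin q) (suc n)) → p ≢ 0k → Indep2 (p ∷ u) (r ∷ v) →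
      tot (λ f → δ (dot f (p ∷ u)) * δ (dot f (r ∷ v))) (forms (suc (suc n))) ≡ q ^ n
    count-pivot n p r u v p≢0 ind with inverse p p≢0
    ... | p⁻¹ , pp⁻¹ = trans (tot-vecs (suc n) _ els) (trans (tot-cong (forms (suc n)) inner)
        (count-vanishing n w w≢0))
      where
      t = ⊖ (r ⊗ p⁻¹)
      w = t *v u +v 1k *v v
      tp+r : t ⊗ p ⊕ 1k ⊗ r ≡ 0k
      tp+r = trans (solve 4 (λ r i p o → (:- (r :* i)) :* p :+ o :* r := r :* (o :- p :* i)) refl r p⁻¹ p 1k)
        (trans (cong (λ z → r ⊗ (1k ⊕ ⊖ z)) pp⁻¹) (trans (cong (r ⊗_) (x⊖x 1k)) (zeroʳ r)))
      w≢0 : w ≢ 0v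
      w≢0 e = 1≢0 (proj₂ (ind t 1k (cong₂ _∷_ tp+r e)))
      second : ∀ f x → x ⊗ p ⊕ dot f u ≡ 0k → x ⊗ r ⊕ dot f v ≡ dot f w
      second f x e = trans (solve 6 (λ x r p t a b → x :* r :+ b := (x :* (t :* p :+ r) :+ :- (t :*
          (x :* p :+ a))) :+ (t :* a :+ b)) refl x r p t (dot f u) (dot f v))
        (trans (cong₂ (λ y z → x ⊗ y ⊕ ⊖ (t ⊗ z) ⊕ (t ⊗ dot f u ⊕ dot f v)) (trans (⊕-congˡ (sym
            (*-identityˡ r))) tp+r) e)
        (trans (⊕-congʳ (trans (cong₂ (λ y z → y ⊕ ⊖ z) (zeroʳ x) (zeroʳ t)) (x⊖x 0k))) (trans (+-identityˡ _)
        (trans (⊕-congˡ (sym (*-identityˡ _))) (sym (dot-comb f u v t 1k))))))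
      inner : ∀ f → tot (λ x → δ (x ⊗ p ⊕ dot f u) * δ (x ⊗ r ⊕ dot f v)) els ≡ δ (dot f w)
      inner f = trans (tot-cong els pointwise) (trans (tot-*ʳ (δ (dot f w)) (λ x → δ (x ⊗ p ⊕ dot f u)) els)
        (trans (cong (_* δ (dot f w)) (δ-linear p (dot f u) p≢0)) (ℕP.*-identityˡ _)))
        where
        pointwise : ∀ x → δ (x ⊗ p ⊕ dot f u) * δ (x ⊗ r ⊕ dot f v) ≡ δ (x ⊗ p ⊕ dot f u) * δ (dot f w)
        pointwise x with x ⊗ p ⊕ dot f u ≟ 0k
        ... | yes e = cong (λ z → 1 * δ z) (second f x e)
        ... | no _ = refl

  -- A nonzero first coordinate of either vector serves as a pivot that reduces the count to one
  -- vector. If both are zero, the first coefficient of the form is free and the dimension drops.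
  count-vanishing₂ : ∀ n (u v : Vec (Fin q) (suc (suc n))) → Indep2 u v →
    tot (λ f → δ (dot f u) * δ (dot f v)) (forms (suc (suc n))) ≡ q ^ n
  count-vanishing₂ n (p ∷ u) (r ∷ v) ind with p ≟ 0k | r ≟ 0k
  ... | no p≢0 | _ = count-pivot n p r u v p≢0 ind
  ... | yes _ | no r≢0 = trans (tot-cong (forms (suc (suc n))) (λ f → ℕP.*-comm (δ (dot f (p ∷ u))) _))
      (count-pivot n r p v u r≢0 (Indep2-sym ind))
  ... | yes p≡0 | yes r≡0 = descend n u v (λ s t e → ind s t (cong₂ _∷_
        (trans (cong₂ (λ x y → s ⊗ x ⊕ t ⊗ y) p≡0 r≡0) (trans (cong₂ _⊕_ (zeroʳ s) (zeroʳ t)) (+-identityʳ 0k))) e))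
    where
    descend : ∀ n (u v : Vec (Fin q) (suc n)) → Indep2 u v → tot (λ f → δ (dot f (p ∷ u)) * δ (dot f (r ∷ v))) (forms
        (suc (suc n))) ≡ q ^ n
    -- In dimension one, b a - a b = 0 would be a relation, so a = 0, and an independent pair
    -- contains no zero vector.
    descend zero (a ∷ []) (b ∷ []) ind = ⊥-elim (Indep2⇒≢0 (Indep2-sym ind) (cong (_∷ [])
      (trans (solve 1 (λ a → a := :- (:- a)) refl a) (trans (cong ⊖_ (proj₂ (ind b (⊖ a) (cong (_∷ []) (trans
          (solve 2 (λ a b → b :* a :+ (:- a) :* b := a :- a) refl a b) (x⊖x a))))))
        (trans (sym (+-identityˡ _)) (x⊖x 0k))))))
    descend (suc n) u v ind = trans (tot-vecs (suc (suc n)) _ els)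
      (trans (tot-cong (forms (suc (suc n))) (λ f → trans (tot-cong els (λ x → cong₂ (λ y z → δ y * δ z)
          (drop-0 {x} p≡0) (drop-0 {x} r≡0))) (tot-els-const _)))
      (trans (tot-* q _ (forms (suc (suc n)))) (cong (q *_) (count-vanishing₂ n u v ind))))

  Mat : ℕ → ℕ → Set
  Mat k m = Vec (Vec (Fin q) m) k

  mats : ∀ k m → List (Mat k m)
  mats k m = vecs (forms m) k

  -- The indicator of v ∈ ker M, written as a product over the rows so that its sum over all M
  -- factors.
  χ : ∀ {k m} → Mat k m → Vec (Fin q) m → ℕ
  χ M v = ∏V (λ r → δ (dot r v)) M

  cnt : ∀ {k m} → Mat k m → List (Vec (Fin q) m) → ℕ
  cnt M = tot (χ M)

  -- The binomial coefficient of `cnt M l` over 2, in the form that can be averaged: a sum of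
  -- products of two indicators.
  pairs : ∀ {k m} → Mat k m → List (Vec (Fin q) m) → ℕ
  pairs M [] = 0
  pairs M (u ∷ l) = χ M u * cnt M l + pairs M l

  -- This is n (n - 1) / 2, one place behind the usual triangular numbers.
  tri : ℕ → ℕ
  tri zero = 0
  tri (suc n) = n + tri n

  sum-1 : ∀ k m → tot (λ _ → 1) (mats k m) ≡ (q ^ m) ^ k
  sum-1 k m = trans (tot1-vecs (forms m) k) (cong (_^ k) (trans (sym (length≡tot (forms m))) (count-forms m)))

  sum-χ : ∀ k n (v : Vec (Fin q) (suc n)) → v ≢ 0v → tot (λ M → χ M v) (mats k (suc n)) ≡ (q ^ n) ^ k
  sum-χ k n v v≢0 = trans (tot-∏V _ (forms (suc n)) k) (cong (_^ k) (count-vanishing n v v≢0))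

  -- A product of two indicators is again a product over rows. With w = (q ^ n) ^ k there are Q² w
  -- matrices, Q w with one given point in the kernel, and w with two: membership of distinct points
  -- is pairwise independent.
  sum-χχ : ∀ k n (u v : Vec (Fin q) (suc (suc n))) → Indep2 u v → tot (λ M → χ M u * χ M v) (mats k (suc (suc n))) ≡
      (q ^ n) ^ k
  sum-χχ k n u v ind = trans (tot-cong (mats k (suc (suc n))) (∏V-* (λ r → δ (dot r u)) (λ r → δ (dot r v)))) (trans
      (tot-∏V _ (forms (suc (suc n))) k) (cong (_^ k) (count-vanishing₂ n u v ind)))

  sum-cnt : ∀ k n l → All (_≢ 0v) l → tot (λ M → cnt M l) (mats k (suc n)) ≡ length l * (q ^ n) ^ k
  sum-cnt k n l nz = trans (tot-swap χ (mats k (suc n)) l) (go l nz)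
    where
    go : ∀ l → All (_≢ 0v) l → tot (λ v → tot (λ M → χ M v) (mats k (suc n))) l ≡ length l * (q ^ n) ^ k
    go [] [] = refl
    go (v ∷ l) (h ∷ hs) = cong₂ _+_ (sum-χ k n v h) (go l hs)

  sum-χcnt : ∀ k n u l → All (Indep2 u) l → tot (λ M → χ M u * cnt M l) (mats k (suc (suc n))) ≡ length l *
      (q ^ n) ^ k
  sum-χcnt k n u [] [] = trans (tot-cong (mats k (suc (suc n))) (λ M → ℕP.*-zeroʳ (χ M u))) (trans (tot-const 0
      (mats k (suc (suc n)))) (ℕP.*-zeroʳ (length (mats k (suc (suc n))))))
  sum-χcnt k n u (v ∷ l) (h ∷ hs) = trans (tot-cong (mats k (suc (suc n))) (λ M → ℕP.*-distribˡ-+ (χ M u) (χ M v)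
      (cnt M l)))
    (trans (tot-+ (λ M → χ M u * χ M v) (λ M → χ M u * cnt M l) (mats k (suc (suc n)))) (cong₂ _+_ (sum-χχ k n u v h)
        (sum-χcnt k n u l hs)))

  sum-pairs : ∀ k n l → AllPairs Indep2 l → tot (λ M → pairs M l) (mats k (suc (suc n))) ≡ tri (length l) *
      (q ^ n) ^ k
  sum-pairs k n [] [] = trans (tot-const 0 (mats k (suc (suc n)))) (ℕP.*-zeroʳ (length (mats k (suc (suc n)))))
  sum-pairs k n (u ∷ l) (h ∷ hs) = trans (tot-+ (λ M → χ M u * cnt M l) (λ M → pairs M l) (mats k (suc (suc n))))
    (trans (cong₂ _+_ (sum-χcnt k n u l h) (sum-pairs k n l hs)) (sym (ℕP.*-distribʳ-+ ((q ^ n) ^ k) (length l) _)))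

  sum-cntcnt : ∀ k n l l′ → All (λ u → All (Indep2 u) l′) l →
    tot (λ M → cnt M l * cnt M l′) (mats k (suc (suc n))) ≡ length l * (length l′ * (q ^ n) ^ k)
  sum-cntcnt k n [] l′ [] = trans (tot-const 0 (mats k (suc (suc n)))) (ℕP.*-zeroʳ (length (mats k (suc (suc n)))))
  sum-cntcnt k n (u ∷ l) l′ (h ∷ hs) = trans (tot-cong (mats k (suc (suc n))) (λ M → ℕP.*-distribʳ-+ (cnt M l′)
      (χ M u) (cnt M l)))
    (trans (tot-+ (λ M → χ M u * cnt M l′) (λ M → cnt M l * cnt M l′) (mats k (suc (suc n)))) (cong₂ _+_
        (sum-χcnt k n u l′ h) (sum-cntcnt k n l l′ hs)))

-- Kernels, spans and separating forms

module Linear {q : ℕ} (K : FinField q) where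
  open import Data.Nat using (zero; suc; _≤_; _<_; s≤s; z≤n; _+_; _*_; _^_; _≤?_)
  import Data.Nat
  import Data.Nat.Properties as ℕP
  open import Data.Fin using (Fin; _≟_)
  open import Data.Product using (∃; _×_; _,_; proj₁; proj₂)
  open import Data.Vec using (Vec; []; _∷_; zipWith)
  import Data.Vec as Vec
  import Data.Vec.Properties as VecP
  open import Data.List using (List; []; _∷_)
  open import Data.Vec.Relation.Unary.All using (All; []; _∷_)
  open import Data.Empty using (⊥-elim)
  open import Relation.Nullary using (yes; no; Dec)
  open import Relation.Binary.PropositionalEquality
  open FinField K
  open Field K
  open Lines K using (δ)
  open Counting K

  private
    variable
      m k d : ℕ

  V : ℕ → Set
  V m = Vec (Fin q) m

  _≟v_ : (u v : V m) → Dec (u ≡ v)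
  _≟v_ = VecP.≡-dec _≟_

  mv : Mat k m → V m → V k
  mv M v = Vec.map (λ r → dot r v) M

  χ-yes : (M : Mat k m) (v : V m) → mv M v ≡ 0v → χ M v ≡ 1
  χ-yes [] v e = refl
  χ-yes (r ∷ M) v e = cong₂ _*_ (δ-yes (VecP.∷-injectiveˡ e)) (χ-yes M v (VecP.∷-injectiveʳ e))

  χ-no : (M : Mat k m) (v : V m) → mv M v ≢ 0v → χ M v ≡ 0
  χ-no [] v n = ⊥-elim (n refl)
  χ-no (r ∷ M) v n with dot r v ≟ 0k
  ... | no _ = refl
  ... | yes e = trans (ℕP.+-identityʳ _) (χ-no M v (λ e′ → n (cong₂ _∷_ e e′)))

  -- The rank-one update M + e ⊗ f. The idle scalar `1k` puts each row in the shape s u + t v that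
  -- `dot-comb` handles.
  update : Mat k m → V k → V m → Mat k m
  update M e f = zipWith (λ r s → 1k *v r +v s *v f) M e

  mv-update : (M : Mat k m) (e : V k) (f v : V m) → mv (update M e f) v ≡ mv M v +v dot f v *v e
  mv-update [] [] f v = refl
  mv-update (r ∷ M) (s ∷ e) f v = cong₂ _∷_
    (trans (dot-sym (1k *v r +v s *v f) v) (trans (dot-comb v r f 1k s) (cong₂ _⊕_ (trans (*-identityˡ _)
        (dot-sym v r)) (trans (cong (s ⊗_) (dot-sym v f)) (*-comm _ _)))))
    (mv-update M e f v)

  mv-comb : (M : Mat k m) (u v : V m) (s t : Fin q) → mv M (s *v u +v t *v v) ≡ s *v mv M u +v t *v mv M v
  mv-comb [] u v s t = refl
  mv-comb (r ∷ M) u v s t = cong₂ _∷_ (dot-comb r u v s t) (mv-comb M u v s t)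

  comb : V d → Vec (V m) d → V m
  comb [] [] = 0v
  comb (c ∷ cs) (b ∷ bs) = c *v b +v comb cs bs

  Indep : Vec (V m) d → Set
  Indep B = ∀ c → comb c B ≡ 0v → c ≡ 0v

  comb-0 : (B : Vec (V m) d) → comb 0v B ≡ 0v
  comb-0 [] = refl
  comb-0 (b ∷ B) = trans (cong₂ _+v_ (0*v b) (comb-0 B)) (+v-identityˡ 0v)

  standard : ∀ m → Vec (V m) m
  standard zero = []
  standard (suc m) = (1k ∷ 0v) ∷ Vec.map (0k ∷_) (standard m)

  comb-map-0∷ : (c : V d) (B : Vec (V m) d) → comb c (Vec.map (0k ∷_) B) ≡ 0k ∷ comb c B
  comb-map-0∷ [] [] = refl
  comb-map-0∷ (c ∷ cs) (b ∷ B) = trans (cong (c *v (0k ∷ b) +v_) (comb-map-0∷ cs B)) (cong₂ _∷_ (trans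
      (+-identityʳ _) (zeroʳ c)) refl)

  comb-standard : (c : V m) → comb c (standard m) ≡ c
  comb-standard [] = refl
  comb-standard {suc m} (c ∷ cs) = trans (cong (c *v (1k ∷ 0v) +v_) (comb-map-0∷ cs (standard m)))
    (cong₂ _∷_ (trans (+-identityʳ _) (*-identityʳ c)) (trans (cong₂ _+v_ (*v-0 c) (comb-standard cs))
        (+v-identityˡ cs)))

  dot-comb≡0 : (r : V m) (B : Vec (V m) d) → All (λ b → dot r b ≡ 0k) B → ∀ c → dot r (comb c B) ≡ 0k
  dot-comb≡0 r [] [] [] = dot-0 r
  dot-comb≡0 r (b ∷ B) (h ∷ hs) (c ∷ cs) = trans (cong (λ z → dot r (c *v b +v z)) (sym (1*v (comb cs B)))) (trans
      (dot-comb r b (comb cs B) c 1k)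
    (trans (cong₂ _⊕_ (trans (cong (c ⊗_) h) (zeroʳ c)) (trans (cong (1k ⊗_) (dot-comb≡0 r B hs cs)) (zeroʳ 1k)))
        (+-identityʳ 0k)))

  module _ (b : V m) (τ : V m → Fin q) where
    shear : Vec (V m) d → Vec (V m) d
    shear = Vec.map (λ v → 1k *v v +v τ v *v b)

    shear-coeff : V d → Vec (V m) d → Fin q
    shear-coeff [] [] = 0k
    shear-coeff (c ∷ cs) (v ∷ B) = c ⊗ τ v ⊕ shear-coeff cs B

    comb-shear : (c : V d) (B : Vec (V m) d) → comb c (shear B) ≡ comb (shear-coeff c B ∷ c) (b ∷ B)
    comb-shear [] [] = sym (trans (cong (_+v 0v) (0*v b)) (+v-identityˡ 0v))
    comb-shear (c ∷ cs) (v ∷ B) = trans (cong (c *v (1k *v v +v τ v *v b) +v_) (comb-shear cs B)) (pointwise c (τ v)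
        (shear-coeff cs B) v b (comb cs B))
      where
      pointwise : ∀ {m} c t s (v b w : V m) → c *v (1k *v v +v t *v b) +v (s *v b +v w) ≡ (c ⊗ t ⊕ s) *v b +v
          (c *v v +v w)
      pointwise c t s [] [] [] = refl
      pointwise c t s (x ∷ v) (y ∷ b) (z ∷ w) = cong₂ _∷_
        (trans (cong (λ o → c ⊗ (o ⊕ t ⊗ y) ⊕ (s ⊗ y ⊕ z)) (*-identityˡ x))
          (solve 6 (λ c t s x y z → c :* (x :+ t :* y) :+ (s :* y :+ z) := (c :* t :+ s) :* y :+
              (c :* x :+ z)) refl c t s x y z))
        (pointwise c t s v b w)

  Indep-tail : ∀ {b : V m} {B : Vec (V m) d} → Indep (b ∷ B) → Indep B
  Indep-tail {b = b} ind c e = VecP.∷-injectiveʳ (ind (0k ∷ c) (trans (cong₂ _+v_ (0*v b) e) (+v-identityˡ 0v)))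

  _⊆span_ : ∀ {d d′} → Vec (V m) d → Vec (V m) d′ → Set
  B′ ⊆span B = ∀ c → ∃ λ c′ → comb c B′ ≡ comb c′ B

  -- The first basis vector b with r b ≠ 0 shears the later ones into the hyperplane r = 0 and is
  -- then dropped; the earlier ones lie in it already. If r vanishes on the whole basis, the last
  -- vector is dropped all the same, so that the length is always d.
  cut : ∀ d (r : V m) (B : Vec (V m) (suc d)) → Indep B →
    ∃ λ (B′ : Vec (V m) d) → Indep B′ × All (λ b → dot r b ≡ 0k) B′ × B′ ⊆span B
  cut d r (b ∷ B) ind with dot r b ≟ 0k
  ... | no rb≢0 with inverse (dot r b) rb≢0
  ...   | u , rbu = shear b τ B
      , (λ c e → VecP.∷-injectiveʳ (ind (shear-coeff b τ c B ∷ c) (trans (sym (comb-shear b τ c B)) e)))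
      , orth B , λ c → shear-coeff b τ c B ∷ c , comb-shear b τ c B
    where
    τ : V _ → Fin q
    τ v = ⊖ (dot r v ⊗ u)
    orth : ∀ {d} (B : Vec (V _) d) → All (λ b → dot r b ≡ 0k) (shear b τ B)
    orth [] = []
    orth (v ∷ B) = trans (dot-comb r v b 1k (τ v)) (trans (solve 4 (λ o x u y → o :* x :+ (:- (x :* u)) :* y := x :*
        (o :- y :* u)) refl 1k (dot r v) u (dot r b))
      (trans (cong (λ z → dot r v ⊗ (1k ⊕ ⊖ z)) rbu) (trans (⊗-congˡ (x⊖x 1k)) (zeroʳ _)))) ∷ orth B
  cut zero r (b ∷ []) ind | yes rb≡0 = [] , (λ { [] _ → refl }) , [] , λ { [] → 0v , sym (comb-0 (b ∷ [])) }
  cut (suc d) r (b ∷ B) ind | yes rb≡0 with cut d r B (Indep-tail ind)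
  ... | B″ , ind″ , orth , span = b ∷ B″ , ind′ , rb≡0 ∷ orth , λ { (c ∷ cs) → c ∷ proj₁ (span cs) , cong
      (c *v b +v_) (proj₂ (span cs)) }
    where
    ind′ : Indep (b ∷ B″)
    ind′ (c ∷ cs) e with ind (c ∷ proj₁ (span cs)) (trans (cong (c *v b +v_) (sym (proj₂ (span cs)))) e)
    ... | z = cong₂ _∷_ c≡0 (ind″ cs (trans (sym (+v-identityˡ _)) (trans (cong (_+v comb cs B″) (sym (trans (cong
        (_*v b) c≡0) (0*v b)))) e)))
      where c≡0 = VecP.∷-injectiveˡ z

  abstract
    -- Each row costs one basis vector. When the rank of M is less than k, the vectors obtained span
    -- only a part of the kernel.
    kernel-basis : ∀ k d → k + d ≡ m → (M : Mat k m) →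
      ∃ λ (B : Vec (V m) d) → Indep B × ∀ c → mv M (comb c B) ≡ 0v
    kernel-basis zero d refl [] = standard d , (λ c e → trans (sym (comb-standard c)) e) , λ c → refl
    kernel-basis (suc k) d eq (r ∷ M) with kernel-basis k (suc d) (trans (ℕP.+-suc k d) eq) M
    ... | B , ind , ker with cut d r B ind
    ...   | B′ , ind′ , orth , span = B′ , ind′ , λ c → cong₂ _∷_ (dot-comb≡0 r B′ orth c) (trans (cong (mv M) (proj₂
        (span c))) (ker (proj₁ (span c))))

  -- Dual to `cut`: the first row that does not kill b clears b from the later rows and is removed.
  -- What the other rows kill can be shifted along b into ker M, so the kernel grows by no more than
  -- ⟨b⟩.
  eliminate : ∀ k (M : Mat (suc k) m) (b : V m) → mv M b ≢ 0v →
    ∃ λ (M′ : Mat k m) → ∀ v → mv M′ v ≡ 0v → ∃ λ t → mv M (1k *v v +v t *v b) ≡ 0v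
  eliminate {m} k (r ∷ R) b n with dot r b ≟ 0k
  ... | no rb≢0 with inverse (dot r b) rb≢0
  ...   | u , rbu = Vec.map (λ s → 1k *v s +v ⊖ (dot s b ⊗ u) *v r) R , λ v h → ⊖ (dot r v ⊗ u) , cong₂ _∷_ (first v)
      (rest R v h)
    where
    first : ∀ v → dot r (1k *v v +v ⊖ (dot r v ⊗ u) *v b) ≡ 0k
    first v = trans (dot-comb r v b 1k _) (trans (solve 4 (λ o x u y → o :* x :+ (:- (x :* u)) :* y := x :*
        (o :- y :* u)) refl 1k (dot r v) u (dot r b))
      (trans (cong (λ z → dot r v ⊗ (1k ⊕ ⊖ z)) rbu) (trans (⊗-congˡ (x⊖x 1k)) (zeroʳ _))))
    rest : ∀ {j} (R : Mat j m) v → mv (Vec.map (λ s → 1k *v s +v ⊖ (dot s b ⊗ u) *v r) R) v ≡ 0v → mv R (1k *v v +v ⊖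
        (dot r v ⊗ u) *v b) ≡ 0v
    rest [] v h = refl
    rest (s ∷ R) v h = cong₂ _∷_ (trans (dot-comb s v b 1k _) (trans
       (trans (solve 5 (λ o x y u z → o :* x :+ (:- (y :* u)) :* z := o :* x :+ (:- (z :* u)) :* y) refl 1k (dot s v)
           (dot r v) u (dot s b))
         (sym (trans (dot-sym (1k *v s +v ⊖ (dot s b ⊗ u) *v r) v) (trans (dot-comb v s r 1k _) (cong₂
             (λ y z → 1k ⊗ y ⊕ ⊖ (dot s b ⊗ u) ⊗ z) (dot-sym v s) (dot-sym v r))))))
       (VecP.∷-injectiveˡ h))) (rest R v (VecP.∷-injectiveʳ h))
  eliminate zero (r ∷ []) b n | yes rb≡0 = ⊥-elim (n (cong (_∷ []) rb≡0))
  eliminate (suc k) (r ∷ R) b n | yes rb≡0 with eliminate k R b (λ e → n (cong₂ _∷_ rb≡0 e))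
  ... | M′ , h = r ∷ M′ , λ v e → proj₁ (h v (VecP.∷-injectiveʳ e)) , cong₂ _∷_
    (trans (dot-comb r v b 1k _) (trans (cong₂ _⊕_ (trans (*-identityˡ _) (VecP.∷-injectiveˡ e)) (trans
        (⊗-congˡ rb≡0) (zeroʳ _))) (+-identityʳ 0k)))
    (proj₂ (h v (VecP.∷-injectiveʳ e)))

  mv-standard : (v : V m) → mv (standard m) v ≡ v
  mv-standard [] = refl
  mv-standard {suc m} (x ∷ v) = cong₂ _∷_ (trans (cong₂ _⊕_ (*-identityˡ x) (trans (dot-sym 0v v) (dot-0 v)))
      (+-identityʳ x)) (trans (tail (standard m)) (mv-standard v))
    where
    tail : ∀ {j} (R : Mat j m) → mv (Vec.map (0k ∷_) R) (x ∷ v) ≡ mv R v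
    tail [] = refl
    tail (r ∷ R) = cong₂ _∷_ (trans (⊕-congʳ (zeroˡ x)) (+-identityˡ _)) (tail R)

  abstract
    -- By independence b lies outside the span of the tail, which contains ker M for the matrix M
    -- already found; hence M b ≠ 0, and eliminating b removes a row while adding b to the span. The
    -- inclusion runs this way because points found in a kernel are to be placed in a subspace.
    kernel⊆span : ∀ d k → d + k ≡ m → (B : Vec (V m) d) → Indep B →
      ∃ λ (M : Mat k m) → ∀ v → mv M v ≡ 0v → ∃ λ c → v ≡ comb c B
    kernel⊆span zero k refl [] ind = standard k , λ v e → [] , trans (sym (mv-standard v)) e
    kernel⊆span (suc d) k eq (b ∷ B) ind with kernel⊆span d (suc k) (trans (ℕP.+-suc d k) eq) B (Indep-tail ind)
    ... | M , h with eliminate k M b Mb≢0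
      where
      Mb≢0 : mv M b ≢ 0v
      Mb≢0 e with h b e
      ... | c , b≡ = 1≢0 (trans (solve 1 (λ o → o := :- (:- o)) refl 1k) (trans (cong ⊖_ (VecP.∷-injectiveˡ (ind
          (⊖ 1k ∷ c)
           (trans (cong (⊖ 1k *v b +v_) (sym b≡)) (cancel b))))) (trans (sym (+-identityˡ _)) (x⊖x 0k))))
        where
        cancel : ∀ {m} (b : V m) → ⊖ 1k *v b +v b ≡ 0v
        cancel [] = refl
        cancel (x ∷ b) = cong₂ _∷_ (trans (cong (⊖ 1k ⊗ x ⊕_) (sym (*-identityˡ x))) (trans (solve 2 (λ o x →
            (:- o) :* x :+ o :* x := (o :- o) :* x) refl 1k x) (trans (⊗-congʳ (x⊖x 1k)) (zeroˡ x)))) (cancel b)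
    ...   | M′ , h′ = M′ , λ v e → ⊖ proj₁ (h′ v e) ∷ proj₁ (h _ (proj₂ (h′ v e))) , trans (move v b (proj₁
        (h′ v e))) (cong (⊖ proj₁ (h′ v e) *v b +v_) (proj₂ (h _ (proj₂ (h′ v e)))))
      where
      move : ∀ {m} (v b : V m) t → v ≡ ⊖ t *v b +v (1k *v v +v t *v b)
      move [] [] t = refl
      move (x ∷ v) (y ∷ b) t = cong₂ _∷_ (trans (solve 3 (λ x y t → x := (:- t) :* y :+ (x :+ t :* y)) refl x y t)
          (cong (λ z → ⊖ t ⊗ y ⊕ (z ⊕ t ⊗ y)) (sym (*-identityˡ x)))) (move v b t)

  tot-< : ∀ {A : Set} {f g : A → ℕ} l → tot f l < tot g l → ∃ λ x → f x < g x
  tot-< {f = f} {g} (x ∷ l) h with g x ≤? f x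
  ... | no n = x , ℕP.≰⇒> n
  ... | yes le = tot-< l (ℕP.+-cancelˡ-< (g x) _ _ (ℕP.≤-<-trans (ℕP.+-monoˡ-≤ (tot f l) le) h))

  -- Of the q ^ (m + 1) forms vanishing at u, only q ^ m vanish at v, and q ^ m at w.
  abstract
    separate : 3 ≤ q → (u v w : V (suc (suc m))) → Indep2 u v → Indep2 u w →
      ∃ λ a → dot a u ≡ 0k × dot a v ≢ 0k × dot a w ≢ 0k
    separate {m} q≥3 u v w uv uw with tot-< (forms (suc (suc m))) lt
      where
      l : List (V (suc (suc m)))
      l = forms (suc (suc m))
      -- A union bound, strict because 2 q ^ m < q ^ (m + 1) for q ≥ 3. Nothing relates v to w, and
      -- they may coincide.
      lt : tot (λ f → δ (dot f u) * δ (dot f v) + δ (dot f u) * δ (dot f w)) l < tot (λ f → δ (dot f u)) l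
      lt = subst₂ _<_ (sym (trans (tot-+ _ _ l) (cong₂ _+_ (count-vanishing₂ m u v uv) (count-vanishing₂ m u w uw))))
          (sym (count-vanishing (suc m) u (Indep2⇒≢0 (Indep2-sym uv))))
        (ℕP.<-≤-trans (ℕP.+-monoʳ-< (q ^ m) (ℕP.m<m+n (q ^ m) (ℕP.m^n>0 q ⦃ Data.Nat.>-nonZero (ℕP.≤-trans
            (s≤s z≤n) q≥3) ⦄ m)))
          (ℕP.≤-trans (ℕP.≤-reflexive (cong (λ z → q ^ m + (q ^ m + z)) (sym (ℕP.+-identityʳ _)))) (ℕP.*-monoˡ-≤
              (q ^ m) q≥3)))
    ... | a , h with dot a u ≟ 0k | dot a v ≟ 0k | dot a w ≟ 0k
    ...   | no _ | _ | _ = ⊥-elim (ℕP.<-irrefl refl h)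
    ...   | yes _ | yes _ | _ = ⊥-elim (ℕP.<⇒≱ h (s≤s z≤n))
    ...   | yes _ | no _ | yes _ = ⊥-elim (ℕP.<⇒≱ h (s≤s z≤n))
    ...   | yes p | no r | no s = a , p , r , s

-- From lines in the plane to points off a kernel

module Cover {q : ℕ} (K : FinField q) where
  open import Data.Nat using (suc; _≤_; s≤s; z≤n; _+_; _*_; _^_; _∸_)
  import Data.Nat
  import Data.Nat.Properties as ℕP
  open import Data.Nat.Solver using (module +-*-Solver)
  open import Data.Fin using (Fin; _≟_)
  open import Data.Fin.Properties using (any?)
  open import Data.Product using (∃; _×_; _,_; proj₁; proj₂)
  open import Data.Vec using ([]; _∷_)
  open import Data.List using (List; []; _∷_; length)
  open import Data.List.Membership.Propositional using (_∈_)
  open import Data.List.Membership.Propositional.Properties using (∈-allFin)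
  open import Data.List.Relation.Unary.Any using (here; there)
  open import Data.List.Relation.Unary.All using (All; []; _∷_)
  import Data.List.Relation.Unary.Unique.Propositional.Properties as UP
  open import Data.Empty using (⊥-elim)
  open import Relation.Nullary using (¬_; yes; no; Dec)
  open import Relation.Binary.PropositionalEquality
  open FinField K
  open Field K
  open Lines K
  open Counting K
  open Linear K

  ≤tot : ∀ {A : Set} (f : A → ℕ) {x l} → x ∈ l → f x ≤ tot f l
  ≤tot f (here refl) = ℕP.m≤m+n _ _
  ≤tot f (there i) = ℕP.≤-trans (≤tot f i) (ℕP.m≤n+m _ _)

  𝟙 : ∀ {m} → V m → V m → ℕ
  𝟙 u v with u ≟v v
  ... | yes _ = 1
  ... | no _ = 0

  𝟙-yes : ∀ {m} {u v : V m} → u ≡ v → 𝟙 u v ≡ 1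
  𝟙-yes {u = u} {v} e with u ≟v v
  ... | yes _ = refl
  ... | no n = ⊥-elim (n e)

  𝟙-no : ∀ {m} {u v : V m} → u ≢ v → 𝟙 u v ≡ 0
  𝟙-no {u = u} {v} n with u ≟v v
  ... | yes e = ⊥-elim (n e)
  ... | no _ = refl

  tot-𝟙 : ∀ {m} (v : V m) → tot (λ e → 𝟙 e v) (forms m) ≡ 1
  tot-𝟙 {m} v = trans (tot-single (forms-unique m) (∈-forms v) (λ y n → 𝟙-no n)) (𝟙-yes {u = v} refl)

  tot-δ : tot δ els ≡ 1
  tot-δ = trans (tot-single (UP.allFin⁺ q) (∈-allFin 0k) (λ y n → δ-no n)) (δ-yes refl)

  χ-cong : ∀ {k m} {M M′ : Mat k m} {v : V m} → mv M v ≡ mv M′ v → χ M v ≡ χ M′ v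
  χ-cong {M = M} {M′} {v} e with mv M v ≟v 0v
  ... | yes h = trans (χ-yes M v h) (sym (χ-yes M′ v (trans (sym e) h)))
  ... | no n = trans (χ-no M v n) (sym (χ-no M′ v (λ h → n (trans e h))))

  χ≤1 : ∀ {k m} (M : Mat k m) v → χ M v ≤ 1
  χ≤1 M v with mv M v ≟v 0v
  ... | yes h = ℕP.≤-reflexive (χ-yes M v h)
  ... | no n = ℕP.≤-trans (ℕP.≤-reflexive (χ-no M v n)) z≤n

  cancel-tail : ∀ {k} {e : V k} c d → e ≢ 0v → c *v e ≡ d *v e → c ≡ d
  cancel-tail {e = []} c d n h = ⊥-elim (n refl)
  cancel-tail {e = x ∷ e} c d n h with x ≟ 0k
  ... | yes x≡0 = cancel-tail c d (λ z → n (cong₂ _∷_ x≡0 z)) (proj₂ (split h))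
    where
    split : ∀ {m} {x y : Fin q} {u v : V m} → x ∷ u ≡ y ∷ v → x ≡ y × u ≡ v
    split refl = refl , refl
  ... | no x≢0 = x⊖y≡0⇒x≡y (⊗-cancel x≢0 (trans (solve 3 (λ x c d → x :* (c :- d) := c :* x :- d :* x) refl x c d)
      (trans (cong (λ z → z ⊕ ⊖ (d ⊗ x)) (head h)) (x⊖x _))))
    where
    head : ∀ {m} {x y : Fin q} {u v : V m} → x ∷ u ≡ y ∷ v → x ≡ y
    head refl = refl

  multiple? : ∀ {k} (w e : V k) → Dec (∃ λ c → w ≡ c *v e)
  multiple? w e = any? (λ c → w ≟v (c *v e))

  add-multiple : ∀ {k} (e : V k) c s → c ⊕ s ≡ 0k → c *v e +v s *v e ≡ 0v
  add-multiple [] c s h = refl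
  add-multiple (x ∷ e) c s h = cong₂ _∷_ (trans (solve 3 (λ c s x → c :* x :+ s :* x := (c :+ s) :* x) refl c s x)
      (trans (cong (_⊗ x) h) (zeroˡ x))) (add-multiple e c s h)

  add≡0 : ∀ {k} (w e : V k) s → w +v s *v e ≡ 0v → w ≡ (⊖ s) *v e
  add≡0 [] [] s h = refl
  add≡0 (y ∷ w) (x ∷ e) s h with y ⊕ s ⊗ x in p | w +v s *v e in p′
  add≡0 (y ∷ w) (x ∷ e) s refl | _ | _ = cong₂ _∷_ (trans (solve 3 (λ y s x → y := (y :+ s :* x) :+
      (:- s) :* x) refl y s x) (trans (cong (_⊕ ⊖ s ⊗ x) p) (+-identityˡ _))) (add≡0 w e s p′)

  module _ {k m} (M : Mat k m) (a b : V m) where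
    -- The points v with M v ∈ ⟨e⟩, seen as lines in the plane of the updates by multiples of e.
    lines : V k → List (V m) → List Line
    lines e [] = []
    lines e (v ∷ A) with multiple? (mv M v) e
    ... | yes (c , _) = (dot a v , dot b v , c) ∷ lines e A
    ... | no _ = lines e A

    plane : V k → Fin q → Fin q → Mat k m
    plane e x y = update M e (x *v a +v y *v b)

    mv-plane : ∀ e x y v → mv (plane e x y) v ≡ mv M v +v (dot a v ⊗ x ⊕ dot b v ⊗ y) *v e
    mv-plane e x y v = trans (mv-update M e _ v) (cong (λ s → mv M v +v s *v e)
      (trans (dot-sym (x *v a +v y *v b) v) (trans (dot-comb v a b x y) (cong₂ _⊕_ (trans (*-comm x _) (cong (_⊗ x)
          (dot-sym v a))) (trans (*-comm y _) (cong (_⊗ y) (dot-sym v b)))))))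

    -- If M v = c e, the updated matrix sends v to (a v x + b v y + c) e, which vanishes exactly on
    -- the line of v. If M v is not in ⟨e⟩, no update by a multiple of e brings v into the kernel.
    zeros-lines : ∀ e → e ≢ 0v → ∀ x y A → zeros (lines e A) x y ≡ cnt (plane e x y) A
    zeros-lines e e≢0 x y [] = refl
    zeros-lines e e≢0 x y (v ∷ A) with multiple? (mv M v) e
    ... | no n = cong₂ _+_ (sym (χ-no (plane e x y) v (λ h → n (_ , add≡0 _ e _ (trans (sym
        (mv-plane e x y v)) h))))) (zeros-lines e e≢0 x y A)
    ... | yes (c , h) = cong₂ _+_ (one (dot a v ⊗ x ⊕ dot b v ⊗ y ⊕ c ≟ 0k)) (zeros-lines e e≢0 x y A)
      where
      s = dot a v ⊗ x ⊕ dot b v ⊗ y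
      one : Dec (s ⊕ c ≡ 0k) → δ (s ⊕ c) ≡ χ (plane e x y) v
      one (yes z) = trans (δ-yes z) (sym (χ-yes (plane e x y) v (trans (mv-plane e x y v) (trans (cong
          (_+v s *v e) h) (add-multiple e c s (trans (+-comm c s) z))))))
      one (no n) = trans (δ-no n) (sym (χ-no (plane e x y) v (λ z → n (trans
        (⊕-congˡ (cancel-tail c (⊖ s) e≢0 (trans (sym h) (add≡0 _ e s (trans (sym (mv-plane e x y v)) z)))))
            (x⊖x s)))))

    incident : V k → V m → ℕ
    incident e v with multiple? (mv M v) e
    ... | yes _ = 1
    ... | no _ = 0

    length-lines : ∀ e A → length (lines e A) ≡ tot (incident e) A
    length-lines e [] = refl
    length-lines e (v ∷ A) with multiple? (mv M v) e
    ... | yes _ = cong suc (length-lines e A)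
    ... | no _ = length-lines e A

    nonzero : ∀ {j} → V j → ℕ
    nonzero e = 1 ∸ 𝟙 e 0v

    -- This is Q - 1, kept as a sum over the nonzero vectors; likewise `q′` is q - 1.
    Q′ : ℕ
    Q′ = tot nonzero (forms k)

    complement : ∀ {n} → n ≤ 1 → (1 ∸ n) + n ≡ 1
    complement = ℕP.m∸n+n≡m

    𝟙≤1 : ∀ {j} (u v : V j) → 𝟙 u v ≤ 1
    𝟙≤1 u v with u ≟v v
    ... | yes _ = s≤s z≤n
    ... | no _ = z≤n

    δ≤1 : ∀ x → δ x ≤ 1
    δ≤1 x with x ≟ 0k
    ... | yes _ = s≤s z≤n
    ... | no _ = z≤n

    Q′+1 : Q′ + 1 ≡ q ^ k
    Q′+1 = trans (cong (Q′ +_) (sym (tot-𝟙 {k} 0v))) (trans (sym (tot-+ nonzero (λ e → 𝟙 e 0v) (forms k)))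
      (trans (tot-cong (forms k) (λ e → complement (𝟙≤1 e 0v))) (count-forms k)))

    q′ : ℕ
    q′ = tot (λ s → 1 ∸ δ s) els

    q′+1 : q′ + 1 ≡ q
    q′+1 = trans (cong (q′ +_) (sym tot-δ)) (trans (sym (tot-+ (λ s → 1 ∸ δ s) δ els))
      (trans (tot-cong els (λ s → complement (δ≤1 s))) (trans (length≡tot els) length-els)))

    -- M v ≢ 0 lies on ⟨e⟩ for the q − 1 nonzero multiples e of M v only.
    incident-bound : ∀ v → tot (λ e → nonzero e * incident e v) (forms k) ≤ χ M v * Q′ + (1 ∸ χ M v) * q′
    incident-bound v with mv M v ≟v 0v
    ... | yes h = subst (λ z → tot (λ e → nonzero e * incident e v) (forms k) ≤ z * Q′ + (1 ∸ z) * q′) (sym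
        (χ-yes M v h))
      (ℕP.≤-trans (tot-mono (forms k) (λ e → ℕP.≤-trans (ℕP.*-monoʳ-≤ (nonzero e) (≤1 e)) (ℕP.≤-reflexive
          (ℕP.*-identityʳ _)))) (ℕP.≤-reflexive (sym (trans (ℕP.+-identityʳ _) (ℕP.+-identityʳ _)))))
      where
      ≤1 : ∀ e → incident e v ≤ 1
      ≤1 e with multiple? (mv M v) e
      ... | yes _ = s≤s z≤n
      ... | no _ = z≤n
    ... | no w≢0 = subst (λ z → tot (λ e → nonzero e * incident e v) (forms k) ≤ z * Q′ + (1 ∸ z) * q′) (sym
        (χ-no M v w≢0))
      (ℕP.≤-trans (tot-mono (forms k) pointwise) (ℕP.≤-reflexive (trans (tot-swap _ (forms k) els) (trans
        (tot-cong els (λ s → trans (tot-* (1 ∸ δ s) (λ e → 𝟙 e (s *v mv M v)) (forms k)) (trans (cong ((1 ∸ δ s) *_)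
            (tot-𝟙 (s *v mv M v))) (ℕP.*-identityʳ _))))
        (sym (ℕP.+-identityʳ q′))))))
      where
      pointwise : ∀ e → nonzero e * incident e v ≤ tot (λ s → (1 ∸ δ s) * 𝟙 e (s *v mv M v)) els
      pointwise e with multiple? (mv M v) e
      ... | no _ = ℕP.≤-trans (ℕP.≤-reflexive (ℕP.*-zeroʳ (nonzero e))) z≤n
      ... | yes (c , h) with c ≟ 0k
      ...   | yes refl = ⊥-elim (w≢0 (trans h (0*v e)))
      ...   | no c≢0 with inverse c c≢0
      ...     | u , cu = ℕP.≤-trans (ℕP.≤-trans (ℕP.≤-reflexive (ℕP.*-identityʳ _)) (ℕP.m∸n≤m 1 (𝟙 e 0v)))
          (ℕP.≤-trans (ℕP.≤-reflexive (sym at)) (≤tot _ (∈-allFin u)))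
        where
        inv : ∀ {j} (e : V j) → e ≡ u *v (c *v e)
        inv [] = refl
        inv (x ∷ e) = cong₂ _∷_ (trans (sym (*-identityˡ x)) (trans (cong (_⊗ x) (sym cu)) (solve 3
            (λ c u x → c :* u :* x := u :* (c :* x)) refl c u x))) (inv e)
        u≢0 : u ≢ 0k
        u≢0 z = 1≢0 (trans (sym cu) (trans (cong (c ⊗_) z) (zeroʳ c)))
        at : (1 ∸ δ u) * 𝟙 e (u *v mv M v) ≡ 1
        at = cong₂ (λ x y → (1 ∸ x) * y) (δ-no u≢0) (𝟙-yes (trans (inv e) (cong (u *v_) (sym h))))

    -- Each of the (q ^ k − 1) / (q − 1) directions e contributes 3 q − 3 points off the kernel of M.
    cover-bound : 2 ≤ q → ∀ A → cnt M A ≡ 1 → All (λ v → mv M v ≡ 0v → dot a v ≢ 0k) A →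
      (∀ e → e ≢ 0v → ∀ x y → ¬ (x ≡ 0k × y ≡ 0k) → 2 ≤ cnt (plane e x y) A) → 3 * q ^ k ≤ length A + 2
    cover-bound q≥2 A one off two = ℕP.≤-trans (ℕP.≤-reflexive (trans (cong (3 *_) (sym Q′+1))
        (ℕP.*-distribˡ-+ 3 Q′ 1)))
      (ℕP.≤-trans (ℕP.+-monoˡ-≤ 3 final) (ℕP.≤-reflexive (trans (sym (ℕP.+-assoc r 1 2)) (cong (_+ 2) (trans (cong
          (r +_) (sym one))
        (trans (sym (tot-+ (λ v → 1 ∸ χ M v) (χ M) A)) (trans (tot-cong A (λ v → complement (χ≤1 M v)))
            (length≡tot A))))))))
      where
      r = tot (λ v → 1 ∸ χ M v) A
      at0 : ∀ e A → cnt (plane e 0k 0k) A ≡ cnt M A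
      at0 e A = tot-cong A (λ v → χ-cong {M = plane e 0k 0k} {M} (trans (mv-plane e 0k 0k v) (trans (cong
          (λ s → mv M v +v s *v e) (trans (cong₂ _⊕_ (zeroʳ _) (zeroʳ _)) (+-identityʳ 0k)))
        (trans (cong (mv M v +v_) (0*v e)) (trans (+v-comm _ _) (+v-identityˡ _))))))
      off-lines : ∀ e A → All (λ v → mv M v ≡ 0v → dot a v ≢ 0k) A → All (λ g → ev g 0k 0k ≡ 0k → proj₁ g ≢ 0k)
          (lines e A)
      off-lines e [] [] = []
      off-lines e (v ∷ A) (h ∷ hs) with multiple? (mv M v) e
      ... | no _ = off-lines e A hs
      ... | yes (c , w) = (λ z → h (trans w (trans (cong (_*v e) (trans (sym (trans (⊕-congʳ (trans (cong₂ _⊕_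
          (zeroʳ _) (zeroʳ _)) (+-identityʳ 0k))) (+-identityˡ c))) z)) (0*v e)))) ∷ off-lines e A hs
      per-direction : ∀ e → nonzero e * (3 * q) ≤ nonzero e * tot (incident e) A + nonzero e * 2
      per-direction e with e ≟v 0v
      ... | yes _ = z≤n
      ... | no e≢0 = ℕP.≤-trans (ℕP.*-monoʳ-≤ 1 (ℕP.≤-trans (double-cover (lines e A)
            (λ x y n → ℕP.≤-trans (two e e≢0 x y n) (ℕP.≤-reflexive (sym (zeros-lines e e≢0 x y A))))
            (trans (zeros-lines e e≢0 0k 0k A) (trans (at0 e A) one)) (off-lines e A off)) (ℕP.≤-reflexive (cong
                (_+ 2) (length-lines e A)))))
          (ℕP.≤-reflexive (ℕP.*-distribˡ-+ 1 (tot (incident e) A) 2))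
      -- The sum runs over nonzero vectors e instead of directions. The point in ker M is then
      -- counted Q - 1 times and each of the r others at most q - 1 times.
      summed : Q′ * (3 * q) ≤ (1 * Q′ + r * q′) + Q′ * 2
      summed = ℕP.≤-trans (ℕP.≤-reflexive (sym (tot-*ʳ (3 * q) nonzero (forms k)))) (ℕP.≤-trans (tot-mono
          (forms k) per-direction)
        (ℕP.≤-trans (ℕP.≤-reflexive (tot-+ (λ e → nonzero e * tot (incident e) A) (λ e → nonzero e * 2) (forms k)))
        (ℕP.+-mono-≤ (ℕP.≤-trans (ℕP.≤-reflexive (trans (tot-cong (forms k) (λ e → sym (tot-* (nonzero e)
            (incident e) A))) (tot-swap (λ e v → nonzero e * incident e v) (forms k) A)))
          (ℕP.≤-trans (tot-mono A incident-bound) (ℕP.≤-reflexive (trans (tot-+ (λ v → χ M v * Q′) (λ v →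
              (1 ∸ χ M v) * q′) A)
            (cong₂ _+_ (trans (tot-*ʳ Q′ (χ M) A) (cong (_* Q′) one)) (tot-*ʳ q′ (λ v → 1 ∸ χ M v) A))))))
          (ℕP.≤-reflexive (tot-*ʳ 2 nonzero (forms k))))))
      -- After subtracting 3 (Q - 1) from both sides, `summed` reads 3 (Q - 1) (q - 1) ≤ r (q - 1),
      -- and q ≥ 2 allows cancellation.
      final : 3 * Q′ ≤ r
      final = ℕP.*-cancelʳ-≤ (3 * Q′) r q′ ⦃ Data.Nat.>-nonZero (ℕP.≤-pred (ℕP.≤-trans q≥2 (ℕP.≤-reflexive (trans
          (sym q′+1) (ℕP.+-comm q′ 1))))) ⦄
        (ℕP.+-cancelʳ-≤ (3 * Q′) _ _ (ℕP.≤-trans (ℕP.≤-reflexive (trans (S.solve 2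
            (λ Q q → S.con 3 S.:* Q S.:* q S.:+ S.con 3 S.:* Q S.:= Q S.:* (S.con 3 S.:*
            (q S.:+ S.con 1))) refl Q′ q′) (cong (λ z → Q′ * (3 * z)) q′+1)))
          (ℕP.≤-trans summed (ℕP.≤-reflexive (S.solve 3 (λ Q q r →
              (S.con 1 S.:* Q S.:+ r S.:* q) S.:+ Q S.:* S.con 2 S.:= r S.:* q S.:+ S.con 3 S.:* Q) refl Q′ q′ r)))))
        where module S = +-*-Solver

-- Discarding the small classes point by point

module Descent {q : ℕ} (K : FinField q) where
  open import Data.Nat using (suc; _≤_; _<_; s≤s; z≤n; _+_; _*_; _^_; _≤?_)
  import Data.Nat.Properties as ℕP
  open import Data.Fin using (_≟_)
  open import Data.Product using (∃; _×_; _,_)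
  open import Data.Sum using (_⊎_; inj₁; inj₂)
  open import Data.Vec using ([]; _∷_)
  open import Data.List using (List; []; _∷_; length; _++_)
  open import Data.List.Properties using (length-++)
  open import Data.List.Membership.Propositional using (_∈_; _∉_)
  open import Data.List.Membership.Propositional.Properties using (∈-++⁺ˡ; ∈-++⁺ʳ; ∈-++⁻)
  open import Data.List.Relation.Unary.Any using (here; there)
  open import Data.List.Relation.Unary.All using (All; []; _∷_)
  import Data.List.Relation.Unary.All as All
  import Data.List.Relation.Unary.All.Properties as AllP
  open import Data.List.Relation.Unary.AllPairs using ([]; _∷_)
  open import Data.List.Relation.Unary.Unique.Propositional using (Unique)
  open import Data.Nat.Solver using (module +-*-Solver)
  open import Data.Empty using (⊥; ⊥-elim)
  open import Relation.Nullary using (¬_; yes; no; Dec)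
  open import Relation.Binary.PropositionalEquality
  open FinField K
  open Field K
  open Counting K
  open Linear K
  open Cover K

  nonvanishing : ∀ {m} (v : V m) → v ≢ 0v → ∃ λ b → dot b v ≢ 0k
  nonvanishing [] n = ⊥-elim (n refl)
  nonvanishing (p ∷ v) n with p ≟ 0k
  ... | no p≢0 = 1k ∷ 0v , λ e → p≢0 (trans (sym (trans (cong₂ _⊕_ (*-identityˡ p) (trans (dot-sym 0v v) (dot-0 v)))
      (+-identityʳ p))) e)
  ... | yes p≡0 with nonvanishing v (λ e → n (cong₂ _∷_ p≡0 e))
  ...   | b , h = 0k ∷ b , λ e → h (trans (sym (trans (⊕-congʳ (zeroˡ p)) (+-identityˡ _))) e)

  scale-≢0 : ∀ {k} s (e : V k) → s ≢ 0k → e ≢ 0v → s *v e ≢ 0v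
  scale-≢0 s e s≢0 e≢0 h = s≢0 (cancel-tail s 0k e≢0 (trans h (sym (0*v e))))

  module _ {k m} (M : Mat k m) where
    χ⇒kernel : ∀ {v} → 1 ≤ χ M v → mv M v ≡ 0v
    χ⇒kernel {v} h with mv M v ≟v 0v
    ... | yes e = e
    ... | no n = ⊥-elim (ℕP.<⇒≢ h (sym (χ-no M v n)))

    cnt⇒∃ : ∀ L → 1 ≤ cnt M L → ∃ λ v → v ∈ L × mv M v ≡ 0v
    cnt⇒∃ (v ∷ L) h with mv M v ≟v 0v
    ... | yes e = v , here refl , e
    ... | no n with cnt⇒∃ L (subst (λ z → 1 ≤ z + cnt M L) (χ-no M v n) h)
    ...   | w , i , e = w , there i , e

    cnt≡0⇒ : ∀ L → cnt M L ≡ 0 → All (λ v → mv M v ≢ 0v) L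
    cnt≡0⇒ [] h = []
    cnt≡0⇒ (v ∷ L) h = (λ e → ℕP.1+n≢0 (trans (sym (cong (_+ cnt M L) (χ-yes M v e))) h)) ∷ cnt≡0⇒ L (ℕP.m+n≡0⇒n≡0
        (χ M v) h)

    cnt≡1⇒ : ∀ L → cnt M L ≡ 1 → ∃ λ u → u ∈ L × mv M u ≡ 0v × All (λ v → mv M v ≡ 0v → v ≡ u) L
    cnt≡1⇒ (v ∷ L) h with mv M v ≟v 0v
    ... | yes e = v , here refl , e , (λ _ → refl) ∷ All.map (λ n e → ⊥-elim (n e)) (cnt≡0⇒ L (ℕP.suc-injective
        (trans (cong (_+ cnt M L) (sym (χ-yes M v e))) h)))
    ... | no n with cnt≡1⇒ L (trans (cong (_+ cnt M L) (sym (χ-no M v n))) h)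
    ...   | u , i , e , all = u , there i , e , (λ e → ⊥-elim (n e)) ∷ all

    off : List (V m) → List (V m)
    off [] = []
    off (v ∷ D) with mv M v ≟v 0v
    ... | yes _ = off D
    ... | no _ = v ∷ off D

    off-misses : ∀ D → All (λ v → mv M v ≢ 0v) (off D)
    off-misses [] = []
    off-misses (v ∷ D) with mv M v ≟v 0v
    ... | yes _ = off-misses D
    ... | no n = n ∷ off-misses D

    length-off : ∀ D → length (off D) ≤ length D
    length-off [] = z≤n
    length-off (v ∷ D) with mv M v ≟v 0v
    ... | yes _ = ℕP.m≤n⇒m≤1+n (length-off D)
    ... | no _ = s≤s (length-off D)

    cnt-misses : ∀ L → All (λ v → mv M v ≢ 0v) L → cnt M L ≡ 0
    cnt-misses L h = tot-zero L (All.map (λ {v} → χ-no M v) h)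

    cnt-off : ∀ (M′ : Mat k m) D → tot (λ v → χ M v * χ M′ v) D + cnt M′ (off D) ≡ cnt M′ D
    cnt-off M′ [] = refl
    cnt-off M′ (v ∷ D) with mv M v ≟v 0v
    ... | yes e = trans (ℕP.+-assoc (χ M v * χ M′ v) _ _) (cong₂ _+_ (trans (cong (_* χ M′ v) (χ-yes M v e))
        (ℕP.*-identityˡ _)) (cnt-off M′ D))
    ... | no n = trans (cong (λ z → z * χ M′ v + tot (λ v → χ M v * χ M′ v) D + (χ M′ v + cnt M′ (off D)))
        (χ-no M v n))
      (trans (sym (ℕP.+-assoc (tot (λ v → χ M v * χ M′ v) D) _ _)) (trans (cong (_+ cnt M′ (off D)) (ℕP.+-comm _
          (χ M′ v)))
      (trans (ℕP.+-assoc (χ M′ v) _ _) (cong (χ M′ v +_) (cnt-off M′ D)))))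

    tot-χχ< : ∀ (M′ : Mat k m) {v D} → v ∈ D → mv M v ≡ 0v → mv M′ v ≢ 0v → tot (λ v → χ M v * χ M′ v) D < cnt M D
    tot-χχ< M′ {v} {_ ∷ D} (here refl) e n = ℕP.+-mono-<-≤ (subst₂ _<_ (sym (trans (cong (χ M v *_) (χ-no M′ v n))
        (ℕP.*-zeroʳ (χ M v)))) (sym (χ-yes M v e)) (s≤s z≤n)) (tot-mono D (product≤ M′))
      where
      product≤ : ∀ M′ v → χ M v * χ M′ v ≤ χ M v
      product≤ M′ v = ℕP.≤-trans (ℕP.*-monoʳ-≤ (χ M v) (χ≤1 M′ v)) (ℕP.≤-reflexive (ℕP.*-identityʳ _))
    tot-χχ< M′ {v} {u ∷ D} (there i) e n = ℕP.+-mono-≤-< (ℕP.≤-trans (ℕP.*-monoʳ-≤ (χ M u) (χ≤1 M′ u))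
        (ℕP.≤-reflexive (ℕP.*-identityʳ _))) (tot-χχ< M′ i e n)

    another : ∀ {u D} → Unique D → 2 ≤ cnt M D → ∃ λ v → v ∈ D × mv M v ≡ 0v × v ≢ u
    another {u} {v ∷ D} (v∉D ∷ uniq) h with mv M v ≟v 0v
    ... | no n with another {u} uniq (subst (λ z → 2 ≤ z + cnt M D) (χ-no M v n) h)
    ...   | w , i , r = w , there i , r
    another {u} {v ∷ D} (v∉D ∷ uniq) h | yes e with v ≟v u
    ... | no n = v , here refl , e , n
    ... | yes refl with cnt⇒∃ D (ℕP.≤-pred (subst (λ z → 2 ≤ z + cnt M D) (χ-yes M v e) h))
    ...   | w , i , e′ = w , there i , e′ , λ z → All.lookup v∉D i (sym z)

  TwoBlocks : ∀ {m} → ℕ → List (V m) → Set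
  TwoBlocks {m} k L = ∀ (M : Mat k m) → 2 ≤ cnt M L

  cnt-++ : ∀ {k m} (M : Mat k m) L L′ → cnt M (L ++ L′) ≡ cnt M L + cnt M L′
  cnt-++ M = tot-++ (χ M)

  -- A matrix violating the conclusion, with cnt M D minimal, would violate cover-bound.
  module _ {k m : ℕ} (q≥2 : 2 ≤ q) (C D E : List (V m)) (P P′ : V m) (M : Mat k m) (a b : V m)
    (small : length C + 2 * length D + 1 < 3 * q ^ k)
    (len : suc (length E) ≤ length D)
    (split : ∀ (M : Mat k m) → 2 ≤ χ M P + cnt M (C ++ E))
    (minimal : ∀ (M′ : Mat k m) → cnt M′ D < cnt M D → 2 ≤ cnt M′ (C ++ E))
    (cnt≡1 : cnt M (C ++ E) ≡ 1)
    (a-off : All (λ v → mv M v ≡ 0v → dot a v ≢ 0k) (C ++ E))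
    (P-in : mv M P ≡ 0v) (P′-in : mv M P′ ≡ 0v) (P′∈D : P′ ∈ D)
    (aP≡0 : dot a P ≡ 0k) (aP′≢0 : dot a P′ ≢ 0k) (bP≢0 : dot b P ≢ 0k) where

    private
      -- Points of E may reappear in `N`. Repetitions are harmless: lines are counted with
      -- multiplicity, and so is the length of `A`.
      N A : List (V m)
      N = off M D
      A = (C ++ E) ++ N

      one≤ : ∀ (M : Mat k m) → 1 ≤ cnt M (C ++ E)
      one≤ M = ℕP.+-cancelˡ-≤ 1 _ _ (ℕP.≤-trans (split M) (ℕP.+-monoˡ-≤ _ (χ≤1 M P)))

      cntA : cnt M A ≡ 1
      cntA = trans (cnt-++ M (C ++ E) N) (cong₂ _+_ cnt≡1 (cnt-misses M N (off-misses M D)))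

      off-a : All (λ v → mv M v ≡ 0v → dot a v ≢ 0k) A
      off-a = AllP.++⁺ a-off (All.map (λ n e → ⊥-elim (n e)) (off-misses M D))

      -- The discarded point P makes E shorter than D by at least one; this is the - 1 in |A| ≤ |C|
      -- + 2 |D| - 1.
      lengths : length A + 2 ≤ length C + 2 * length D + 1
      lengths = ℕP.≤-trans (ℕP.+-monoˡ-≤ 2 (ℕP.≤-trans (ℕP.≤-reflexive (trans (length-++ (C ++ E)) (cong
          (_+ length N) (length-++ C)))) (ℕP.+-monoʳ-≤ (length C + length E) (length-off M D))))
        (ℕP.≤-trans (ℕP.≤-reflexive (S.solve 3 (λ c e d → c S.:+ e S.:+ d S.:+ S.con 2 S.:= c S.:+
            (S.con 1 S.:+ e) S.:+ d S.:+ S.con 1) refl (length C) (length E) (length D)))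
        (ℕP.≤-trans (ℕP.+-monoˡ-≤ 1 (ℕP.+-monoˡ-≤ (length D) (ℕP.+-monoʳ-≤ (length C) len)))
        (ℕP.≤-reflexive (S.solve 2 (λ c d → c S.:+ d S.:+ d S.:+ S.con 1 S.:= c S.:+ S.con 2 S.:* d S.:+ S.con 1)
            refl (length C) (length D)))))
        where module S = +-*-Solver

      moved : ∀ e x y v → e ≢ 0v → mv M v ≡ 0v → dot a v ⊗ x ⊕ dot b v ⊗ y ≢ 0k → mv (plane M a b e x y) v ≢ 0v
      moved e x y v e≢0 z s≢0 h = scale-≢0 _ e s≢0 e≢0 (trans (sym (trans (mv-plane M a b e x y v) (trans
          (cong₂ _+v_ z refl) (+v-identityˡ _)))) h)

      module Moved (M′ : Mat k m) (bad : ¬ 2 ≤ cnt M′ (C ++ E)) where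
        P-in′ : mv M′ P ≢ 0v → ⊥
        P-in′ n = bad (subst (λ z → 2 ≤ z + cnt M′ (C ++ E)) (χ-no M′ P n) (split M′))

        more : cnt M D ≤ cnt M′ D
        more with cnt M D ≤? cnt M′ D
        ... | yes p = p
        ... | no p = ⊥-elim (bad (minimal M′ (ℕP.≰⇒> p)))

        -- The kernel of M′ has at least as many points of D as that of M but has lost P′, so it has
        -- gained a point of D off ker M.
        N-hit : mv M′ P′ ≢ 0v → 1 ≤ cnt M′ N
        N-hit P′-out = ℕP.+-cancelˡ-≤ (tot (λ v → χ M v * χ M′ v) D) _ _ (ℕP.≤-trans (ℕP.≤-reflexive (ℕP.+-comm _ 1))
          (ℕP.≤-trans (tot-χχ< M M′ P′∈D P′-in P′-out) (ℕP.≤-trans more (ℕP.≤-reflexive (sym (cnt-off M M′ D))))))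

        A-hit : mv M′ P′ ≢ 0v → 2 ≤ cnt M′ A
        A-hit P′-out = ℕP.≤-trans (ℕP.+-mono-≤ (one≤ M′) (N-hit P′-out)) (ℕP.≤-reflexive (sym (cnt-++ M′ (C ++ E) N)))

      two : ∀ e → e ≢ 0v → ∀ x y → ¬ (x ≡ 0k × y ≡ 0k) → 2 ≤ cnt (plane M a b e x y) A
      two e e≢0 x y xy≢0 = cases (2 ≤? cnt M′ (C ++ E)) (y ≟ 0k)
        where
        M′ = plane M a b e x y
        cases : Dec (2 ≤ cnt M′ (C ++ E)) → Dec (y ≡ 0k) → 2 ≤ cnt M′ A
        cases (yes good) _ = ℕP.≤-trans good (ℕP.≤-trans (ℕP.m≤m+n _ _) (ℕP.≤-reflexive (sym (cnt-++ M′ (C ++ E) N))))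
        -- A bad kernel must contain P, since it met C ++ P ∷ E twice; but y ≠ 0 moves P by b P y ≠
        -- 0.
        cases (no bad) (no y≢0) = ⊥-elim (Moved.P-in′ M′ bad (moved e x y P e≢0 P-in
          (λ z → ⊗-nonzero bP≢0 y≢0 (trans (sym (trans (⊕-congʳ (trans (⊗-congʳ aP≡0) (zeroˡ x)))
              (+-identityˡ _))) z))))
        -- Here x ≠ 0, so P′ moves by a P′ x ≠ 0; the point gained in `N` joins the one that C ++ E
        -- always retains.
        cases (no bad) (yes y≡0) = Moved.A-hit M′ bad (moved e x y P′ e≢0 P′-in
          (λ z → ⊗-nonzero aP′≢0 (λ x≡0 → xy≢0 (x≡0 , y≡0)) (trans (sym (trans (⊕-congˡ (trans (⊗-congˡ y≡0)
              (zeroʳ _))) (+-identityʳ _))) z)))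

    no-minimal : ⊥
    no-minimal = ℕP.<⇒≱ (ℕP.≤-<-trans lengths small) (cover-bound M a b q≥2 A cntA off-a two)

  module _ {k n : ℕ} (q≥3 : 3 ≤ q) (C D : List (V (suc (suc n))))
    (indep : ∀ {u v} → u ∈ C ++ D → v ∈ C ++ D → u ≢ v → Indep2 u v)
    (D-unique : Unique D)
    (C⊎D : ∀ (M : Mat k (suc (suc n))) → 2 ≤ cnt M C ⊎ 2 ≤ cnt M D)
    (small : length C + 2 * length D + 1 < 3 * q ^ k) where

    private
      -- Induction on `cnt M D`, with t as its strict upper bound. When M fails, all matrices with
      -- fewer points of D in the kernel are already known to succeed, so M may be treated as a
      -- minimal failure.
      remove-one : ∀ P E → P ∈ D → (∀ {v} → v ∈ E → v ∈ D) → P ∉ C ++ E → length (P ∷ E) ≤ length D →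
        TwoBlocks k (C ++ P ∷ E) → TwoBlocks k (C ++ E)
      remove-one P E P∈D E⊆D P∉ len blocks M = rec (suc (cnt M D)) M ℕP.≤-refl
        where
        ⊆CD : ∀ {v} → v ∈ C ++ E → v ∈ C ++ D
        ⊆CD i with ∈-++⁻ C i
        ... | inj₁ j = ∈-++⁺ˡ j
        ... | inj₂ j = ∈-++⁺ʳ C (E⊆D j)

        split : ∀ (M : Mat k (suc (suc n))) → 2 ≤ χ M P + cnt M (C ++ E)
        split M = subst (2 ≤_) (trans (cnt-++ M C (P ∷ E)) (trans (sym (ℕP.+-assoc (cnt M C) _ _)) (trans (cong
            (_+ cnt M E) (ℕP.+-comm (cnt M C) (χ M P)))
          (trans (ℕP.+-assoc (χ M P) _ _) (cong (χ M P +_) (sym (cnt-++ M C E))))))) (blocks M)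

        D-hit : ∀ (M : Mat k (suc (suc n))) → ¬ 2 ≤ cnt M (C ++ E) → 2 ≤ cnt M D
        D-hit M bad with C⊎D M
        ... | inj₂ h = h
        ... | inj₁ h = ⊥-elim (bad (ℕP.≤-trans h (ℕP.≤-trans (ℕP.m≤m+n _ (cnt M E)) (ℕP.≤-reflexive (sym
            (cnt-++ M C E))))))

        exact : ∀ (M : Mat k (suc (suc n))) → ¬ 2 ≤ cnt M (C ++ E) → cnt M (C ++ E) ≡ 1
        exact M bad = ℕP.≤-antisym (ℕP.≤-pred (ℕP.≰⇒> bad)) (ℕP.+-cancelˡ-≤ 1 _ _ (ℕP.≤-trans (split M)
            (ℕP.+-monoˡ-≤ _ (χ≤1 M P))))

        rec : ∀ t (M : Mat k (suc (suc n))) → cnt M D < t → 2 ≤ cnt M (C ++ E)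
        step : ∀ t (M : Mat k (suc (suc n))) → cnt M D ≤ t → ¬ 2 ≤ cnt M (C ++ E) → ⊥
        rec (suc t) M (s≤s le) with 2 ≤? cnt M (C ++ E)
        ... | yes good = good
        ... | no bad = ⊥-elim (step t M le bad)
        step t M le bad =
          let cnt≡1 = exact M bad
              P₀ , P₀∈ , _ , only = cnt≡1⇒ M (C ++ E) cnt≡1
              -- A failing kernel meets C at most once, hence contains two points of D, one of them
              -- other than P. It may be P₀.
              P′ , P′∈D , P′-in , P′≢P = another M {P} D-unique (D-hit M bad)
              P-P₀ = indep (∈-++⁺ʳ C P∈D) (⊆CD P₀∈) (λ e → P∉ (subst (_∈ C ++ E) (sym e) P₀∈))
              P-P′ = indep (∈-++⁺ʳ C P∈D) (∈-++⁺ʳ C P′∈D) (λ e → P′≢P (sym e))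
              a , aP≡0 , aP₀≢0 , aP′≢0 = separate q≥3 P P₀ P′ P-P₀ P-P′
              b , bP≢0 = nonvanishing P (Indep2⇒≢0 (Indep2-sym P-P₀))
          in no-minimal (ℕP.≤-trans (s≤s (s≤s z≤n)) q≥3) C D E P P′ M a b small len split
            (λ M′ lt → rec t M′ (ℕP.<-≤-trans lt le)) cnt≡1
            (All.map (λ h e z → aP₀≢0 (trans (cong (dot a) (sym (h e))) z)) only)
            (χ⇒kernel M (ℕP.+-cancelʳ-≤ 1 1 (χ M P) (subst (λ z → 2 ≤ χ M P + z) cnt≡1 (split M))))
            P′-in P′∈D aP≡0 aP′≢0 bP≢0

    -- While E shrinks from D to the empty list, `C⊎D` and `small` keep referring to the full D;
    -- minimality is likewise measured by D and not by what remains of it.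
    C-blocks : (∀ {v} → v ∈ C → v ∉ D) → TwoBlocks k C
    C-blocks disjoint = λ M → subst (2 ≤_) (trans (cnt-++ M C []) (ℕP.+-identityʳ _)) (go D
        (λ i → i) D-unique ℕP.≤-refl start M)
      where
      start : TwoBlocks k (C ++ D)
      start M with C⊎D M
      ... | inj₁ h = ℕP.≤-trans h (ℕP.≤-trans (ℕP.m≤m+n _ (cnt M D)) (ℕP.≤-reflexive (sym (cnt-++ M C D))))
      ... | inj₂ h = ℕP.≤-trans h (ℕP.≤-trans (ℕP.m≤n+m _ (cnt M C)) (ℕP.≤-reflexive (sym (cnt-++ M C D))))
      go : ∀ E → (∀ {v} → v ∈ E → v ∈ D) → Unique E → length E ≤ length D → TwoBlocks k (C ++ E) → TwoBlocks k
          (C ++ [])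
      go [] _ _ _ h = h
      go (P ∷ E) ⊆D (P∉E ∷ u) len h = go E (λ i → ⊆D (there i)) u (ℕP.≤-trans (ℕP.n≤1+n _) len)
        (remove-one P E (⊆D (here refl)) (λ i → ⊆D (there i)) P∉ len h)
        where
        P∉ : P ∉ C ++ E
        P∉ i with ∈-++⁻ C i
        ... | inj₁ j = disjoint j (⊆D (here refl))
        ... | inj₂ j = All.lookup P∉E j refl

-- The numerical inequality behind the dominance of one class

module Arith where
  open import Data.Nat using (ℕ; suc; _≤_; s≤s; z≤n; _+_; _*_; _∸_)
  import Data.Nat
  import Data.Nat.Properties as ℕP
  open import Data.Sum using (inj₁; inj₂)
  open import Data.Nat.Solver using (module +-*-Solver)
  open import Data.Empty using (⊥; ⊥-elim)
  open import Relation.Binary.PropositionalEquality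
  open +-*-Solver using () renaming (solve to solveℕ; _:+_ to _+'_; _:*_ to _*'_; _:=_ to _≔_; con to #)

  ≤-by : ∀ {a b c d} → a ≡ b → b ≤ c → c ≡ d → a ≤ d
  ≤-by e h e′ = ℕP.≤-trans (ℕP.≤-reflexive e) (ℕP.≤-trans h (ℕP.≤-reflexive e′))

  -- With y = y′ + 1 and ρ = y′ + t: if 15 y ≤ 14 Q, `first` and `third` already give 10 ρ ≤ 3 Q. Otherwise s and y are both close to Q,
  -- and the right-hand side of `second` is less than 10 Q² + 2 s y.
  module _ (Q s y′ t : ℕ) (Q≥239 : 239 ≤ Q) (y≤s : suc y′ ≤ s)
    (first : 2 * Q * Q ≤ s * Q + suc y′ * (y′ + t))
    (second : 10 * Q * Q + 2 * (s * suc y′) ≤ 4 * (s + suc y′) * Q + (s * s + suc y′ * suc y′) + 5 * (suc y′ * t))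
    (third : 50 * (s + (y′ + t)) ≤ 101 * Q) where

    private
      y ρ u : ℕ
      y = suc y′
      ρ = y′ + t
      u = s ∸ y

      instance
        Q≢0 : Data.Nat.NonZero Q
        Q≢0 = Data.Nat.>-nonZero (ℕP.≤-trans (s≤s z≤n) Q≥239)

      -- Eliminates s: fifty times `first` plus Q times `third`.
      combined : 50 * ρ * Q ≤ Q * Q + 50 * (y * ρ)
      combined = ℕP.+-cancelˡ-≤ (100 * (Q * Q) + 50 * s * Q) _ _ (≤-by
        (solveℕ 3 (λ Q s r → # 100 *' (Q *' Q) +' # 50 *' s *' Q +' # 50 *' r *' Q ≔ # 50 *'
            (# 2 *' Q *' Q) +' # 50 *' (s +' r) *' Q) refl Q s ρ)
        (ℕP.+-mono-≤ (ℕP.*-monoʳ-≤ 50 first) (ℕP.*-monoˡ-≤ Q third))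
        (solveℕ 3 (λ Q s yr → # 50 *' (s *' Q +' yr) +' # 101 *' Q *' Q ≔ # 100 *' (Q *' Q) +' # 50 *' s *' Q +'
            (Q *' Q +' # 50 *' yr)) refl Q s (y * ρ)))

      -- Inserting y ≤ 14 Q / 15 in `combined` leaves 50 (1 - 14 / 15) ρ = 10 ρ / 3 ≤ Q, which is
      -- the origin of the threshold 14 / 15.
      small-y : 15 * y ≤ 14 * Q → 10 * ρ ≤ 3 * Q
      small-y h = ℕP.*-cancelʳ-≤ (10 * ρ) (3 * Q) (5 * Q) ⦃ ℕP.m*n≢0 5 Q ⦄ (ℕP.+-cancelʳ-≤ (700 * (ρ * Q)) _ _ (≤-by
        (solveℕ 2 (λ r Q → # 10 *' r *' (# 5 *' Q) +' # 700 *' (r *' Q) ≔ # 15 *' (# 50 *' r *' Q)) refl ρ Q)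
        (ℕP.≤-trans (ℕP.*-monoʳ-≤ 15 combined) (≤-by
          (solveℕ 3 (λ Q y r → # 15 *' (Q *' Q +' # 50 *' (y *' r)) ≔ # 15 *' (Q *' Q) +' # 50 *' r *'
              (# 15 *' y)) refl Q y ρ)
          (ℕP.+-monoʳ-≤ (15 * (Q * Q)) (ℕP.*-monoʳ-≤ (50 * ρ) h))
          refl))
        (solveℕ 2 (λ r Q → # 15 *' (Q *' Q) +' # 50 *' r *' (# 14 *' Q) ≔ # 3 *' Q *' (# 5 *' Q) +' # 700 *'
            (r *' Q)) refl ρ Q)))

      s≡ : s ≡ y + u
      s≡ = sym (ℕP.m+[n∸m]≡n y≤s)

      total : 50 * (2 * y + u + t) ≤ 102 * Q
      total = ℕP.≤-trans (≤-by (solveℕ 3 (λ y u t → # 50 *' (# 2 *' (# 1 +' y) +' u +' t) ≔ # 50 *' (# 1 +' y +' u +'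
          (y +' t)) +' # 50) refl y′ u t)
        (ℕP.+-mono-≤ (subst (λ z → 50 * (z + ρ) ≤ 101 * Q) s≡ third) (ℕP.≤-trans (ℕP.m≤m+n 50 189) Q≥239))
        refl) (ℕP.≤-reflexive (solveℕ 1 (λ Q → # 101 *' Q +' Q ≔ # 102 *' Q) refl Q))

      -- Three times `third`, with the rounding term 150 absorbed by a single Q. Tripling `total`
      -- would give 306 in place of 304, too weak for the bound on u + t below.
      total′ : 300 * y + 150 * (u + t) ≤ 304 * Q
      total′ = ℕP.≤-trans (≤-by (solveℕ 3 (λ y u t → # 300 *' (# 1 +' y) +' # 150 *' (u +' t) ≔ # 3 *' (# 50 *'
          (# 1 +' y +' u +' (y +' t))) +' # 150) refl y′ u t)
        (ℕP.+-mono-≤ (ℕP.*-monoʳ-≤ 3 (subst (λ z → 50 * (z + ρ) ≤ 101 * Q) s≡ third)) (ℕP.≤-trans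
            (ℕP.m≤m+n 150 89) Q≥239))
        refl) (ℕP.≤-reflexive (solveℕ 1 (λ Q → # 3 *' (# 101 *' Q) +' Q ≔ # 304 *' Q) refl Q))

      -- In units of Q², `second′` has 10 on the left, but on the right at most 8.16 from 4 (s + y)
      -- Q and 0.816 from u² + 5 y t. Multiplying by 1250 clears the denominators: 12500 against
      -- 11220.
      large-y : 14 * Q ≤ 15 * y → ⊥
      large-y h = ℕP.<⇒≱ (ℕP.*-monoˡ-< (Q * Q) ⦃ ℕP.m*n≢0 Q Q ⦄ {11220} {12500} (ℕP.m≤m+n 11221 1279)) contradiction
        where
        ut : 25 * (u + t) ≤ 4 * Q
        ut = ℕP.*-cancelˡ-≤ 6 (ℕP.+-cancelˡ-≤ (280 * Q) _ _ (≤-by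
          (solveℕ 2 (λ Q v → # 280 *' Q +' # 6 *' (# 25 *' v) ≔ # 20 *' (# 14 *' Q) +' # 150 *' v) refl Q (u + t))
          (ℕP.+-monoˡ-≤ (150 * (u + t)) (ℕP.*-monoʳ-≤ 20 h))
          (solveℕ 2 (λ y v → # 20 *' (# 15 *' y) +' # 150 *' v ≔ # 300 *' y +' # 150 *' v) refl y (u + t)) ⟨≤⟩
          ≤-by refl total′ (solveℕ 1 (λ Q → # 304 *' Q ≔ # 280 *' Q +' # 6 *' (# 4 *' Q)) refl Q)))
          where
          infixr 1 _⟨≤⟩_
          _⟨≤⟩_ : ∀ {a b c} → a ≤ b → b ≤ c → a ≤ c
          _⟨≤⟩_ = ℕP.≤-trans
        y≤ : 50 * y ≤ 51 * Q
        y≤ = ℕP.*-cancelˡ-≤ 2 (ℕP.≤-trans (≤-by (solveℕ 1 (λ y → # 2 *' (# 50 *' y) ≔ # 50 *' (# 2 *' y)) refl y)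
          (ℕP.*-monoʳ-≤ 50 (ℕP.≤-trans (ℕP.m≤m+n (2 * y) u) (ℕP.m≤m+n (2 * y + u) t))) refl) (≤-by refl total
              (solveℕ 1 (λ Q → # 102 *' Q ≔ # 2 *' (# 51 *' Q)) refl Q)))
        s+y≤ : 50 * (s + y) ≤ 102 * Q
        s+y≤ = ℕP.≤-trans (≤-by (trans (cong (λ z → 50 * (z + y)) s≡) (solveℕ 2 (λ y u → # 50 *'
            (y +' u +' y) ≔ # 50 *' (# 2 *' y +' u)) refl y u))
          (ℕP.*-monoʳ-≤ 50 (ℕP.m≤m+n (2 * y + u) t)) refl) total
        u≤Q : 10 * u ≤ 51 * Q
        u≤Q = ℕP.≤-trans (ℕP.*-monoˡ-≤ u (ℕP.m≤m+n 10 15)) (ℕP.≤-trans (ℕP.*-monoʳ-≤ 25 (ℕP.m≤m+n u t))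
            (ℕP.≤-trans ut (ℕP.*-monoˡ-≤ Q (ℕP.m≤m+n 4 47))))
        -- The mixed term 2 s y turns s² + y² into the square of u = s - y.
        second′ : 10 * (Q * Q) ≤ 4 * (s + y) * Q + (u * u + 5 * (y * t))
        second′ = ℕP.+-cancelʳ-≤ (2 * ((y + u) * y)) _ _ (≤-by
          (solveℕ 3 (λ Q y u → # 10 *' (Q *' Q) +' # 2 *' ((y +' u) *' y) ≔ # 10 *' Q *' Q +' # 2 *'
              ((y +' u) *' y)) refl Q y u)
          (subst (λ s → 10 * Q * Q + 2 * (s * y) ≤ 4 * (s + y) * Q + (s * s + y * y) + 5 * (y * t)) s≡ second)
          (trans (solveℕ 4 (λ Q y u t → # 4 *' (y +' u +' y) *' Q +' ((y +' u) *' (y +' u) +' y *' y) +' # 5 *'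
              (y *' t)
              ≔ # 4 *' (y +' u +' y) *' Q +' (u *' u +' # 5 *' (y *' t)) +' # 2 *' ((y +' u) *' y)) refl Q y u t)
            (cong (λ s → 4 * (s + y) * Q + (u * u + 5 * (y * t)) + 2 * ((y + u) * y)) (sym s≡))))
        -- The generous bound 10 u ≤ 51 Q is chosen to match 50 y ≤ 51 Q: both summands then carry
        -- the factor 5.1 Q, and the bound on u + t finishes.
        squares : 1250 * (u * u + 5 * (y * t)) ≤ 1020 * (Q * Q)
        squares = ℕP.≤-trans (≤-by
          (solveℕ 3 (λ u y t → # 1250 *' (u *' u +' # 5 *' (y *' t)) ≔ # 125 *'
              (# 10 *' u *' u +' # 50 *' y *' t)) refl u y t)
          (ℕP.*-monoʳ-≤ 125 (ℕP.+-mono-≤ (ℕP.*-monoˡ-≤ u u≤Q) (ℕP.*-monoˡ-≤ t y≤)))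
          (solveℕ 3 (λ Q u t → # 125 *' (# 51 *' Q *' u +' # 51 *' Q *' t) ≔ # 255 *' Q *' (# 25 *'
              (u +' t))) refl Q u t))
          (≤-by refl (ℕP.*-monoʳ-≤ (255 * Q) ut) (solveℕ 1 (λ Q → # 255 *' Q *' (# 4 *' Q) ≔ # 1020 *'
              (Q *' Q)) refl Q))
        contradiction : 12500 * (Q * Q) ≤ 11220 * (Q * Q)
        contradiction = ℕP.≤-trans (≤-by (solveℕ 1 (λ Z → # 12500 *' Z ≔ # 1250 *' (# 10 *' Z)) refl (Q * Q))
            (ℕP.*-monoʳ-≤ 1250 second′) refl)
          (≤-by (solveℕ 3 (λ v Q S → # 1250 *' (# 4 *' v *' Q +' S) ≔ # 100 *' Q *' (# 50 *' v) +' # 1250 *' S) refl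
              (s + y) Q (u * u + 5 * (y * t)))
            (ℕP.+-mono-≤ (ℕP.*-monoʳ-≤ (100 * Q) s+y≤) squares)
            (solveℕ 1 (λ Q → # 100 *' Q *' (# 102 *' Q) +' # 1020 *' (Q *' Q) ≔ # 11220 *' (Q *' Q)) refl Q))

    excess-small : 10 * (y′ + t) ≤ 3 * Q
    excess-small with ℕP.≤-total (15 * y) (14 * Q)
    ... | inj₁ h = small-y h
    ... | inj₂ h = ⊥-elim (large-y h)

-- Averaging over all matrices

module Averages {q : ℕ} (K : FinField q) where
  open import Data.Nat using (zero; suc; pred; _≤_; s≤s; z≤n; _+_; _*_; _^_; _∸_; NonZero)
  import Data.Nat
  import Data.Nat.Properties as ℕP
  open import Data.Sum using (_⊎_; inj₁; inj₂)
  open import Data.List using (List; []; _∷_; length)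
  open import Data.List.Relation.Unary.Any using (Any; here; there)
  open import Data.List.Relation.Unary.All using (All; []; _∷_)
  open import Data.List.Relation.Unary.AllPairs using (AllPairs; []; _∷_)
  open import Data.Nat.Solver using (module +-*-Solver)
  open import Data.Empty using (⊥-elim)
  open import Relation.Binary.PropositionalEquality
  open Counting K
  open Linear K
  open Cover K
  open Arith using (≤-by)
  open +-*-Solver using () renaming (solve to solveℕ; _:+_ to _+'_; _:*_ to _*'_; _:=_ to _≔_; con to #)

  ^-distribʳ-* : ∀ k m n → (m * n) ^ k ≡ m ^ k * n ^ k
  ^-distribʳ-* zero m n = refl
  ^-distribʳ-* (suc k) m n = trans (cong (m * n *_) (^-distribʳ-* k m n)) (ℕP.[m*n]*[o*p]≡[m*o]*[n*p] m n (m ^ k)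
      (n ^ k))

  cnt² : ∀ {k m} (M : Mat k m) l → cnt M l * cnt M l ≡ cnt M l + 2 * pairs M l
  cnt² M [] = refl
  cnt² M (v ∷ l) = trans (solveℕ 2 (λ x c → (x +' c) *' (x +' c) ≔ x *' x +' # 2 *' (x *' c) +' c *' c) refl (χ M v)
      (cnt M l))
    (trans (cong₂ (λ y z → y + 2 * (χ M v * cnt M l) + z) χ² (cnt² M l))
    (solveℕ 4 (λ x xc c p → x +' # 2 *' xc +' (c +' # 2 *' p) ≔ x +' c +' # 2 *' (xc +' p)) refl (χ M v)
        (χ M v * cnt M l) (cnt M l) (pairs M l)))
    where
    χ² : χ M v * χ M v ≡ χ M v
    χ² with χ M v | χ≤1 M v
    ... | zero | _ = refl
    ... | suc zero | _ = refl
    ... | suc (suc _) | s≤s ()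

  2≤⇒pairs : ∀ X p → X * X ≡ X + 2 * p → 2 ≤ X → 1 ≤ p
  2≤⇒pairs X (suc p) e h = s≤s z≤n
  2≤⇒pairs X zero e h = ⊥-elim (ℕP.<⇒≢ (ℕP.m<m*n X X ⦃ Data.Nat.>-nonZero (ℕP.≤-trans (s≤s z≤n) h) ⦄ h) (sym (trans e
      (ℕP.+-identityʳ X))))

  -- (Y − X)² + 3 (X + Y) ≥ 10 as soon as X ≥ 2 or Y ≥ 2; here for Y = X + u.
  private
    quadratic≤ : ∀ c X u → c ≤ 6 * X + 3 * u + u * u → c + 2 * (X * (X + u)) ≤ 3 * X + 3 * (X + u) + X * X +
        (X + u) * (X + u)
    quadratic≤ c X u h = ≤-by refl (ℕP.+-monoˡ-≤ (2 * (X * (X + u))) h)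
      (solveℕ 2 (λ X u → # 6 *' X +' # 3 *' u +' u *' u +' # 2 *' (X *' (X +' u)) ≔ # 3 *' X +' # 3 *'
          (X +' u) +' X *' X +' (X +' u) *' (X +' u)) refl X u)

    -- Equality holds at (X, u) = (0, 2) and at (1, 1), so 10 is the best constant for this
    -- quadratic.
    ten : ∀ X u → 2 ≤ X + u → 10 ≤ 6 * X + 3 * u + u * u
    ten zero u h = ℕP.+-mono-≤ (ℕP.*-monoʳ-≤ 3 h) (ℕP.*-mono-≤ h h)
    ten (suc zero) (suc u) h = ℕP.+-mono-≤ (ℕP.+-monoʳ-≤ 6 (ℕP.*-monoʳ-≤ 3 (s≤s {n = u} z≤n))) (ℕP.*-mono-≤
        (s≤s {n = u} z≤n) (s≤s {n = u} z≤n))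
    ten (suc zero) zero (s≤s ())
    ten (suc (suc X)) u h = ℕP.≤-trans (ℕP.≤-trans (ℕP.m≤m+n 10 2) (ℕP.*-monoʳ-≤ 6 (s≤s (s≤s (z≤n {X})))))
        (ℕP.≤-trans (ℕP.m≤m+n _ (3 * u)) (ℕP.m≤m+n _ (u * u)))

  -- The smaller of X and Y becomes W and their difference u. Phrasing the hypothesis through the
  -- maximum Z lets one estimate serve both orders.
  quadratic : ∀ X Y c → (∀ Z → X ≤ Z → Y ≤ Z → (Z ≡ X ⊎ Z ≡ Y) → ∀ W u → Z ≡ W + u → c ≤ 6 * W + 3 * u + u * u) →
    c + 2 * (X * Y) ≤ 3 * X + 3 * Y + X * X + Y * Y
  quadratic X Y c h with ℕP.≤-total X Y
  ... | inj₁ X≤Y = subst (λ Y → c + 2 * (X * Y) ≤ 3 * X + 3 * Y + X * X + Y * Y) e (quadratic≤ c X (Y ∸ X)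
      (h Y X≤Y ℕP.≤-refl (inj₂ refl) X (Y ∸ X) (sym e)))
    where e = ℕP.m+[n∸m]≡n X≤Y
  ... | inj₂ Y≤X = subst (λ X → c + 2 * (X * Y) ≤ 3 * X + 3 * Y + X * X + Y * Y) e
      (≤-by (cong (λ z → c + 2 * z) (ℕP.*-comm (Y + (X ∸ Y)) Y)) (quadratic≤ c Y (X ∸ Y) (h X ℕP.≤-refl Y≤X
          (inj₁ refl) Y (X ∸ Y) (sym e)))
        (solveℕ 2 (λ x y → # 3 *' y +' # 3 *' x +' y *' y +' x *' x ≔ # 3 *' x +' # 3 *' y +' x *' x +' y *' y) refl
            (Y + (X ∸ Y)) Y))
    where e = ℕP.m+[n∸m]≡n Y≤X

  quadratic-10 : ∀ X Y → 2 ≤ X ⊎ 2 ≤ Y → 10 + 2 * (X * Y) ≤ 3 * X + 3 * Y + X * X + Y * Y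
  quadratic-10 X Y h = quadratic X Y 10 (λ Z X≤Z Y≤Z _ W u e → ten W u (subst (2 ≤_) e (big Z X≤Z Y≤Z h)))
    where
    big : ∀ Z → X ≤ Z → Y ≤ Z → 2 ≤ X ⊎ 2 ≤ Y → 2 ≤ Z
    big Z X≤Z Y≤Z (inj₁ h) = ℕP.≤-trans h X≤Z
    big Z X≤Z Y≤Z (inj₂ h) = ℕP.≤-trans h Y≤Z

  quadratic-0 : ∀ X Y → 2 * (X * Y) ≤ 3 * X + 3 * Y + X * X + Y * Y
  quadratic-0 X Y = quadratic X Y 0 (λ _ _ _ _ _ _ _ → z≤n)

  2tri : ∀ s → 2 * tri (suc s) ≡ suc s * s
  2tri zero = refl
  2tri (suc s) = trans (ℕP.*-distribˡ-+ 2 (suc s) (tri (suc s))) (trans (cong (2 * suc s +_) (2tri s))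
    (solveℕ 1 (λ s → # 2 *' (# 1 +' s) +' (# 1 +' s) *' s ≔ (# 1 +' (# 1 +' s)) *' (# 1 +' s)) refl s))

  2tri≤ : ∀ s y → s ≤ y → 2 * tri s ≤ y * pred s
  2tri≤ zero y h = z≤n
  2tri≤ (suc s) y h = ≤-by (2tri s) (ℕP.*-monoˡ-≤ s h) refl

  2tri≤² : ∀ s → 2 * tri s ≤ s * s
  2tri≤² s = ℕP.≤-trans (2tri≤ s s ℕP.≤-refl) (ℕP.*-monoʳ-≤ s (ℕP.pred[n]≤n {s}))

  module _ {k m : ℕ} (M : Mat k m) (C₁ C₂ : List (V m)) (Cs : List (List (V m)))
    (hit : Any (λ C → 2 ≤ cnt M C) (C₁ ∷ C₂ ∷ Cs)) where

    private
      X = cnt M C₁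
      Y = cnt M C₂
      R = tot (pairs M) Cs

      rest : ∀ {Cs} → Any (λ C → 2 ≤ cnt M C) Cs → 1 ≤ tot (pairs M) Cs
      rest {C ∷ Cs} (here h) = ℕP.≤-trans (2≤⇒pairs (cnt M C) (pairs M C) (cnt² M C) h) (ℕP.m≤m+n _ _)
      rest {C ∷ Cs} (there i) = ℕP.≤-trans (rest i) (ℕP.m≤n+m _ _)

    -- If C₁ is not met twice, some other class contributes a pair. The largest class enters by its
    -- points alone, because its number of pairs could be too large.
    pointwise₁ : 2 ≤ cnt M C₁ + 2 * (pairs M C₂ + tot (pairs M) Cs)
    pointwise₁ = cases hit
      where
      cases : Any (λ C → 2 ≤ cnt M C) (C₁ ∷ C₂ ∷ Cs) → 2 ≤ X + 2 * (pairs M C₂ + R)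
      cases (here h) = ℕP.≤-trans h (ℕP.m≤m+n _ _)
      cases (there i) = ℕP.≤-trans (ℕP.*-monoʳ-≤ 2 (rest i)) (ℕP.m≤n+m _ X)

    -- If C₁ or C₂ is met twice, (X - Y)² + 3 (X + Y) ≥ 10; otherwise a pair in a smaller class pays
    -- the 10. The term - 2 X Y is what excludes two classes that both have about Q points.
    pointwise₂ : 10 + 2 * (cnt M C₁ * cnt M C₂) ≤ 4 * (cnt M C₁ + cnt M C₂) + 2 *
        (pairs M C₁ + pairs M C₂) + 10 * tot (pairs M) Cs
    pointwise₂ = subst (10 + 2 * (X * Y) ≤_) eq (goal hit)
      where
      eq : 3 * X + 3 * Y + (X + 2 * pairs M C₁) + (Y + 2 * pairs M C₂) + 10 * R ≡ 4 * (X + Y) + 2 *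
          (pairs M C₁ + pairs M C₂) + 10 * R
      eq = solveℕ 5 (λ X Y p r R → # 3 *' X +' # 3 *' Y +' (X +' # 2 *' p) +' (Y +' # 2 *' r) +' # 10 *' R ≔ # 4 *'
          (X +' Y) +' # 2 *' (p +' r) +' # 10 *' R) refl X Y (pairs M C₁) (pairs M C₂) R
      squares = cong₂ (λ a b → 3 * X + 3 * Y + a + b) (cnt² M C₁) (cnt² M C₂)
      goal : Any (λ C → 2 ≤ cnt M C) (C₁ ∷ C₂ ∷ Cs) → 10 + 2 * (X * Y) ≤ 3 * X + 3 * Y + (X + 2 * pairs M C₁) +
          (Y + 2 * pairs M C₂) + 10 * R
      goal (here h) = ℕP.≤-trans (≤-by refl (quadratic-10 X Y (inj₁ h)) squares) (ℕP.m≤m+n _ _)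
      goal (there (here h)) = ℕP.≤-trans (≤-by refl (quadratic-10 X Y (inj₂ h)) squares) (ℕP.m≤m+n _ _)
      goal (there (there i)) = ≤-by (ℕP.+-comm 10 _) (ℕP.+-mono-≤ (≤-by refl (quadratic-0 X Y) squares)
          (ℕP.*-monoʳ-≤ 10 (rest i))) refl

  module _ (k n : ℕ) .⦃ _ : NonZero q ⦄ (C₁ C₂ : List (V (suc (suc n)))) (Cs : List (List (V (suc (suc n)))))
    (indep : All (AllPairs Indep2) (C₁ ∷ C₂ ∷ Cs)) (nonzero₁ : All (_≢ 0v) C₁) (nonzero₂ : All (_≢ 0v) C₂)
    (cross : All (λ u → All (Indep2 u) C₂) C₁)
    (hit : ∀ (M : Mat k (suc (suc n))) → Any (λ C → 2 ≤ cnt M C) (C₁ ∷ C₂ ∷ Cs)) where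

    private
      Q w s y T : ℕ
      Q = q ^ k
      w = (q ^ n) ^ k
      s = length C₁
      y = length C₂
      T = tot (λ C → tri (length C)) Cs
      Ms = mats k (suc (suc n))

      instance
        w≢0 : NonZero w
        w≢0 = ℕP.m^n≢0 (q ^ n) k ⦃ ℕP.m^n≢0 q n ⦄

      Qw : (q ^ suc n) ^ k ≡ Q * w
      Qw = ^-distribʳ-* k q (q ^ n)

      QQw : (q ^ suc (suc n)) ^ k ≡ Q * (Q * w)
      QQw = trans (^-distribʳ-* k q (q ^ suc n)) (cong (Q *_) Qw)

      sum-tot-pairs : ∀ Cs → All (AllPairs Indep2) Cs → tot (λ M → tot (pairs M) Cs) Ms ≡ tot (λ C → tri
          (length C)) Cs * w
      sum-tot-pairs [] [] = trans (tot-const 0 Ms) (ℕP.*-zeroʳ (length Ms))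
      sum-tot-pairs (C ∷ Cs) (h ∷ hs) = trans (tot-+ (λ M → pairs M C) (λ M → tot (pairs M) Cs) Ms)
        (trans (cong₂ _+_ (sum-pairs k n C h) (sum-tot-pairs Cs hs)) (sym (ℕP.*-distribʳ-+ w (tri (length C)) _)))

      scaled : ∀ c → tot (λ M → c) Ms ≡ c * Q * Q * w
      scaled c = trans (tot-cong Ms (λ _ → sym (ℕP.*-identityʳ c))) (trans (tot-* c (λ _ → 1) Ms)
        (trans (cong (c *_) (trans (sum-1 k (suc (suc n))) QQw)) (solveℕ 3 (λ c Q w → c *' (Q *'
            (Q *' w)) ≔ c *' Q *' Q *' w) refl c Q w)))

      pairs₁ = sum-pairs k n C₁ (Data.List.Relation.Unary.All.head indep)
      pairs₂ = sum-pairs k n C₂ (Data.List.Relation.Unary.All.head (Data.List.Relation.Unary.All.tail indep))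
      pairsR = sum-tot-pairs Cs (Data.List.Relation.Unary.All.tail (Data.List.Relation.Unary.All.tail indep))

      cnt₁ = trans (sum-cnt k (suc n) C₁ nonzero₁) (cong (s *_) Qw)
      cnt₂ = trans (sum-cnt k (suc n) C₂ nonzero₂) (cong (y *_) Qw)

    -- The sum of `pointwise₁` over the Q² w matrices, divided by w: a point contributes Q, and an
    -- independent pair contributes 1.
    average₁ : 2 * Q * Q ≤ s * Q + 2 * (tri y + T)
    average₁ = ℕP.*-cancelʳ-≤ _ _ w (≤-by (sym (scaled 2)) (tot-mono Ms (λ M → pointwise₁ M C₁ C₂ Cs (hit M)))
      (trans (tot-+ (λ M → cnt M C₁) (λ M → 2 * (pairs M C₂ + tot (pairs M) Cs)) Ms)
      (trans (cong₂ _+_ cnt₁ (trans (tot-* 2 (λ M → pairs M C₂ + tot (pairs M) Cs) Ms) (cong (2 *_) (trans (tot-+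
          (λ M → pairs M C₂) (λ M → tot (pairs M) Cs) Ms) (cong₂ _+_ pairs₂ pairsR)))))
      (solveℕ 5 (λ s Q w a T → s *' (Q *' w) +' # 2 *' (a *' w +' T *' w) ≔ (s *' Q +' # 2 *'
          (a +' T)) *' w) refl s Q w (tri y) T))))

    average₂ : 10 * Q * Q + 2 * (s * y) ≤ 4 * (s + y) * Q + 2 * (tri s + tri y) + 10 * T
    average₂ = ℕP.*-cancelʳ-≤ _ _ w (≤-by
      (trans (solveℕ 4 (λ Q s y w → (# 10 *' Q *' Q +' # 2 *' (s *' y)) *' w ≔ # 10 *' Q *' Q *' w +' # 2 *' (s *'
          (y *' w))) refl Q s y w)
        (sym (trans (tot-+ (λ M → 10) (λ M → 2 * (cnt M C₁ * cnt M C₂)) Ms) (cong₂ _+_ (scaled 10)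
          (trans (tot-* 2 (λ M → cnt M C₁ * cnt M C₂) Ms) (cong (2 *_) (sum-cntcnt k n C₁ C₂ cross)))))))
      (tot-mono Ms (λ M → pointwise₂ M C₁ C₂ Cs (hit M)))
      (trans (tot-+ (λ M → 4 * (cnt M C₁ + cnt M C₂) + 2 * (pairs M C₁ + pairs M C₂)) (λ M → 10 * tot
          (pairs M) Cs) Ms)
      (trans (cong₂ _+_ (trans (tot-+ (λ M → 4 * (cnt M C₁ + cnt M C₂)) (λ M → 2 * (pairs M C₁ + pairs M C₂)) Ms)
          (cong₂ _+_
          (trans (tot-* 4 (λ M → cnt M C₁ + cnt M C₂) Ms) (cong (4 *_) (trans (tot-+ (λ M → cnt M C₁)
              (λ M → cnt M C₂) Ms) (cong₂ _+_ cnt₁ cnt₂))))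
          (trans (tot-* 2 (λ M → pairs M C₁ + pairs M C₂) Ms) (cong (2 *_) (trans (tot-+ (λ M → pairs M C₁)
              (λ M → pairs M C₂) Ms) (cong₂ _+_ pairs₁ pairs₂))))))
        (trans (tot-* 10 (λ M → tot (pairs M) Cs) Ms) (cong (10 *_) pairsR)))
      (solveℕ 7 (λ s y Q w a b T → # 4 *' (s *' (Q *' w) +' y *' (Q *' w)) +' # 2 *' (a *' w +' b *' w) +' # 10 *'
          (T *' w)
        ≔ (# 4 *' (s +' y) *' Q +' # 2 *' (a +' b) +' # 10 *' T) *' w) refl s y Q w (tri s) (tri y) T))))

-- A dominant class meets every kernel twice

module Core {q : ℕ} (K : FinField q) where
  open import Data.Nat using (suc; pred; _≤_; _<_; s≤s; z≤n; _+_; _*_; _^_; _≤?_; NonZero; >-nonZero)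
  import Data.Nat.Properties as ℕP
  open import Data.Product using (∃₂; _×_; _,_; proj₁)
  open import Data.Sum using (_⊎_; inj₁; inj₂)
  open import Data.List using (List; []; _∷_; length; concat; filter; _++_)
  open import Data.List.Properties using (length-++)
  open import Data.List.Membership.Propositional using (_∈_; _∉_)
  open import Data.List.Relation.Unary.Any using (Any; here; there)
  open import Data.List.Relation.Unary.All using (All; []; _∷_)
  import Data.List.Relation.Unary.All as All
  import Data.List.Relation.Unary.All.Properties as AllP
  open import Data.List.Relation.Unary.AllPairs using (AllPairs; []; _∷_)
  import Data.List.Relation.Unary.AllPairs as AllPairs
  import Data.List.Relation.Unary.AllPairs.Properties as APP
  open import Data.List.Relation.Binary.Permutation.Propositional using (_↭_; prep; swap; ↭-refl; ↭-sym; ↭-trans)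
  import Data.List.Relation.Binary.Permutation.Propositional as Perm
  open import Data.List.Relation.Binary.Permutation.Propositional.Properties using (All-resp-↭; Any-resp-↭)
  open import Data.List.Relation.Binary.Permutation.Propositional using (↭⇒↭ₛ)
  import Data.List.Relation.Binary.Permutation.Setoid.Properties as SetoidPerm
  open import Data.Nat.Solver using (module +-*-Solver)
  import Data.Vec
  open import Data.Empty using (⊥-elim)
  open import Relation.Nullary using (yes; no; Dec)
  open import Relation.Binary.PropositionalEquality
  open FinField K
  open Field K using (x⊖x; +-identityʳ)
  open Counting K
  open Linear K
  open Cover K
  open Descent K
  open Averages K
  open Arith
  open +-*-Solver using () renaming (solve to solveℕ; _:+_ to _+'_; _:*_ to _*'_; _:=_ to _≔_; con to #)

  module _ {A : Set} where
    AllPairs-resp-↭ : ∀ {R : A → A → Set} →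
        (∀ {x y} → R x y → R y x) → ∀ {l l′} → l ↭ l′ → AllPairs R l → AllPairs R l′
    AllPairs-resp-↭ {R} s p = SetoidPerm.AllPairs-resp-↭ (setoid A) s (resp₂ R) (↭⇒↭ₛ p)

    AllPairs-lookup : ∀ {R : A → A → Set} →
        (∀ {x y} → R x y → R y x) → ∀ {l} → AllPairs R l → ∀ {x y} → x ∈ l → y ∈ l → x ≢ y → R x y
    AllPairs-lookup s (h ∷ hs) (here refl) (here refl) n = ⊥-elim (n refl)
    AllPairs-lookup s (h ∷ hs) (here refl) (there j) n = All.lookup h j
    AllPairs-lookup s (h ∷ hs) (there i) (here refl) n = s (All.lookup h i)
    AllPairs-lookup s (h ∷ hs) (there i) (there j) n = AllPairs-lookup s hs i j n

    tot-↭ : ∀ (f : A → ℕ) {l l′} → l ↭ l′ → tot f l ≡ tot f l′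
    tot-↭ f Perm.refl = refl
    tot-↭ f (prep x p) = cong (f x +_) (tot-↭ f p)
    tot-↭ f (swap {xs = xs} {ys} x y p) = trans (sym (ℕP.+-assoc (f x) (f y) _)) (trans (cong₂ _+_ (ℕP.+-comm (f x)
        (f y)) (tot-↭ f p)) (ℕP.+-assoc (f y) (f x) _))
    tot-↭ f (Perm.trans p p′) = trans (tot-↭ f p) (tot-↭ f p′)

    -- Applied twice, it isolates the two largest classes; the order of the others is immaterial.
    longest-first : ∀ (C : List A) Cs → ∃₂ λ C₁ Cs′ → C ∷ Cs ↭ C₁ ∷ Cs′ × All (λ C → length C ≤ length C₁) Cs′
    longest-first C [] = C , [] , ↭-refl , []
    longest-first C (C′ ∷ Cs) with longest-first C′ Cs
    ... | C₁ , Cs′ , p , h with ℕP.≤-total (length C) (length C₁)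
    ...   | inj₁ le = C₁ , C ∷ Cs′ , ↭-trans (prep C p) (swap C C₁ ↭-refl) , le ∷ h
    ...   | inj₂ ge = C , C₁ ∷ Cs′ , prep C p , ge ∷ All.map (λ le → ℕP.≤-trans le ge) h

  Cross : ∀ {m} → List (V m) → List (V m) → Set
  Cross C C′ = All (λ u → All (Indep2 u) C′) C

  Cross-sym : ∀ {m} {C C′ : List (V m)} → Cross C C′ → Cross C′ C
  Cross-sym h = All.map (All.map Indep2-sym) (AllP.All-swap h)

  Indep2-irrefl : ∀ {m} {u v : V m} → Indep2 u v → u ≢ v
  Indep2-irrefl {u = u} i refl = 1≢0 (proj₁ (i 1k (⊖ 1k) (add-multiple u 1k (⊖ 1k) (x⊖x 1k))))

  abstract
    long? : ∀ {m} (C : List (V m)) → Dec (2 ≤ length C)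
    long? C = 2 ≤? length C

  -- A class with one point is never met twice, so it can be left out of D, whose length is then
  -- bounded by twice the excess.
  nontrivial : ∀ {m} → List (List (V m)) → List (List (V m))
  nontrivial = filter long?

  cnt≤length : ∀ {k m} (M : Mat k m) L → cnt M L ≤ length L
  cnt≤length M L = ≤-by refl (tot-mono L (χ≤1 M)) (length≡tot L)

  cnt-nontrivial : ∀ {k m} (M : Mat k m) Cs → Any (λ C → 2 ≤ cnt M C) Cs → 2 ≤ cnt M (concat (nontrivial Cs))
  cnt-nontrivial M (C ∷ Cs) i with long? C
  cnt-nontrivial M (C ∷ Cs) (here h) | yes _ = ℕP.≤-trans h (ℕP.≤-trans (ℕP.m≤m+n _ _) (ℕP.≤-reflexive (sym
      (cnt-++ M C _))))
  cnt-nontrivial M (C ∷ Cs) (there i) | yes _ = ℕP.≤-trans (cnt-nontrivial M Cs i) (ℕP.≤-trans (ℕP.m≤n+m _ (cnt M C))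
      (ℕP.≤-reflexive (sym (cnt-++ M C _))))
  cnt-nontrivial M (C ∷ Cs) (here h) | no n = ⊥-elim (n (ℕP.≤-trans h (cnt≤length M C)))
  cnt-nontrivial M (C ∷ Cs) (there i) | no n = cnt-nontrivial M Cs i

  length-nontrivial : ∀ {m} (Cs : List (List (V m))) → length (concat (nontrivial Cs)) ≤ 2 * tot (λ C → pred
      (length C)) Cs
  length-nontrivial [] = z≤n
  length-nontrivial (C ∷ Cs) with long? C
  ... | no n = ℕP.≤-trans (length-nontrivial Cs) (ℕP.*-monoʳ-≤ 2 (ℕP.m≤n+m _ (pred (length C))))
  ... | yes h = ≤-by (length-++ C) (ℕP.+-mono-≤ (double h) (length-nontrivial Cs)) (sym (ℕP.*-distribˡ-+ 2 (pred
      (length C)) _))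
    where
    double : ∀ {n} → 2 ≤ n → n ≤ 2 * pred n
    double (s≤s {n = n} h) = ≤-by (ℕP.+-comm 1 n) (ℕP.+-monoʳ-≤ n h) (cong (n +_) (sym (ℕP.+-identityʳ n)))

  module _ {k n : ℕ} (q≥3 : 3 ≤ q) (Q≥239 : 239 ≤ q ^ k) where
    private
      Q = q ^ k
      m = suc (suc n)
      instance
        q≢0 : NonZero q
        q≢0 = >-nonZero (ℕP.≤-trans (s≤s z≤n) q≥3)

      excess : List (List (V m)) → ℕ
      excess = tot (λ C → pred (length C))

      -- A class of c ≤ y points has c (c - 1) ≤ y (c - 1) ordered pairs, so the pairs of all
      -- classes after the second are controlled by y times their excess t. This linearises the
      -- averages into the form that `excess-small` expects.
      excess-bound : ∀ C₁ C₂ Cs → All (λ C → 1 ≤ length C) (C₁ ∷ C₂ ∷ Cs) →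
        All (All (_≢ 0v)) (C₁ ∷ C₂ ∷ Cs) → All (AllPairs Indep2) (C₁ ∷ C₂ ∷ Cs) → AllPairs Cross (C₁ ∷ C₂ ∷ Cs) →
        (∀ (M : Mat k m) → Any (λ C → 2 ≤ cnt M C) (C₁ ∷ C₂ ∷ Cs)) →
        length C₂ ≤ length C₁ → All (λ C → length C ≤ length C₂) Cs →
        50 * (length C₁ + excess (C₂ ∷ Cs)) ≤ 101 * Q → 10 * excess (C₂ ∷ Cs) ≤ 3 * Q
      excess-bound C₁ [] Cs (_ ∷ () ∷ _)
      excess-bound C₁ C₂@(x ∷ C₂′) Cs _ (nz₁ ∷ nz₂ ∷ _) ind ((c₁₂ ∷ _) ∷ _) hit le les third =
        excess-small Q s y′ t Q≥239 le
          (ℕP.≤-trans (average₁ k n C₁ C₂ Cs ind nz₁ nz₂ c₁₂ hit) (ℕP.+-monoʳ-≤ (s * Q)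
            (≤-by (ℕP.*-distribˡ-+ 2 (tri y) T) (ℕP.+-mono-≤ (ℕP.≤-reflexive (2tri y′)) T≤) (sym
                (ℕP.*-distribˡ-+ y y′ t)))))
          (ℕP.≤-trans (average₂ k n C₁ C₂ Cs ind nz₁ nz₂ c₁₂ hit) (ℕP.+-mono-≤
            (ℕP.+-monoʳ-≤ (4 * (s + y) * Q) (≤-by (ℕP.*-distribˡ-+ 2 (tri s) (tri y)) (ℕP.+-mono-≤ (2tri≤² s)
                (2tri≤² y)) refl))
            (≤-by (ℕP.*-assoc 5 2 T) (ℕP.*-monoʳ-≤ 5 T≤) refl)))
          third
        where
        s = length C₁
        y′ = length C₂′
        y = suc y′
        t = excess Cs
        T = tot (λ C → tri (length C)) Cs
        T≤ : 2 * T ≤ y * t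
        T≤ = go Cs les
          where
          go : ∀ Cs → All (λ C → length C ≤ y) Cs → 2 * tot (λ C → tri (length C)) Cs ≤ y * excess Cs
          go [] [] = z≤n
          go (C ∷ Cs) (h ∷ hs) = ≤-by (ℕP.*-distribˡ-+ 2 (tri (length C)) _) (ℕP.+-mono-≤ (2tri≤ (length C) y h)
              (go Cs hs)) (sym (ℕP.*-distribˡ-+ y (pred (length C)) _))

      largest-blocks : ∀ C₁ Cs → All (AllPairs Indep2) (C₁ ∷ Cs) → AllPairs Cross (C₁ ∷ Cs) →
        (∀ (M : Mat k m) → Any (λ C → 2 ≤ cnt M C) (C₁ ∷ Cs)) →
        50 * (length C₁ + excess Cs) ≤ 101 * Q → 10 * excess Cs ≤ 3 * Q → TwoBlocks k C₁
      largest-blocks C₁ Cs (ind₁ ∷ ind) (cross₁ ∷ cross) hit bound small = C-blocks q≥3 C₁ D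
          (AllPairs-lookup Indep2-sym all) (AllPairs.map Indep2-irrefl indD) C⊎D lengths disjoint
        where
        D = concat (nontrivial Cs)
        s = length C₁
        ρ = excess Cs
        indD : AllPairs Indep2 D
        indD = APP.concat⁺ (AllP.filter⁺ long? ind) (APP.filter⁺ long? cross)
        crossD : Cross C₁ D
        crossD = All.map AllP.concat⁺ (AllP.All-swap (AllP.filter⁺ long? cross₁))
        all : AllPairs Indep2 (C₁ ++ D)
        all = APP.++⁺ ind₁ indD crossD
        C⊎D : ∀ (M : Mat k m) → 2 ≤ cnt M C₁ ⊎ 2 ≤ cnt M D
        C⊎D M with hit M
        ... | here h = inj₁ h
        ... | there i = inj₂ (cnt-nontrivial M Cs i)
        disjoint : ∀ {v} → v ∈ C₁ → v ∉ D
        disjoint i j = Indep2-irrefl (All.lookup (All.lookup crossD i) j) refl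
        -- Here 50 (s + 4 ρ + 1) = 50 (s + ρ) + 15 · 10 ρ + 50 ≤ 101 Q + 45 Q + 50, and 50 < 4 Q.
        lengths : s + 2 * length D + 1 < 3 * Q
        lengths = ℕP.≤-<-trans (ℕP.+-monoˡ-≤ 1 (ℕP.+-monoʳ-≤ s (ℕP.*-monoʳ-≤ 2 (length-nontrivial Cs))))
            (ℕP.*-cancelˡ-< 50 _ _
          (ℕP.≤-<-trans (≤-by (solveℕ 2 (λ s r → # 50 *' (s +' # 2 *' (# 2 *' r) +' # 1) ≔ # 50 *'
              (s +' r) +' # 15 *' (# 10 *' r) +' # 50) refl s ρ)
              (ℕP.+-monoˡ-≤ 50 (ℕP.+-mono-≤ bound (ℕP.*-monoʳ-≤ 15 small))) refl)
            (ℕP.<-≤-trans (ℕP.+-monoʳ-< (101 * Q + 15 * (3 * Q)) (ℕP.≤-trans (ℕP.m≤m+n 51 905)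
                (ℕP.*-monoʳ-≤ 4 Q≥239)))
              (ℕP.≤-reflexive (solveℕ 1 (λ Q → # 101 *' Q +' # 15 *' (# 3 *' Q) +' # 4 *' Q ≔ # 50 *'
                  (# 3 *' Q)) refl Q)))))

    some-class-blocks : ∀ (Cs : List (List (V m))) → All (λ C → 1 ≤ length C) Cs →
      All (All (_≢ 0v)) Cs → All (AllPairs Indep2) Cs → AllPairs Cross Cs →
      (∀ (M : Mat k m) → Any (λ C → 2 ≤ cnt M C) Cs) →
      50 * (1 + tot (λ C → pred (length C)) Cs) ≤ 101 * Q → Any (TwoBlocks k) Cs
    some-class-blocks [] _ _ _ _ hit _ with hit (Data.Vec.replicate k 0v)
    ... | ()
    some-class-blocks (C ∷ Cs) len nz ind cross hit bound with longest-first C Cs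
    ... | [] , Cs′ , p , les with () ← All.head (All-resp-↭ p len)
    some-class-blocks (C ∷ Cs) len nz ind cross hit bound | C₁@(x ∷ C₁′) , [] , p , les = Any-resp-↭ (↭-sym p) (here
        (λ M → single (Any-resp-↭ p (hit M))))
      where
      single : ∀ {P : List (V m) → Set} → Any P (C₁ ∷ []) → P C₁
      single (here h) = h
    some-class-blocks (C ∷ Cs) len nz ind cross hit bound | C₁@(x ∷ C₁′) , C′ ∷ Cs′ , p , les with longest-first C′
        Cs′
    ... | C₂ , Cs″ , p′ , les′ = Any-resp-↭ (↭-sym p″) (here (largest-blocks C₁ (C₂ ∷ Cs″)
        (All-resp-↭ p″ ind) cross″ hit″ bound″
          (excess-bound C₁ C₂ Cs″ (All-resp-↭ p″ len) (All-resp-↭ p″ nz) (All-resp-↭ p″ ind) cross″ hit″ (All.head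
              (All-resp-↭ p′ les)) les′ bound″)))
      where
      p″ : C ∷ Cs ↭ C₁ ∷ C₂ ∷ Cs″
      p″ = ↭-trans p (prep C₁ p′)
      cross″ = AllPairs-resp-↭ Cross-sym p″ cross
      hit″ = λ M → Any-resp-↭ p″ (hit M)
      -- `C₁` is nonempty, so the 1 of the hypothesis restores the point that `pred` takes from it.
      bound″ : 50 * (length C₁ + excess (C₂ ∷ Cs″)) ≤ 101 * Q
      bound″ = subst (λ z → 50 * suc z ≤ 101 * Q) (tot-↭ (λ C → pred (length C)) p″) bound

-- Representatives of the points and their colour classes

module Reps {q : ℕ} (K : FinField q) where
  open import Defs using (θ)
  open import Data.Nat using (zero; suc; pred; _≤_; s≤s; _+_; _^_)
  import Data.Nat.Properties as ℕP
  open import Data.Fin using (Fin; _≟_)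
  open import Data.Product using (∃₂; _×_; _,_; proj₁; proj₂)
  open import Data.Vec using ([]; _∷_)
  import Data.Vec.Properties as VecP
  open import Data.List using (List; []; _∷_; length; filter; map; _++_; allFin)
  open import Data.List.Properties using (length-++; length-map; length-tabulate)
  open import Data.List.Membership.Propositional using (_∈_)
  open import Data.List.Membership.Propositional.Properties using (∈-++⁺ˡ; ∈-++⁺ʳ; ∈-map⁺; ∈-filter⁻; ∈-allFin)
  open import Data.List.Relation.Unary.Any using (here; there)
  open import Data.List.Relation.Unary.All using (All; []; _∷_)
  import Data.List.Relation.Unary.All as All
  import Data.List.Relation.Unary.All.Properties as AllP
  open import Data.List.Relation.Unary.AllPairs using (AllPairs; []; _∷_)
  import Data.List.Relation.Unary.AllPairs as AllPairs
  import Data.List.Relation.Unary.AllPairs.Properties as APP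
  import Data.List.Relation.Unary.Unique.Propositional.Properties as UP
  open import Data.Empty using (⊥-elim)
  open import Relation.Nullary using (yes; no)
  open import Relation.Binary.PropositionalEquality
  open FinField K
  open Field K
  open Counting K
  open Linear K
  open Cover K
  open Core K

  -- One vector for each point of PG(n, q): the one whose first nonzero coordinate is 1.
  reps : ∀ n → List (V (suc n))
  reps zero = (1k ∷ []) ∷ []
  reps (suc n) = map (1k ∷_) (forms (suc n)) ++ map (0k ∷_) (reps n)

  length-reps : ∀ n → length (reps n) ≡ θ q n
  length-reps zero = refl
  length-reps (suc n) = trans (length-++ (map (1k ∷_) (forms (suc n)))) (trans (cong₂ _+_
    (trans (length-map (1k ∷_) (forms (suc n))) (trans (sym (length≡tot (forms (suc n)))) (count-forms (suc n))))
    (trans (length-map (0k ∷_) (reps n)) (length-reps n))) (ℕP.+-comm (q ^ suc n) _))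

  reps-nonzero : ∀ n → All (_≢ 0v) (reps n)
  reps-nonzero zero = (λ e → 1≢0 (VecP.∷-injectiveˡ e)) ∷ []
  reps-nonzero (suc n) = AllP.++⁺ (AllP.map⁺ (All.tabulate (λ _ e → 1≢0 (VecP.∷-injectiveˡ e))))
    (AllP.map⁺ (All.map (λ n e → n (VecP.∷-injectiveʳ e)) (reps-nonzero n)))

  private
    both : ∀ {m} (u v : V m) → u ≢ v → Indep2 (1k ∷ u) (1k ∷ v)
    both u v u≢v s t e = s≡0 , trans (sym (+-identityˡ t)) (trans (⊕-congʳ (sym s≡0)) s+t)
      where
      s+t : s ⊕ t ≡ 0k
      s+t = trans (sym (cong₂ _⊕_ (*-identityʳ s) (*-identityʳ t))) (VecP.∷-injectiveˡ e)
      equal : s ≢ 0k → ∀ {m} (u v : V m) → s *v u +v t *v v ≡ 0v → u ≡ v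
      equal s≢0 [] [] e = refl
      equal s≢0 (x ∷ u) (y ∷ v) e = cong₂ _∷_ (x⊖y≡0⇒x≡y (⊗-cancel s≢0 (trans
        (solve 4 (λ s t x y → s :* (x :- y) := (s :* x :+ t :* y) :- (s :+ t) :* y) refl s t x y)
        (trans (cong₂ (λ a b → a ⊕ ⊖ (b ⊗ y)) (VecP.∷-injectiveˡ e) s+t) (trans (cong (λ z → 0k ⊕ ⊖ z) (zeroˡ y))
            (x⊖x 0k))))))
        (equal s≢0 u v (VecP.∷-injectiveʳ e))
      s≡0 : s ≡ 0k
      s≡0 with s ≟ 0k
      ... | yes z = z
      ... | no n = ⊥-elim (u≢v (equal n u v (VecP.∷-injectiveʳ e)))

    mixed : ∀ {m} (u v : V m) → v ≢ 0v → Indep2 (1k ∷ u) (0k ∷ v)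
    mixed u v v≢0 s t e = s≡0 , cancel-tail t 0k v≢0 (trans (sym (+v-identityˡ _))
        (trans (cong (_+v t *v v) (sym (trans (cong (_*v u) s≡0) (0*v u)))) (trans (VecP.∷-injectiveʳ e) (sym
            (0*v v)))))
      where
      s≡0 : s ≡ 0k
      s≡0 = trans (sym (trans (cong₂ _⊕_ (*-identityʳ s) (zeroʳ t)) (+-identityʳ s))) (VecP.∷-injectiveˡ e)

  reps-indep : ∀ n → AllPairs Indep2 (reps n)
  reps-indep zero = [] ∷ []
  reps-indep (suc n) = APP.++⁺
    (APP.map⁺ (AllPairs.map (λ {u} {v} → both u v) (forms-unique (suc n))))
    (APP.map⁺ (AllPairs.map (λ i s t e → i s t (VecP.∷-injectiveʳ e)) (reps-indep n)))
    (AllP.map⁺ (All.tabulate (λ {u} _ → AllP.map⁺ (All.map (λ {v} → mixed u v) (reps-nonzero n)))))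

  normalise : ∀ n (v : V (suc n)) → v ≢ 0v → ∃₂ λ r c → r ∈ reps n × c ≢ 0k × r ≡ c *v v
  normalise n (p ∷ v) v≢0 with p ≟ 0k
  ... | no p≢0 with inverse p p≢0
  ...   | u , pu = 1k ∷ u *v v , u , member n v , (λ z → 1≢0 (trans (sym pu) (trans (cong (p ⊗_) z)
      (zeroʳ p)))) , cong (_∷ u *v v) (trans (sym pu) (*-comm p u))
    where
    member : ∀ n (v : V n) → 1k ∷ u *v v ∈ reps n
    member zero [] = here refl
    member (suc n) v = ∈-++⁺ˡ (∈-map⁺ (1k ∷_) (∈-forms (u *v v)))
  normalise zero (p ∷ []) v≢0 | yes p≡0 = ⊥-elim (v≢0 (cong (_∷ []) p≡0))
  normalise (suc n) (p ∷ v) v≢0 | yes p≡0 with normalise n v (λ e → v≢0 (cong₂ _∷_ p≡0 e))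
  ... | r , c , i , c≢0 , e = 0k ∷ r , c , ∈-++⁺ʳ (map (1k ∷_) (forms (suc n))) (∈-map⁺ (0k ∷_) i) , c≢0 , cong₂ _∷_
      (sym (trans (cong (c ⊗_) p≡0) (zeroʳ c))) e

  two-members : ∀ {k m} (M : Mat k m) {L u v} → u ∈ L → v ∈ L → u ≢ v → mv M u ≡ 0v → mv M v ≡ 0v → 2 ≤ cnt M L
  two-members M (here refl) (here refl) n _ _ = ⊥-elim (n refl)
  two-members M (here refl) (there j) n eu ev = ℕP.+-mono-≤ (ℕP.≤-reflexive (sym (χ-yes M _ eu))) (ℕP.≤-trans
      (ℕP.≤-reflexive (sym (χ-yes M _ ev))) (≤tot (χ M) j))
  two-members M (there i) (here refl) n eu ev = ℕP.+-mono-≤ (ℕP.≤-reflexive (sym (χ-yes M _ ev))) (ℕP.≤-trans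
      (ℕP.≤-reflexive (sym (χ-yes M _ eu))) (≤tot (χ M) i))
  two-members M (there i) (there j) n eu ev = ℕP.≤-trans (two-members M i j n eu ev) (ℕP.m≤n+m _ _)

  module _ {n N : ℕ} (colour : V (suc n) → Fin N) where
    class : Fin N → List (V (suc n))
    class c = filter (λ r → colour r ≟ c) (reps n)

    classes : List (List (V (suc n)))
    classes = map class (allFin N)

    ∈-class : ∀ {c v} → v ∈ class c → v ∈ reps n × colour v ≡ c
    ∈-class {c} = ∈-filter⁻ (λ r → colour r ≟ c)

    classes-nonzero : All (All (_≢ 0v)) classes
    classes-nonzero = AllP.map⁺ (All.tabulate (λ {c} _ → AllP.filter⁺ (λ r → colour r ≟ c) (reps-nonzero n)))

    classes-indep : All (AllPairs Indep2) classes
    classes-indep = AllP.map⁺ (All.tabulate (λ {c} _ → APP.filter⁺ (λ r → colour r ≟ c) (reps-indep n)))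

    classes-cross : AllPairs Cross classes
    classes-cross = APP.map⁺ (AllPairs.map (λ c≢d → All.tabulate λ i → All.tabulate λ j → AllPairs-lookup Indep2-sym
        (reps-indep n)
        (proj₁ (∈-class i)) (proj₁ (∈-class j)) (λ u≡v → c≢d (trans (sym (proj₂ (∈-class i))) (trans
            (cong colour u≡v) (proj₂ (∈-class j))))))
      (UP.allFin⁺ N))

    private
      same : Fin N → Fin N → ℕ
      same d c with d ≟ c
      ... | yes _ = 1
      ... | no _ = 0

      same-yes : ∀ c → same c c ≡ 1
      same-yes c with c ≟ c
      ... | yes _ = refl
      ... | no n = ⊥-elim (n refl)

      same-no : ∀ {c d} → c ≢ d → same c d ≡ 0
      same-no {c} {d} n with c ≟ d
      ... | yes e = ⊥-elim (n e)
      ... | no _ = refl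

      length-filter : ∀ c l → length (filter (λ r → colour r ≟ c) l) ≡ tot (λ r → same (colour r) c) l
      length-filter c [] = refl
      length-filter c (r ∷ l) with colour r ≟ c
      ... | yes _ = cong suc (length-filter c l)
      ... | no _ = length-filter c l

    total-length : tot length classes ≡ θ q n
    total-length = trans (tot-map length class (allFin N)) (trans (tot-cong (allFin N) (λ c → length-filter c
        (reps n)))
      (trans (tot-swap (λ c r → same (colour r) c) (allFin N) (reps n))
      (trans (tot-cong (reps n) (λ r → trans (tot-single (UP.allFin⁺ N) (∈-allFin (colour r)) (λ c ne → same-no
          (λ e → ne (sym e)))) (same-yes (colour r))))
      (trans (length≡tot (reps n)) (length-reps n)))))

    -- Each of the N inhabited classes gives up one point. This identifies the excess with θ_n - N
    -- without a subtraction.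
    total-excess : All (λ C → 1 ≤ length C) classes → tot (λ C → pred (length C)) classes + N ≡ θ q n
    total-excess h = trans (cong (tot (λ C → pred (length C)) classes +_) (sym (trans (length-map class (allFin N))
        (length-tabulate {n = N} (λ x → x)))))
      (trans (go classes h) total-length)
      where
      go : ∀ (Cs : List (List (V (suc n)))) → All (λ C → 1 ≤ length C) Cs → tot (λ C → pred
          (length C)) Cs + length Cs ≡ tot length Cs
      go [] [] = refl
      go (C ∷ Cs) (h ∷ hs) = trans (shuffle (pred (length C)) _ (length Cs)) (cong₂ _+_ (suc-pred h) (go Cs hs))
        where
        suc-pred : ∀ {n} → 1 ≤ n → suc (pred n) ≡ n
        suc-pred (s≤s _) = refl
        shuffle : ∀ a b c → a + b + suc c ≡ suc a + (b + c)
        shuffle a b c = trans (ℕP.+-suc (a + b) c) (cong suc (ℕP.+-assoc a b c))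

-- Translation between the geometry and coordinate vectors

module Geo {q : ℕ} (F : FiniteField q) (K : FinField q) (coordinates : Coordinates F K) where
  open import Defs using (module Geometry; θ)
  open FiniteField F using (Carrier; _≈_; _+_; _*_; 0#)
  open FinField K using (_⊗_; 0k)
  open Coordinates coordinates
  open import Data.Nat using (zero; suc; pred; _≤_; _^_; _∸_; s≤s; z≤n) renaming (_+_ to _+ℕ_; _*_ to _*ℕ_)
  import Data.Nat.Properties as ℕP
  open import Data.Fin using (_≟_; zero; suc)
  open import Data.Product using (∃; _,_; proj₁; proj₂)
  open import Data.Vec using ([]; _∷_; tabulate; lookup)
  import Data.Vec as Vec
  import Data.Vec.Properties as VecP
  open import Data.List using (length)
  open import Data.List.Membership.Propositional using (_∈_; lose)
  open import Data.List.Membership.Propositional.Properties using (∈-filter⁺; ∈-allFin)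
  open import Data.List.Relation.Unary.Any using (Any; here; there; satisfied)
  import Data.List.Relation.Unary.Any.Properties as AnyP
  open import Data.List.Relation.Unary.All using (All)
  import Data.List.Relation.Unary.All as All
  import Data.List.Relation.Unary.All.Properties as AllP
  import Data.List.Relation.Unary.AllPairs as AllPairs
  import Data.List.Relation.Unary.AllPairs.Properties as APP
  open import Data.List.Relation.Unary.Unique.Propositional using (Unique)
  open import Data.List using (_∷_)
  open import Data.Empty using (⊥-elim)
  open import Function using (_∘_)
  open import Relation.Nullary using (¬_; yes; no)
  open FinField K using (1k; ⊖_; 1≢0) renaming (inverse to inverseK)
  module 𝕂 = Field K
  open Counting K
  open Linear K
  open Cover K using (add-multiple)
  open Descent K
  open Core K
  open Reps K
  open Geometry F
  open FiniteField F using () renaming (sym to ≈-sym; trans to ≈-trans)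

  ι-inj : ∀ {x y} → ι x ≡ ι y → x ≈ y
  ι-inj {x} {y} e = ≈-trans (≈-sym (ε-ι x)) (≈-trans (FiniteField.reflexive F (cong ε e)) (ε-ι y))

  toV : ∀ {m} → Vect m → V m
  toV v = tabulate (ι ∘ v)

  fromV : ∀ {m} → V m → Vect m
  fromV v i = ε (lookup v i)

  toV-fromV : ∀ {m} (v : V m) → toV (fromV v) ≡ v
  toV-fromV v = trans (VecP.tabulate-cong (ι-ε ∘ lookup v)) (VecP.tabulate∘lookup v)

  toV-cong : ∀ {m} {u v : Vect m} → (∀ i → u i ≈ v i) → toV u ≡ toV v
  toV-cong h = VecP.tabulate-cong (ι-cong ∘ h)

  toV-inj : ∀ {m} {u v : Vect m} → toV u ≡ toV v → ∀ i → u i ≈ v i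
  toV-inj {u = u} {v} e i = ι-inj (trans (sym (VecP.lookup∘tabulate (ι ∘ u) i)) (trans (cong (λ w → lookup w i) e)
      (VecP.lookup∘tabulate (ι ∘ v) i)))

  toV-0 : ∀ {m} → toV {m} (λ _ → 0#) ≡ 0v
  toV-0 {zero} = refl
  toV-0 {suc m} = cong₂ _∷_ ι-0 toV-0

  toV-+ : ∀ {m} (u v : Vect m) → toV (λ i → u i + v i) ≡ toV u +v toV v
  toV-+ {zero} u v = refl
  toV-+ {suc m} u v = cong₂ _∷_ (ι-+ _ _) (toV-+ (u ∘ suc) (v ∘ suc))

  toV-* : ∀ {m} c (v : Vect m) → toV (λ i → c * v i) ≡ ι c *v toV v
  toV-* {zero} c v = refl
  toV-* {suc m} c v = cong₂ _∷_ (ι-* _ _) (toV-* c (v ∘ suc))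

  toV-lincomb : ∀ {d m} (c : Fin d → Carrier) (B : Fin d → Vect m) → toV (lincomb c B) ≡ comb (toV c) (tabulate
      (toV ∘ B))
  toV-lincomb {zero} c B = toV-0
  toV-lincomb {suc d} c B = trans (toV-+ _ (lincomb (c ∘ suc) (B ∘ suc))) (cong₂ _+v_ (toV-* (c zero) (B zero))
      (toV-lincomb (c ∘ suc) (B ∘ suc)))

  toV≡0 : ∀ {m} {v : Vect m} → (∀ i → v i ≈ 0#) → toV v ≡ 0v
  toV≡0 h = trans (toV-cong h) toV-0

  toV≡0⁻ : ∀ {m} {v : Vect m} → toV v ≡ 0v → ∀ i → v i ≈ 0#
  toV≡0⁻ e = toV-inj (trans e (sym toV-0))

  -- The rainbow-free hypothesis speaks of subspaces and is applied to kernels, so every kernel must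
  -- contain a subspace of dimension n - k. The conclusion goes back through `subspace-kernel`,
  -- which puts a kernel inside every subspace.
  kernel-subspace : ∀ n k → k ≤ n → (M : Mat k (suc n)) → ∃ λ (S : Subspace n (n ∸ k)) → ∀ P → P ∈S S → mv M (toV
      (vec P)) ≡ 0v
  kernel-subspace n k k≤n M with kernel-basis k (suc (n ∸ k)) (trans (ℕP.+-suc k (n ∸ k)) (cong suc
      (ℕP.m+[n∸m]≡n k≤n))) M
  ... | B , ind , ker = record { basis = fromV ∘ lookup B ; indep = λ c h → toV≡0⁻ (ind (toV c) (trans (sym
      (combine c)) (toV≡0 h))) }
      , λ P (c , h) → trans (cong (mv M) (trans (toV-cong h) (combine c))) (ker (toV c))
    where
    combine : ∀ c → toV (lincomb c (fromV ∘ lookup B)) ≡ comb (toV c) B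
    combine c = trans (toV-lincomb c (fromV ∘ lookup B)) (cong (comb (toV c)) (trans (VecP.tabulate-cong
        (toV-fromV ∘ lookup B)) (VecP.tabulate∘lookup B)))

  comb-fromV : ∀ {d m} (c : V d) (B : Fin d → Vect m) → toV (lincomb (fromV c) B) ≡ comb c (tabulate (toV ∘ B))
  comb-fromV c B = trans (toV-lincomb (fromV c) B) (cong (λ z → comb z (tabulate (toV ∘ B))) (toV-fromV c))

  LinIndep⇒Indep : ∀ {d m} (B : Fin d → Vect m) → LinIndep B → Indep (tabulate (toV ∘ B))
  LinIndep⇒Indep B ind c e = trans (sym (toV-fromV c))
    (toV≡0 {v = fromV c} (ind (fromV c) (toV≡0⁻ {v = lincomb (fromV c) B} (trans (comb-fromV c B) e))))

  span⇒lincomb : ∀ {d m} (B : Fin d → Vect m) (v : V m) c → v ≡ comb c (tabulate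
      (toV ∘ B)) → ∀ i → fromV v i ≈ lincomb (fromV c) B i
  span⇒lincomb B v c e = toV-inj {u = fromV v} {v = lincomb (fromV c) B} (trans (toV-fromV v) (trans e (sym
      (comb-fromV c B))))

  subspace-kernel : ∀ n k → k ≤ n → (S : Subspace n (n ∸ k)) →
    ∃ λ (M : Mat k (suc n)) → ∀ v → mv M v ≡ 0v → ∃ λ c → ∀ i → fromV v i ≈ lincomb c (basis S) i
  subspace-kernel n k k≤n S =
    let M , h = kernel⊆span (suc (n ∸ k)) k (cong suc (ℕP.m∸n+n≡m k≤n)) (tabulate (toV ∘ basis S)) (LinIndep⇒Indep
            (basis S) (indep S))
    in M , λ v e → fromV (proj₁ (h v e)) , span⇒lincomb (basis S) v (proj₁ (h v e)) (proj₂ (h v e))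

  mkPoint : ∀ {n} (v : V (suc n)) → v ≢ 0v → Point n
  mkPoint v v≢0 = pt (fromV v) (λ h → v≢0 (trans (sym (toV-fromV v)) (toV≡0 h)))

  toV-point≢0 : ∀ {n} (P : Point n) → toV (vec P) ≢ 0v
  toV-point≢0 P e = nonzero P (toV≡0⁻ e)

  proportional : ∀ {n} (P Q : Point n) c → c ≢ 0k → toV (vec Q) ≡ c *v toV (vec P) → P ∼ Q
  proportional P Q c c≢0 e = ε c , (λ z → c≢0 (trans (sym (ι-ε c)) (trans (ι-cong z) ι-0))) ,
    toV-inj (trans e (trans (cong (_*v toV (vec P)) (sym (ι-ε c))) (sym (toV-* (ε c) (vec P)))))

  mv-* : ∀ {k m} (M : Mat k m) c v → mv M v ≡ 0v → mv M (c *v v) ≡ 0v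
  mv-* M c v e = trans (cong (mv M) (sym (trans (cong (c *v v +v_) (0*v v)) (trans (+v-comm _ _) (+v-identityˡ _)))))
    (trans (mv-comb M v v c 0k) (trans (cong₂ _+v_ (trans (cong (c *v_) e) (*v-0 c)) (0*v _)) (+v-identityˡ 0v)))

  *v-assoc : ∀ {m} c d (v : V m) → c *v (d *v v) ≡ (c ⊗ d) *v v
  *v-assoc c d [] = refl
  *v-assoc c d (x ∷ v) = cong₂ _∷_ (sym (𝕂.*-assoc c d x)) (*v-assoc c d v)

  module _ {n N : ℕ} (χ′ : Coloring n N) where
    e₀≢0 : 1k ∷ 0v {n} ≢ 0v
    e₀≢0 e = 1≢0 (VecP.∷-injectiveˡ e)

    colour : V (suc n) → Fin N
    colour v with v ≟v 0v
    -- A default for the zero vector, which is not a point and never occurs among `reps`.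
    ... | yes _ = col χ′ (mkPoint (1k ∷ 0v) e₀≢0)
    ... | no v≢0 = col χ′ (mkPoint v v≢0)

    colour-point : ∀ (P : Point n) c → c ≢ 0k → ∀ v → v ≡ c *v toV (vec P) → colour v ≡ col χ′ P
    colour-point P c c≢0 v e with v ≟v 0v
    ... | no v≢0 = sym (col-resp χ′ P (mkPoint v v≢0) (proportional P (mkPoint v v≢0) c c≢0 (trans (toV-fromV v) e)))
    ... | yes v≡0 = ⊥-elim (scale-≢0 c _ c≢0 (toV-point≢0 P) (trans (sym e) v≡0))

    colour-mkPoint : ∀ v v≢0 → colour v ≡ col χ′ (mkPoint v v≢0)
    colour-mkPoint v v≢0 = colour-point (mkPoint v v≢0) 1k 1≢0 v (trans (sym (toV-fromV v)) (sym (1*v _)))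

    record Rep (P : Point n) : Set where
      field
        rep : V (suc n)
        coeff : Fin q
        coeff≢0 : coeff ≢ 0k
        rep≡ : rep ≡ coeff *v toV (vec P)
        member : rep ∈ class colour (col χ′ P)

    representative : ∀ P → Rep P
    representative P with normalise n (toV (vec P)) (toV-point≢0 P)
    ... | r , c , i , c≢0 , e = record { rep = r ; coeff = c ; coeff≢0 = c≢0 ; rep≡ = e
        ; member = ∈-filter⁺ (λ r → colour r ≟ col χ′ P) i (colour-point P c c≢0 r e) }
    open Rep

    rep-injective : ∀ P Q (p : Rep P) (s : Rep Q) → rep p ≡ rep s → P ∼ Q
    rep-injective P Q p s e with inverseK (coeff s) (coeff≢0 s)
    ... | d , cd = proportional P Q (d ⊗ coeff p) (𝕂.⊗-nonzero (λ z → 1≢0 (trans (sym cd) (trans (cong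
        (coeff s ⊗_) z) (𝕂.zeroʳ _)))) (coeff≢0 p))
      (trans (sym (1*v _)) (trans (cong (_*v toV (vec Q)) (trans (sym cd) (𝕂.*-comm _ _))) (trans (sym (*v-assoc d
          (coeff s) _))
        (trans (cong (d *v_) (trans (sym (rep≡ s)) (trans (sym e) (rep≡ p)))) (*v-assoc d (coeff p) _)))))

    classes-inhabited : Strict χ′ → All (λ C → 1 ≤ length C) (classes colour)
    classes-inhabited strict = AllP.map⁺ (All.tabulate (λ {c} _ → inhabited c (strict c)))
      where
      inhabited : ∀ c → (∃ λ P → col χ′ P ≡ c) → 1 ≤ length (class colour c)
      inhabited _ (P , refl) = nonempty (member (representative P))
        where
        nonempty : ∀ {A : Set} {x : A} {l} → x ∈ l → 1 ≤ length l
        nonempty (here _) = s≤s z≤n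
        nonempty (there _) = s≤s z≤n

    -- Non-proportional points have different representatives, so two points of equal colour in the
    -- subspace become two entries of one class in the kernel.
    rainbow-free⇒hit : ∀ k → k ≤ n → RainbowFree (n ∸ k) χ′ → ∀ (M : Mat k (suc n)) → Any (λ C → 2 ≤ cnt M C)
        (classes colour)
    rainbow-free⇒hit k k≤n rf M with kernel-subspace n k k≤n M
    ... | S , ker with rf S
    ...   | P , Q , P∈S , Q∈S , P≁Q , same = AnyP.map⁺ (lose (∈-allFin (col χ′ P)) (two-members M
        (member p) (subst (λ c → rep s ∈ class colour c) (sym same) (member s)) (λ e → P≁Q (rep-injective P Q p s e))
        (in-kernel P p P∈S) (in-kernel Q s Q∈S)))
      where
      p = representative P
      s = representative Q
      in-kernel : ∀ P (p : Rep P) → P ∈S S → mv M (rep p) ≡ 0v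
      in-kernel P p i = trans (cong (mv M) (rep≡ p)) (mv-* M (coeff p) (toV (vec P)) (ker P i))

    class-nonzero : ∀ {c v} → v ∈ class colour c → v ≢ 0v
    class-nonzero i = All.lookup (reps-nonzero n) (proj₁ (∈-class colour i))

    mkPoint-≁ : ∀ {u v : V (suc n)} (u≢0 : u ≢ 0v) (v≢0 : v ≢ 0v) → Indep2 u v → ¬ (mkPoint u u≢0 ∼ mkPoint v v≢0)
    mkPoint-≁ {u} {v} u≢0 v≢0 uv (d , _ , h) = 1≢0 (proj₂ (uv (⊖ ι d) 1k relation))
      where
      v≡ : v ≡ ι d *v u
      v≡ = trans (sym (toV-fromV v)) (trans (toV-cong {u = fromV v} h) (trans (toV-* d (fromV u)) (cong (ι d *v_)
          (toV-fromV u))))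
      relation : ⊖ ι d *v u +v 1k *v v ≡ 0v
      relation = trans (cong (⊖ ι d *v u +v_) (trans (1*v v) v≡)) (add-multiple u (⊖ ι d) (ι d) (𝕂.-‿inverseˡ (ι d)))

    col-class : ∀ {c v} (i : v ∈ class colour c) → col χ′ (mkPoint v (class-nonzero i)) ≡ c
    col-class {v = v} i = trans (sym (colour-mkPoint v (class-nonzero i))) (proj₂ (∈-class colour i))

    class-indep : ∀ {c u v} → u ∈ class colour c → v ∈ class colour c → u ≢ v → Indep2 u v
    class-indep i j = AllPairs-lookup Indep2-sym (reps-indep n) (proj₁ (∈-class colour i)) (proj₁ (∈-class colour j))

    class-unique : ∀ c → Unique (class colour c)
    class-unique c = AllPairs.map Indep2-irrefl (APP.filter⁺ (λ r → colour r ≟ c) (reps-indep n))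

    blocks⇒transversal : ∀ k → k ≤ n → ∀ c → TwoBlocks k (class colour c) → Mono2Transversal (n ∸ k) χ′ c
    blocks⇒transversal k k≤n c blocks S =
      let M , span = subspace-kernel n k k≤n S
          u , u∈ , Mu = cnt⇒∃ M (class colour c) (ℕP.≤-trans (s≤s z≤n) (blocks M))
          v , v∈ , Mv , v≢u = another M {u} (class-unique c) (blocks M)
          u≢0 = class-nonzero u∈
          v≢0 = class-nonzero v∈
      in mkPoint u u≢0 , mkPoint v v≢0 , span u Mu , span v Mv
        , mkPoint-≁ u≢0 v≢0 (class-indep u∈ v∈ (λ e → v≢u (sym e))) , col-class u∈ , col-class v∈

  -- The bound is asked for every d with d + N = θ_n in place of a truncated difference, and is then
  -- used at the excess of the classes.
  exists-transversal : ∀ {n₀ N} k → 3 ≤ q → 239 ≤ q ^ k → k ≤ suc n₀ → (χ′ : Coloring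
      (suc n₀) N) → Strict χ′ → RainbowFree (suc n₀ ∸ k) χ′ →
    (∀ d → d +ℕ N ≡ θ q (suc n₀) → 50 *ℕ (1 +ℕ d) ≤ 101 *ℕ q ^ k) → ∃ λ c → Mono2Transversal (suc n₀ ∸ k) χ′ c
  exists-transversal {n₀} {N} k q≥3 Q≥239 k≤n χ′ strict rf bound = proj₁ block , blocks⇒transversal χ′ k k≤n
      (proj₁ block) (proj₂ block)
    where
    Cs = classes (colour χ′)
    excess = tot (λ C → pred (length C)) Cs
    small : 50 *ℕ (1 +ℕ excess) ≤ 101 *ℕ q ^ k
    small = bound excess (total-excess (colour χ′) (classes-inhabited χ′ strict))
    abstract
      block : ∃ λ c → TwoBlocks k (class (colour χ′) c)
      block = satisfied (AnyP.map⁻ (some-class-blocks q≥3 Q≥239 Cs (classes-inhabited χ′ strict)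
        (classes-nonzero (colour χ′)) (classes-indep (colour χ′)) (classes-cross (colour χ′))
            (rainbow-free⇒hit χ′ k k≤n rf) small))

-- Moving the field structure to `Fin q`

module Transfer {q : ℕ} (F : FiniteField q) where
  open import Level using (0ℓ)
  open import Data.Fin using (Fin)
  open import Data.Product using (_,_; proj₁; proj₂)
  open import Relation.Binary.PropositionalEquality
  open import Algebra.Bundles.Raw using (RawRing)
  open import Algebra.Morphism.Structures using (IsRingMonomorphism)
  import Algebra.Morphism.RingMonomorphism as RingMonomorphism
  import Algebra.Structures
  open FiniteField F using (Carrier; _≈_; _+_; _*_; -_; 0#; 1#; enum; enum-inj; enum-surj; inverse; 1≉0)
  private module F = FiniteField F

  ι : Carrier → Fin q
  ι x = proj₁ (enum-surj x)

  enum-ι : ∀ x → enum (ι x) ≈ x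
  enum-ι x = proj₂ (enum-surj x)

  ι-cong : ∀ {x y} → x ≈ y → ι x ≡ ι y
  ι-cong {x} {y} e = enum-inj _ _ (F.trans (enum-ι x) (F.trans e (F.sym (enum-ι y))))

  ι-enum : ∀ i → ι (enum i) ≡ i
  ι-enum i = enum-inj _ _ (enum-ι (enum i))

  rawRing : RawRing 0ℓ 0ℓ
  rawRing = record { Carrier = Fin q ; _≈_ = _≡_
    ; _+_ = λ i j → ι (enum i + enum j) ; _*_ = λ i j → ι (enum i * enum j) ; -_ = λ i → ι
        (- enum i) ; 0# = ι 0# ; 1# = ι 1# }

  -- The operations are defined by transport along `enum`, which makes it a homomorphism by
  -- construction; its injectivity then pulls all ring laws back from `F`.
  enum-isRingMonomorphism : IsRingMonomorphism rawRing F.rawRing enum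
  enum-isRingMonomorphism = record
    { isRingHomomorphism = record
      { isSemiringHomomorphism = record
        { isNearSemiringHomomorphism = record
          { +-isMonoidHomomorphism = record
            { isMagmaHomomorphism = record { isRelHomomorphism = record { cong = λ e → F.reflexive
                (cong enum e) } ; homo = λ _ _ → enum-ι _ }
            ; ε-homo = enum-ι 0# }
          ; *-homo = λ _ _ → enum-ι _ }
        ; 1#-homo = enum-ι 1# }
      ; -‿homo = λ _ → enum-ι _ }
    ; injective = λ e → enum-inj _ _ e }

  𝕂 : FinField q
  𝕂 = record
    { isCommutativeRing = RingMonomorphism.isCommutativeRing enum-isRingMonomorphism F.isCommutativeRing
    ; 1≢0 = λ e → 1≉0 (F.trans (F.sym (enum-ι 1#)) (F.trans (F.reflexive (cong enum e)) (enum-ι 0#)))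
    ; inverse = λ i n → let y , e = inverse (enum i) (λ z → n (trans (sym (ι-enum i)) (ι-cong z)))
                        in ι y , ι-cong (F.trans (F.*-congˡ (enum-ι y)) e) }

  coordinates : Coordinates F 𝕂
  coordinates = record
    { ι = ι ; ε = enum ; ι-cong = ι-cong ; ε-ι = enum-ι ; ι-ε = ι-enum
    ; ι-+ = λ x y → ι-cong (F.sym (F.+-cong (enum-ι x) (enum-ι y)))
    ; ι-* = λ x y → ι-cong (F.sym (F.*-cong (enum-ι x) (enum-ι y)))
    ; ι-0 = refl }

-- The numerical hypothesis and the conclusion

open import Defs
open import Data.Nat using (ℕ; _+_; _*_; _∸_; _^_; _≤_)
open import Data.Nat.Primality using (Prime)
open import Data.Fin using (Fin)
open import Data.Product using (∃)
open import Data.Nat using (zero; suc; z≤n; s≤s)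
import Data.Nat
import Data.Nat.Properties as ℕP
open import Data.Nat.Solver using (module +-*-Solver)
open import Relation.Binary.PropositionalEquality using (_≡_; refl; trans; cong)

θ-geometric : ∀ r m → r * θ (suc r) m + 1 ≡ suc r ^ suc m
θ-geometric r zero = solve 1 (λ r → r :* con 1 :+ con 1 := (con 1 :+ r) :* con 1) refl r
  where open +-*-Solver
θ-geometric r (suc m) = trans (solve 3 (λ r t Q → r :* (t :+ Q) :+ con 1 := (r :* t :+ con 1) :+ r :* Q) refl r (θ
    (suc r) m) (suc r ^ suc m))
  (cong (_+ r * suc r ^ suc m) (θ-geometric r m))
  where open +-*-Solver

-- The geometric sum gives (q - 1) θ_m < q ^ (m + 1), and q - 1 ≥ 120.
θ-bound : ∀ q m → 121 ≤ q → 120 * θ q m ≤ q ^ suc m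
θ-bound (suc r) m (s≤s h) = ℕP.≤-trans (ℕP.*-monoˡ-≤ (θ (suc r) m) h) (ℕP.≤-trans (ℕP.m≤m+n _ 1) (ℕP.≤-reflexive
    (θ-geometric r m)))

-- With t = θ_{k-1} and t + Q = θ_k, the last hypothesis is the bound on N multiplied by 200, the
-- 500 being 200 + 300 from 1 + 3/2. It yields 200 (d + 1) ≤ 401 Q + 200 t, and 200 t ≤ 360 t ≤ 3 Q.
excess-bound : ∀ t T Q d N → d + N ≡ T → 120 * t ≤ Q → 200 * T + 200 * t + 500 ≤ 200 * N + 400 * (t + Q) + Q → 50 *
    (1 + d) ≤ 101 * Q
excess-bound t _ Q d N refl h le = ℕP.*-cancelˡ-≤ 4 (ℕP.+-cancelˡ-≤ (200 * N + 200 * t) _ _ (ℕP.≤-trans (ℕP.≤-trans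
  (ℕP.≤-trans (ℕP.m≤m+n _ 300) (ℕP.≤-reflexive (solve 3 (λ N t d → con 200 :* N :+ con 200 :* t :+ con 4 :*
      (con 50 :* (con 1 :+ d)) :+ con 300 := con 200 :* (d :+ N) :+ con 200 :* t :+ con 500) refl N t d))) le)
  (ℕP.≤-trans (ℕP.≤-reflexive (solve 3 (λ N t Q → con 200 :* N :+ con 400 :* (t :+ Q) :+ Q :=
      (con 200 :* N :+ con 200 :* t :+ con 401 :* Q) :+ con 200 :* t) refl N t Q))
  (ℕP.≤-trans (ℕP.+-monoʳ-≤ (200 * N + 200 * t + 401 * Q) (ℕP.≤-trans (ℕP.*-monoˡ-≤ t (ℕP.m≤m+n 200 160)) (ℕP.≤-trans
      (ℕP.≤-reflexive (ℕP.*-assoc 3 120 t)) (ℕP.*-monoʳ-≤ 3 h))))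
  (ℕP.≤-reflexive (solve 3 (λ N t Q →
      (con 200 :* N :+ con 200 :* t :+ con 401 :* Q) :+ con 3 :* Q := con 200 :* N :+ con 200 :* t :+ con 4 :*
      (con 101 :* Q)) refl N t Q))))))
  where open +-*-Solver

theorem1p8 : (n p h k : ℕ) → 2 ≤ n → Prime p → 2 ≤ h → 1 ≤ k → k ≤ n ∸ 1 →
    11 ≤ p → 239 ≤ (p ^ h) ^ k →
    (F : FiniteField (p ^ h)) → (N : ℕ) →
    (χ : Geometry.Coloring F n N) →
    Geometry.Strict F χ →
    Geometry.RainbowFree F (n ∸ k) χ →
    200 * θ (p ^ h) n + 200 * θ (p ^ h) (k ∸ 1) + 500
    ≤ 200 * N + 400 * θ (p ^ h) k + (p ^ h) ^ k →
    ∃ λ (c : Fin N) → Geometry.Mono2Transversal F (n ∸ k) χ c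
theorem1p8 (suc n) p (suc (suc h)) (suc k) 2≤n _ (s≤s (s≤s _)) 1≤k k≤n 11≤p 239≤Q F N χ strict rf bound =
  Geo.exists-transversal F (Transfer.𝕂 F) (Transfer.coordinates F) (suc k)
    (ℕP.≤-trans (s≤s (s≤s (s≤s z≤n))) 121≤q) 239≤Q (ℕP.≤-trans k≤n (ℕP.n≤1+n n)) χ strict rf
    (λ d e → excess-bound (θ q k) (θ q (suc n)) (q ^ suc k) d N e (θ-bound q k 121≤q) bound)
  where
  q = p ^ suc (suc h)
  -- Two factors p ≥ 11 are available because the exponent is at least 2.
  121≤q : 121 ≤ q
  121≤q = ℕP.*-mono-≤ 11≤p (ℕP.*-mono-≤ 11≤p (ℕP.m^n>0 p ⦃ Data.Nat.>-nonZero (ℕP.≤-trans (s≤s z≤n) 11≤p) ⦄ h))
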